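{- For every prime $p\ge5$ and every integer $m\ge1$, \[ M_{m,p}:=[q^{mp}]\,C(q)H(q^p)^m\equiv B_m\pmod{p^4}. \]
   Context: $A_n=27^n[z^n]\,{}_2F_1(\tfrac13,\tfrac13;1;z)^3$, $B_n=(-1)^nA_n$. $\chi_3(n)=\left(\frac{n}{3}\right)$; $C(q)=1+\sum_{n\ge1}c_nq^n$ with $c_n=3\sum_{d\mid n}\chi_3(d)d^4$; $t(q)=q\prod_{n\ge1}(1-q^{3n})^{12}(1-q^n)^{ -12}$, $H(q)=q/t(q)$. Congruence mod $p^4$ means the difference lies in $p^4\mathbf{Z}_{(p)}$. -}

module Defs where

open import Data.Nat as ℕ using (ℕ; zero; suc; _!; _≟_)
open import Data.Nat.Properties using (_!≢0)
open import Data.Nat.Divisibility using (_∣?_)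
open import Data.Integer as ℤ using (ℤ; +_; -[1+_])
open import Data.Rational using (ℚ; _/_; _+_; _*_; _-_; -_; 0ℚ; 1ℚ)
open import Data.Product using (∃₂; _×_)
open import Relation.Nullary using (¬_; yes; no)
open import Relation.Binary.PropositionalEquality using (_≡_)

ℕ→ℚ : ℕ → ℚ
ℕ→ℚ n = + n / 1

ℤ→ℚ : ℤ → ℚ
ℤ→ℚ z = z / 1

_^ℚ_ : ℚ → ℕ → ℚ
x ^ℚ zero = 1ℚ
x ^ℚ suc n = x * (x ^ℚ n)

sumTo : ℕ → (ℕ → ℚ) → ℚ
sumTo zero f = f 0
sumTo (suc n) f = sumTo n f + f (suc n)

Series : Set
Series = ℕ → ℚ

oneS : Series
oneS zero = 1ℚ
oneS (suc _) = 0ℚ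

_⊛_ : Series → Series → Series
(f ⊛ g) n = sumTo n (λ k → f k * g (n ℕ.∸ k))

_^S_ : Series → ℕ → Series
f ^S zero = oneS
f ^S suc m = f ⊛ (f ^S m)

dilate : ℕ → Series → Series
dilate p f n = sumTo n (λ k → if-eq (k ℕ.* p) n (f k))
  where
  if-eq : ℕ → ℕ → ℚ → ℚ
  if-eq a b x with a ≟ b
  ... | yes _ = x
  ... | no _ = 0ℚ

-- 1 - q^k   (k ≥ 1)
oneMinusQ : ℕ → Series
oneMinusQ k zero = 1ℚ
oneMinusQ k (suc n) with suc n ≟ k
... | yes _ = - 1ℚ
... | no _ = 0ℚ

-- (1 - q^k)^{-1} = Σ_j q^{kj}   (k ≥ 1)
geom : ℕ → Series
geom k n = sumTo n (λ j → ind (j ℕ.* k) n)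
  where
  ind : ℕ → ℕ → ℚ
  ind a b with a ≟ b
  ... | yes _ = 1ℚ
  ... | no _ = 0ℚ

prodS : ℕ → (ℕ → Series) → Series
prodS zero F = oneS
prodS (suc N) F = prodS N F ⊛ F (suc N)

-- Infinite product ∏_{n≥1} F n, where each F n ≡ 1 mod q^n:
-- the coefficient of q^N is that of the partial product over 1 ≤ n ≤ N.
prodInf : (ℕ → Series) → Series
prodInf F N = prodS N F N

-- t(q)/q = ∏_{n≥1} (1-q^{3n})^{12} (1-q^n)^{-12}
-- H(q) = q/t(q) = ∏_{n≥1} (1-q^n)^{12} (1-q^{3n})^{-12}
H : Series
H = prodInf (λ n → (oneMinusQ n ^S 12) ⊛ (geom (3 ℕ.* n) ^S 12))

χ₃ : ℕ → ℤ
χ₃ d with d ℕ.% 3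
... | 0 = + 0
... | 1 = + 1
... | _ = -[1+ 0 ]

cCoeff : ℕ → ℚ
cCoeff n = ℕ→ℚ 3 * sumTo n term
  where
  term : ℕ → ℚ
  term d with d ∣? n | d
  ... | yes _ | suc _ = ℤ→ℚ (χ₃ d) * (ℕ→ℚ d ^ℚ 4)
  ... | yes _ | zero = 0ℚ
  ... | no _ | _ = 0ℚ

C : Series
C zero = 1ℚ
C (suc n) = cCoeff (suc n)

M : ℕ → ℕ → ℚ
M m p = (C ⊛ (dilate p H ^S m)) (m ℕ.* p)

poch : ℚ → ℕ → ℚ
poch a zero = 1ℚ
poch a (suc k) = poch a k * (a + ℕ→ℚ k)

-- coefficients of ₂F₁(a,b;1;z) = Σ_k (a)_k (b)_k / ((1)_k k!) z^k, with (1)_k = k!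
invFact : ℕ → ℚ
invFact k = (+ 1 / (k !)) {{k !≢0}}

F21 : ℚ → ℚ → Series
F21 a b k = poch a k * poch b k * invFact k * invFact k

A : ℕ → ℚ
A n = (ℕ→ℚ 27 ^ℚ n) * ((F21 (+ 1 / 3) (+ 1 / 3) ^S 3) n)

B : ℕ → ℚ
B n = ((- 1ℚ) ^ℚ n) * A n

-- x ≡ y (mod p^k) in ℤ_(p): x - y = p^k a / b with a, b ∈ ℤ, p ∤ b
CongModPow : ℕ → ℕ → ℚ → ℚ → Set
CongModPow p k x y =
  ∃₂ λ (a b : ℤ) → ¬ (p Data.Nat.Divisibility.∣ ℤ.∣ b ∣)
                 × ((x - y) * ℤ→ℚ b ≡ ℤ→ℚ (+ (p ℕ.^ k)) * ℤ→ℚ a)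

{-# OPTIONS --safe #-}

-- Divisors of k p that are multiples of p contribute multiples of p⁴ to the k p-th coefficient of C, so C(q)
-- may be replaced by U_p C ≡ C and M_{m,p} ≡ [q^m] C H^m (mod p⁴). It remains to show [q^m] C H^m = B_m.
-- With P = (q dt/dq)/t, Lagrange inversion gives [q^m] F(t) P H^m = [t^m] F, so this says that
-- C = P · f(t)³ with f(t) = ₂F₁(1/3, 1/3; 1; -27 t); here f(t) is b(q) = η(q)³/η(q³), and P = a(q)².
--
-- The modular input is a closed system of five quadratic relations between Lambert series of level 3:
--   a² = P,  3 Da = a Y - N,  3 DY = Y² - a N,  DN = Y N - C,  C = P N,  where D = q d/dq.
-- It makes the second-order equation of f(t) factor through D - Λ, where DN = 3 Λ N, whence N = f(t)³.
-- Each relation is an instance of one summation: for X_k = q^k/(1 - q^k), the partial fraction identity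
-- X_k X_l = X_{k+l} (1 + X_k + X_l) evaluates Σ G(k, l) X_k X_l as a Lambert series plus a derivative whenever
-- G(k, l) = F(k, l) - F(k - l, l) with F and G symmetric.

module Submission where

open import Defs
open import Algebra.Bundles using (CommutativeRing)
import Algebra.Properties.Group as GroupProperties
import Algebra.Solver.Ring as RingSolver
open import Algebra.Solver.Ring.AlmostCommutativeRing using (fromCommutativeRing; _-Raw-AlmostCommutative⟶_)
open import Algebra.Structures using (IsCommutativeRing)
open import Data.Bool using (Bool; T; _∧_)
open import Data.Bool.Properties using (T-∧)
open import Data.Fin using (zero; suc)
open import Data.Integer as ℤ using (ℤ; +_; -[1+_])
import Data.Integer.Properties as ℤₚ
open import Data.Maybe using (just; nothing; is-just)
open import Data.Nat using (ℕ; _≤_)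
open import Data.Nat as ℕ using (zero; suc; z≤n; s≤s; _∸_; _≟_; _!)
open import Data.Nat.Coprimality using (Coprime; coprime-divisor)
open import Data.Nat.Divisibility using (_∣_; _∣?_; divides; ∣-refl; >⇒∤; ∣⇒≤; ∣m⇒∣m*n; ∣m+n∣m⇒∣n; ∣m∣n⇒∣m+n)
import Data.Nat.DivMod as DivMod
open import Data.Nat.Primality using (Prime; prime⇒irreducible; prime⇒nonZero)
import Data.Nat.Properties as ℕₚ
open import Data.Nat.Properties using (_!≢0)
open import Data.Product using (_,_; proj₁; proj₂)
open import Data.Rational as ℚ using (ℚ; 0ℚ; 1ℚ; _/_; _+_; _*_; -_; _-_; toℚᵘ)
import Data.Rational.Properties as ℚₚ
import Data.Rational.Unnormalised as ℚᵘ
import Data.Rational.Unnormalised.Properties as ℚᵘₚ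
open import Data.Sum using (inj₁; inj₂)
open import Data.Vec using ([]; _∷_)
open import Function using (_∘_)
open import Function.Bundles using (Equivalence)
open import Relation.Binary using (tri<; tri≈; tri>)
open import Relation.Binary.Definitions using (WeaklyDecidable)
open import Relation.Binary.PropositionalEquality
import Relation.Binary.Reasoning.Setoid as SetoidReasoning
open import Relation.Nullary using (¬_; yes; no; contradiction)

open GroupProperties ℚₚ.+-0-group using () renaming (∙-cancelʳ to +-cancelʳ)

-- No theory of modular forms enters. The series `a`, `Y`, `N` satisfy a level 3 analogue of
-- Ramanujan's system for E₂, E₄, E₆: every derivative is a polynomial in the generators. The later
-- modular identities are polynomial consequences of it, or follow because a power series solving a
-- first-order linear equation is fixed by its first coefficients. The second principle replaces
-- theta functions in the Borwein relation c³ = a³ - b³, where c³ = 27 t b³. The argument -27 t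
-- comes from the Borweins' a = ₂F₁(1/3, 2/3; 1; c³/a³) by Pfaff's transformation: for z = -27 t =
-- -c³/b³ one has 1 - z = a³/b³ and z/(z - 1) = c³/a³, hence ₂F₁(1/3, 1/3; 1; z) = (b/a) a = b. U_p
-- keeps the coefficients at multiples of p, so that [q^(mp)] C(q) G(q^p) = [q^m] (U_p C) G for
-- every series G. With G = H^m, which has integral coefficients, a congruence for U_p C passes to
-- M.

toℚᵘ-ℤ→ℚ : ∀ z → toℚᵘ (ℤ→ℚ z) ℚᵘ.≃ (z ℚᵘ./ 1)
toℚᵘ-ℤ→ℚ z = ℚₚ.toℚᵘ-fromℚᵘ (z ℚᵘ./ 1)

ℤ→ℚ-+ : ∀ x y → ℤ→ℚ (x ℤ.+ y) ≡ ℤ→ℚ x + ℤ→ℚ y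
ℤ→ℚ-+ x y = ℚₚ.toℚᵘ-injective (begin
  toℚᵘ (ℤ→ℚ (x ℤ.+ y))              ≈⟨ toℚᵘ-ℤ→ℚ (x ℤ.+ y) ⟩
  (x ℤ.+ y) ℚᵘ./ 1                  ≈⟨ ℚᵘ.*≡* (cong (ℤ._* + 1) (cong₂ ℤ._+_ (sym (ℤₚ.*-identityʳ x)) (sym (ℤₚ.*-identityʳ y)))) ⟩
  (x ℚᵘ./ 1) ℚᵘ.+ (y ℚᵘ./ 1)        ≈⟨ ℚᵘₚ.+-cong (toℚᵘ-ℤ→ℚ x) (toℚᵘ-ℤ→ℚ y) ⟨
  toℚᵘ (ℤ→ℚ x) ℚᵘ.+ toℚᵘ (ℤ→ℚ y)    ≈⟨ ℚₚ.toℚᵘ-homo-+ (ℤ→ℚ x) (ℤ→ℚ y) ⟨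
  toℚᵘ (ℤ→ℚ x + ℤ→ℚ y)              ∎)
  where open ℚᵘₚ.≃-Reasoning

ℤ→ℚ-* : ∀ x y → ℤ→ℚ (x ℤ.* y) ≡ ℤ→ℚ x * ℤ→ℚ y
ℤ→ℚ-* x y = ℚₚ.toℚᵘ-injective (begin
  toℚᵘ (ℤ→ℚ (x ℤ.* y))              ≈⟨ toℚᵘ-ℤ→ℚ (x ℤ.* y) ⟩
  (x ℚᵘ./ 1) ℚᵘ.* (y ℚᵘ./ 1)        ≈⟨ ℚᵘₚ.*-cong (toℚᵘ-ℤ→ℚ x) (toℚᵘ-ℤ→ℚ y) ⟨
  toℚᵘ (ℤ→ℚ x) ℚᵘ.* toℚᵘ (ℤ→ℚ y)    ≈⟨ ℚₚ.toℚᵘ-homo-* (ℤ→ℚ x) (ℤ→ℚ y) ⟨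
  toℚᵘ (ℤ→ℚ x * ℤ→ℚ y)              ∎)
  where open ℚᵘₚ.≃-Reasoning

ℤ→ℚ-neg : ∀ x → ℤ→ℚ (ℤ.- x) ≡ - ℤ→ℚ x
ℤ→ℚ-neg x = ℚₚ.toℚᵘ-injective (begin
  toℚᵘ (ℤ→ℚ (ℤ.- x))     ≈⟨ toℚᵘ-ℤ→ℚ (ℤ.- x) ⟩
  ℚᵘ.- (x ℚᵘ./ 1)        ≈⟨ ℚᵘₚ.-‿cong (toℚᵘ-ℤ→ℚ x) ⟨
  ℚᵘ.- toℚᵘ (ℤ→ℚ x)      ≈⟨ ℚₚ.toℚᵘ-homo‿- (ℤ→ℚ x) ⟨
  toℚᵘ (- ℤ→ℚ x)         ∎)
  where open ℚᵘₚ.≃-Reasoning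

-- Solver constants are integers, combined and compared in ℤ and only then mapped to the target
-- ring. The same scheme serves ℚ here and power series below, where equality itself is undecidable.
ℤ→ℚ-morphism : CommutativeRing.rawRing ℤₚ.+-*-commutativeRing
  -Raw-AlmostCommutative⟶ fromCommutativeRing ℚₚ.+-*-commutativeRing
ℤ→ℚ-morphism = record
  { ⟦_⟧ = ℤ→ℚ ; +-homo = ℤ→ℚ-+ ; *-homo = ℤ→ℚ-* ; -‿homo = ℤ→ℚ-neg
  ; 0-homo = refl ; 1-homo = refl }

_ℚ-coeff≟_ : WeaklyDecidable (λ x y → ℤ→ℚ x ≡ ℤ→ℚ y)
x ℚ-coeff≟ y with x ℤ.≟ y
... | yes x≡y = just (cong ℤ→ℚ x≡y)
... | no _ = nothing

module ℚ-Solver = RingSolver _ _ ℤ→ℚ-morphism _ℚ-coeff≟_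

ℕ→ℚ-suc : ∀ n → ℕ→ℚ (suc n) ≡ 1ℚ + ℕ→ℚ n
ℕ→ℚ-suc n = ℤ→ℚ-+ (+ 1) (+ n)

ℕ→ℚ-+ : ∀ m n → ℕ→ℚ (m ℕ.+ n) ≡ ℕ→ℚ m + ℕ→ℚ n
ℕ→ℚ-+ m n = ℤ→ℚ-+ (+ m) (+ n)

ℕ→ℚ-* : ∀ m n → ℕ→ℚ (m ℕ.* n) ≡ ℕ→ℚ m * ℕ→ℚ n
ℕ→ℚ-* m n = trans (cong ℤ→ℚ (ℤₚ.pos-* m n)) (ℤ→ℚ-* (+ m) (+ n))

ℕ→ℚ-injective : ∀ {m n} → ℕ→ℚ m ≡ ℕ→ℚ n → m ≡ n
ℕ→ℚ-injective {m} {n} eq =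
  ℤₚ.+-injective (ℤₚ.*-cancelʳ-≡ (+ m) (+ n) (+ 1) (ℚᵘₚ.drop-*≡*
    (ℚᵘₚ.≃-trans (ℚᵘₚ.≃-sym (toℚᵘ-ℤ→ℚ (+ m))) (ℚᵘₚ.≃-trans (ℚᵘₚ.≃-reflexive (cong toℚᵘ eq)) (toℚᵘ-ℤ→ℚ (+ n))))))

*-cancelˡ-suc : ∀ n {x y} → ℕ→ℚ (suc n) * x ≡ ℕ→ℚ (suc n) * y → x ≡ y
*-cancelˡ-suc n {x} {y} eq = begin
  x                ≡⟨ unit x ⟨
  i * (s * x)      ≡⟨ cong (i *_) eq ⟩
  i * (s * y)      ≡⟨ unit y ⟩
  y                ∎
  where
  open ≡-Reasoning
  s = ℕ→ℚ (suc n)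
  instance
    s≢0 : ℚ.NonZero s
    s≢0 = ℚ.≢-nonZero λ s≡0 → ℕₚ.1+n≢0 (ℕ→ℚ-injective {suc n} {0} s≡0)
  i = ℚ.1/ s
  unit : ∀ z → i * (s * z) ≡ z
  unit z = trans (sym (ℚₚ.*-assoc i s z)) (trans (cong (_* z) (ℚₚ.*-inverseˡ s)) (ℚₚ.*-identityˡ z))

-- Finite sums

sum-cong : ∀ n {f g : ℕ → ℚ} → (∀ {k} → k ℕ.≤ n → f k ≡ g k) → sumTo n f ≡ sumTo n g
sum-cong zero eq = eq z≤n
sum-cong (suc n) eq = cong₂ _+_ (sum-cong n (λ k≤n → eq (ℕₚ.m≤n⇒m≤1+n k≤n))) (eq ℕₚ.≤-refl)

sum-zero : ∀ n {f : ℕ → ℚ} → (∀ {k} → k ℕ.≤ n → f k ≡ 0ℚ) → sumTo n f ≡ 0ℚ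
sum-zero zero eq = eq z≤n
sum-zero (suc n) eq = cong₂ _+_ (sum-zero n (λ k≤n → eq (ℕₚ.m≤n⇒m≤1+n k≤n))) (eq ℕₚ.≤-refl)

sum-+ : ∀ n (f g : ℕ → ℚ) → sumTo n (λ k → f k + g k) ≡ sumTo n f + sumTo n g
sum-+ zero f g = refl
sum-+ (suc n) f g = trans (cong (_+ (f (suc n) + g (suc n))) (sum-+ n f g))
  (solve 4 (λ a b c d → (a :+ b) :+ (c :+ d) := (a :+ c) :+ (b :+ d)) refl (sumTo n f) (sumTo n g) (f (suc n)) (g (suc n)))
  where open ℚ-Solver

sum-*ˡ : ∀ n c (f : ℕ → ℚ) → sumTo n (λ k → c * f k) ≡ c * sumTo n f
sum-*ˡ zero c f = refl
sum-*ˡ (suc n) c f = trans (cong (_+ c * f (suc n)) (sum-*ˡ n c f)) (sym (ℚₚ.*-distribˡ-+ c (sumTo n f) (f (suc n))))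

sum-*ʳ : ∀ n c (f : ℕ → ℚ) → sumTo n (λ k → f k * c) ≡ sumTo n f * c
sum-*ʳ n c f = trans (sum-cong n (λ {k} _ → ℚₚ.*-comm (f k) c)) (trans (sum-*ˡ n c f) (ℚₚ.*-comm c _))

sum-neg : ∀ n (f : ℕ → ℚ) → sumTo n (λ k → - f k) ≡ - sumTo n f
sum-neg zero f = refl
sum-neg (suc n) f = trans (cong (_+ - f (suc n)) (sum-neg n f)) (sym (ℚₚ.neg-distrib-+ (sumTo n f) (f (suc n))))

sum-head : ∀ n (f : ℕ → ℚ) → sumTo (suc n) f ≡ f 0 + sumTo n (f ∘ suc)
sum-head zero f = refl
sum-head (suc n) f = trans (cong (_+ f (suc (suc n))) (sum-head n f)) (ℚₚ.+-assoc (f 0) (sumTo n (f ∘ suc)) (f (suc (suc n))))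

sum-swap : ∀ m n (f : ℕ → ℕ → ℚ) → sumTo m (λ i → sumTo n (f i)) ≡ sumTo n (λ j → sumTo m (λ i → f i j))
sum-swap zero n f = refl
sum-swap (suc m) n f = trans (cong (_+ sumTo n (f (suc m))) (sum-swap m n f)) (sym (sum-+ n (λ j → sumTo m (λ i → f i j)) (f (suc m))))

sum-truncate : ∀ {m n} {f : ℕ → ℚ} → m ℕ.≤ n → (∀ {k} → m ℕ.< k → f k ≡ 0ℚ) → sumTo n f ≡ sumTo m f
sum-truncate {m} {n} {f} m≤n eq with ℕₚ.m≤n⇒m<n∨m≡n m≤n
... | inj₂ refl = refl
sum-truncate {m} {suc n} m≤n eq | inj₁ (s≤s m≤n′) =
  trans (cong₂ _+_ (sum-truncate m≤n′ eq) (eq (s≤s m≤n′))) (ℚₚ.+-identityʳ _)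

sum-single : ∀ {n j} {f : ℕ → ℚ} → j ℕ.≤ n → (∀ {k} → k ≢ j → f k ≡ 0ℚ) → sumTo n f ≡ f j
sum-single {zero} z≤n eq = refl
sum-single {suc n} {j} {f} j≤ eq with ℕₚ.m≤n⇒m<n∨m≡n j≤
... | inj₁ (s≤s j≤n) = trans (cong₂ _+_ (sum-single j≤n eq) (eq (λ e → ℕₚ.<⇒≢ (s≤s j≤n) (sym e)))) (ℚₚ.+-identityʳ _)
... | inj₂ refl = trans (cong (_+ f (suc n)) (sum-zero n λ k≤n → eq (ℕₚ.<⇒≢ (s≤s k≤n)))) (ℚₚ.+-identityˡ (f (suc n)))

-- Formal power series

constS : ℚ → Series
constS c zero = c
constS c (suc _) = 0ℚ

addS : Series → Series → Series
addS f g n = f n + g n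

negS : Series → Series
negS f n = - f n

tailS : Series → Series
tailS f n = f (suc n)

⊛-suc : ∀ f g n → (f ⊛ g) (suc n) ≡ f 0 * g (suc n) + (tailS f ⊛ g) n
⊛-suc f g n = sum-head n _

⊛-sucʳ : ∀ f g n → (f ⊛ g) (suc n) ≡ (f ⊛ tailS g) n + f (suc n) * g 0
⊛-sucʳ f g n = cong₂ _+_ (sum-cong n λ {k} k≤n → cong (λ i → f k * g i) (ℕₚ.+-∸-assoc 1 k≤n))
  (cong (λ i → f (suc n) * g i) (ℕₚ.n∸n≡0 n))

⊛-cong-≤ : ∀ n {f f′ g g′} → (∀ {k} → k ℕ.≤ n → f k ≡ f′ k) → (∀ {k} → k ℕ.≤ n → g k ≡ g′ k) → (f ⊛ g) n ≡ (f′ ⊛ g′) n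
⊛-cong-≤ n p q = sum-cong n λ {k} k≤n → cong₂ _*_ (p k≤n) (q (ℕₚ.m∸n≤m n k))

⊛-cong : ∀ {f f′ g g′} → f ≗ f′ → g ≗ g′ → f ⊛ g ≗ f′ ⊛ g′
⊛-cong p q n = ⊛-cong-≤ n (λ {k} _ → p k) (λ {k} _ → q k)

⊛-distribʳ : ∀ h f g → addS f g ⊛ h ≗ addS (f ⊛ h) (g ⊛ h)
⊛-distribʳ h f g n = trans (sum-cong n λ {k} _ → ℚₚ.*-distribʳ-+ (h (n ∸ k)) (f k) (g k)) (sum-+ n _ _)

⊛-comm : ∀ f g → f ⊛ g ≗ g ⊛ f
⊛-comm f g zero = ℚₚ.*-comm (f 0) (g 0)
⊛-comm f g (suc n) = begin
  (f ⊛ g) (suc n)                       ≡⟨ ⊛-suc f g n ⟩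
  f 0 * g (suc n) + (tailS f ⊛ g) n     ≡⟨ ℚₚ.+-comm (f 0 * g (suc n)) _ ⟩
  (tailS f ⊛ g) n + f 0 * g (suc n)     ≡⟨ cong₂ _+_ (⊛-comm (tailS f) g n) (ℚₚ.*-comm (f 0) _) ⟩
  (g ⊛ tailS f) n + g (suc n) * f 0     ≡⟨ ⊛-sucʳ g f n ⟨
  (g ⊛ f) (suc n)                       ∎
  where open ≡-Reasoning

⊛-scaleˡ : ∀ c f g → (λ k → c * f k) ⊛ g ≗ (λ n → c * (f ⊛ g) n)
⊛-scaleˡ c f g n = trans (sum-cong n λ {k} _ → ℚₚ.*-assoc c (f k) (g (n ∸ k))) (sum-*ˡ n c _)

⊛-assoc : ∀ f g h → (f ⊛ g) ⊛ h ≗ f ⊛ (g ⊛ h)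
⊛-assoc f g h zero = ℚₚ.*-assoc (f 0) (g 0) (h 0)
⊛-assoc f g h (suc n) = begin
  ((f ⊛ g) ⊛ h) (suc n)
    ≡⟨ ⊛-suc (f ⊛ g) h n ⟩
  f 0 * g 0 * h (suc n) + (tailS (f ⊛ g) ⊛ h) n
    ≡⟨ cong (f 0 * g 0 * h (suc n) ℚ.+_) (⊛-cong {g = h} (⊛-suc f g) (λ _ → refl) n) ⟩
  f 0 * g 0 * h (suc n) + (addS (λ k → f 0 * tailS g k) (tailS f ⊛ g) ⊛ h) n
    ≡⟨ cong (f 0 * g 0 * h (suc n) ℚ.+_) (⊛-distribʳ h (λ k → f 0 * tailS g k) (tailS f ⊛ g) n) ⟩
  f 0 * g 0 * h (suc n) + (((λ k → f 0 * tailS g k) ⊛ h) n + ((tailS f ⊛ g) ⊛ h) n)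
    ≡⟨ cong (f 0 * g 0 * h (suc n) ℚ.+_) (cong₂ _+_ (⊛-scaleˡ (f 0) (tailS g) h n) (⊛-assoc (tailS f) g h n)) ⟩
  f 0 * g 0 * h (suc n) + (f 0 * (tailS g ⊛ h) n + (tailS f ⊛ (g ⊛ h)) n)
    ≡⟨ solve 5 (λ a b c d e → a :* b :* c :+ (a :* d :+ e) := a :* (b :* c :+ d) :+ e) refl (f 0) (g 0) (h (suc n)) _ _ ⟩
  f 0 * (g 0 * h (suc n) + (tailS g ⊛ h) n) + (tailS f ⊛ (g ⊛ h)) n
    ≡⟨ cong (λ x → f 0 * x + (tailS f ⊛ (g ⊛ h)) n) (⊛-suc g h n) ⟨
  f 0 * (g ⊛ h) (suc n) + (tailS f ⊛ (g ⊛ h)) n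
    ≡⟨ ⊛-suc f (g ⊛ h) n ⟨
  (f ⊛ (g ⊛ h)) (suc n) ∎
  where open ≡-Reasoning; open ℚ-Solver

constS-⊛ : ∀ c f → constS c ⊛ f ≗ λ n → c * f n
constS-⊛ c f n = sum-single {n} {0} z≤n λ
  { {zero} 0≢0 → contradiction refl 0≢0
  ; {suc k} _ → ℚₚ.*-zeroˡ (f (n ∸ suc k)) }

oneS≗𝟙 : oneS ≗ constS 1ℚ
oneS≗𝟙 zero = refl
oneS≗𝟙 (suc _) = refl

⊛-identityˡ : ∀ f → constS 1ℚ ⊛ f ≗ f
⊛-identityˡ f n = trans (constS-⊛ 1ℚ f n) (ℚₚ.*-identityˡ (f n))

-- The ring operations are opaque, and equality is a record, so that series expressions are compared
-- without unfolding them to coefficients.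

infix 4 _≈_
record _≈_ (f g : Series) : Set where
  constructor pointwise
  field at : f ≗ g
open _≈_ public

infixl 6 _⊕_ _⊝_
infixl 7 _·_
infix 8 ⊖_

𝟘 𝟙 : Series
𝟘 = constS 0ℚ
𝟙 = constS 1ℚ

𝟘-at : ∀ n → 𝟘 n ≡ 0ℚ
𝟘-at zero = refl
𝟘-at (suc _) = refl

opaque
  _⊕_ : Series → Series → Series
  _⊕_ = addS

  _·_ : Series → Series → Series
  _·_ = _⊛_

  ⊖_ : Series → Series
  ⊖_ = negS

  ⊕-at : ∀ f g n → (f ⊕ g) n ≡ f n + g n
  ⊕-at f g n = refl

  ·-at : ∀ f g n → (f · g) n ≡ (f ⊛ g) n
  ·-at f g n = refl

  ⊖-at : ∀ f n → (⊖ f) n ≡ - f n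
  ⊖-at f n = refl

  isCommutativeRing : IsCommutativeRing _≈_ _⊕_ _·_ ⊖_ 𝟘 𝟙
  isCommutativeRing = record
    { isRing = record
      { +-isAbelianGroup = record
        { isGroup = record
          { isMonoid = record
            { isSemigroup = record
              { isMagma = record
                { isEquivalence = record
                  { refl = pointwise λ _ → refl
                  ; sym = λ p → pointwise λ n → sym (at p n)
                  ; trans = λ p q → pointwise λ n → trans (at p n) (at q n) }
                ; ∙-cong = λ p q → pointwise λ n → cong₂ _+_ (at p n) (at q n) }
              ; assoc = λ f g h → pointwise λ n → ℚₚ.+-assoc (f n) (g n) (h n) }
            ; identity = (λ f → pointwise λ n → trans (cong (λ z → z + f n) (𝟘-at n)) (ℚₚ.+-identityˡ (f n)))
                         , (λ f → pointwise λ n → trans (cong (λ z → f n + z) (𝟘-at n)) (ℚₚ.+-identityʳ (f n))) }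
          ; inverse = (λ f → pointwise λ n → trans (ℚₚ.+-inverseˡ (f n)) (sym (𝟘-at n)))
                    , (λ f → pointwise λ n → trans (ℚₚ.+-inverseʳ (f n)) (sym (𝟘-at n)))
          ; ⁻¹-cong = λ p → pointwise λ n → cong -_ (at p n) }
        ; comm = λ f g → pointwise λ n → ℚₚ.+-comm (f n) (g n) }
      ; *-cong = λ p q → pointwise (⊛-cong (at p) (at q))
      ; *-assoc = λ f g h → pointwise (⊛-assoc f g h)
      ; *-identity = (λ f → pointwise (⊛-identityˡ f)) , (λ f → pointwise λ n → trans (⊛-comm f 𝟙 n) (⊛-identityˡ f n))
      ; distrib = (λ h f g → pointwise λ n → trans (⊛-comm h (addS f g) n) (trans (⊛-distribʳ h f g n)
                    (cong₂ _+_ (⊛-comm f h n) (⊛-comm g h n))))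
                , (λ h f g → pointwise (⊛-distribʳ h f g)) }
    ; *-comm = λ f g → pointwise (⊛-comm f g) }

_⊝_ : Series → Series → Series
f ⊝ g = f ⊕ ⊖ g

⊝-at : ∀ f g n → (f ⊝ g) n ≡ f n - g n
⊝-at f g n = trans (⊕-at f (⊖ g) n) (cong (λ x → f n + x) (⊖-at g n))

seriesRing : CommutativeRing _ _
seriesRing = record { isCommutativeRing = isCommutativeRing }

open CommutativeRing seriesRing public
  using ()
  renaming ( refl to ≈-refl; sym to ≈-sym; trans to ≈-trans
           ; +-cong to ⊕-cong; *-cong to ·-cong; -‿cong to ⊖-cong; *-assoc to ·-assoc; *-comm to ·-comm
           ; *-identityˡ to ·-identityˡ; *-identityʳ to ·-identityʳ; zeroˡ to ·-zeroˡ; zeroʳ to ·-zeroʳ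
           ; +-identityˡ to ⊕-identityˡ; +-identityʳ to ⊕-identityʳ )
module ≈-Reasoning = SetoidReasoning (CommutativeRing.setoid seriesRing)

·-cong-≤ : ∀ n {f f′ g g′} → (∀ {k} → k ℕ.≤ n → f k ≡ f′ k) → (∀ {k} → k ℕ.≤ n → g k ≡ g′ k) → (f · g) n ≡ (f′ · g′) n
·-cong-≤ n {f} {f′} {g} {g′} p q = trans (·-at f g n) (trans (⊛-cong-≤ n p q) (sym (·-at f′ g′ n)))

constS-· : ∀ c f n → (constS c · f) n ≡ c * f n
constS-· c f n = trans (·-at (constS c) f n) (constS-⊛ c f n)

ℤ→Series : ℤ → Series
ℤ→Series z = constS (ℤ→ℚ z)

ℤ→Series-morphism : CommutativeRing.rawRing ℤₚ.+-*-commutativeRing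
  -Raw-AlmostCommutative⟶ fromCommutativeRing seriesRing
ℤ→Series-morphism = record
  { ⟦_⟧ = ℤ→Series
  ; +-homo = λ x y → pointwise λ where
      zero → trans (ℤ→ℚ-+ x y) (sym (⊕-at (ℤ→Series x) (ℤ→Series y) 0))
      (suc n) → sym (⊕-at (ℤ→Series x) (ℤ→Series y) (suc n))
  ; *-homo = λ x y → pointwise λ where
      zero → trans (ℤ→ℚ-* x y) (sym (constS-· (ℤ→ℚ x) (ℤ→Series y) 0))
      (suc n) → sym (trans (constS-· (ℤ→ℚ x) (ℤ→Series y) (suc n)) (ℚₚ.*-zeroʳ (ℤ→ℚ x)))
  ; -‿homo = λ x → pointwise λ where
      zero → trans (ℤ→ℚ-neg x) (sym (⊖-at (ℤ→Series x) 0))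
      (suc n) → sym (⊖-at (ℤ→Series x) (suc n))
  ; 0-homo = ≈-refl
  ; 1-homo = ≈-refl }

_Series-coeff≟_ : WeaklyDecidable (λ x y → ℤ→Series x ≈ ℤ→Series y)
x Series-coeff≟ y with x ℤ.≟ y
... | yes x≡y = just (pointwise λ n → cong (λ z → ℤ→Series z n) x≡y)
... | no _ = nothing

module Series-Solver = RingSolver _ _ ℤ→Series-morphism _Series-coeff≟_

-- The tool for calculating modulo known relations: the ring solver first rewrites an expression as
-- the wanted one plus explicit multiples of differences p - q, with the cofactors supplied by hand,
-- and each difference is then removed by its relation.
drop-⊝ : ∀ y c {p q} → p ≈ q → y ⊕ c · (p ⊝ q) ≈ y
drop-⊝ y c {p} {q} p≈q = ≈-trans
  (⊕-cong ≈-refl (·-cong ≈-refl (⊕-cong p≈q ≈-refl)))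
  (solve 3 (λ y c q → y :+ c :* (q :- q) := y) ≈-refl y c q)
  where open Series-Solver

-- The Euler derivation q d/dq

D : Series → Series
D f n = ℕ→ℚ n * f n

D-cong : ∀ {f g} → f ≈ g → D f ≈ D g
D-cong p = pointwise λ n → cong (ℕ→ℚ n *_) (at p n)

D-⊕ : ∀ f g → D (f ⊕ g) ≈ D f ⊕ D g
D-⊕ f g = pointwise λ n → trans (cong (ℕ→ℚ n *_) (⊕-at f g n))
  (trans (ℚₚ.*-distribˡ-+ (ℕ→ℚ n) (f n) (g n)) (sym (⊕-at (D f) (D g) n)))

D-⊖ : ∀ f → D (⊖ f) ≈ ⊖ D f
D-⊖ f = pointwise λ n → trans (cong (ℕ→ℚ n *_) (⊖-at f n))
  (trans (sym (ℚₚ.neg-distribʳ-* (ℕ→ℚ n) (f n))) (sym (⊖-at (D f) n)))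

D-⊝ : ∀ f g → D (f ⊝ g) ≈ D f ⊝ D g
D-⊝ f g = ≈-trans (D-⊕ f (⊖ g)) (⊕-cong ≈-refl (D-⊖ g))

D-constS : ∀ c → D (constS c) ≈ 𝟘
D-constS c = pointwise λ where
  zero → ℚₚ.*-zeroˡ c
  (suc n) → ℚₚ.*-zeroʳ (ℕ→ℚ (suc n))

D-⊛ : ∀ f g → D (f ⊛ g) ≗ addS (D f ⊛ g) (f ⊛ D g)
D-⊛ f g n = begin
  ℕ→ℚ n * sumTo n (λ k → f k * g (n ∸ k))
    ≡⟨ sum-*ˡ n (ℕ→ℚ n) (λ k → f k * g (n ∸ k)) ⟨
  sumTo n (λ k → ℕ→ℚ n * (f k * g (n ∸ k)))
    ≡⟨ sum-cong n split ⟩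
  sumTo n (λ k → D f k * g (n ∸ k) + f k * D g (n ∸ k))
    ≡⟨ sum-+ n (λ k → D f k * g (n ∸ k)) (λ k → f k * D g (n ∸ k)) ⟩
  (D f ⊛ g) n + (f ⊛ D g) n ∎
  where
  open ≡-Reasoning
  open ℚ-Solver
  split : ∀ {k} → k ℕ.≤ n → ℕ→ℚ n * (f k * g (n ∸ k)) ≡ D f k * g (n ∸ k) + f k * D g (n ∸ k)
  split {k} k≤n = trans
    (cong (_* (f k * g (n ∸ k))) (trans (cong ℕ→ℚ (sym (ℕₚ.m+[n∸m]≡n k≤n))) (ℕ→ℚ-+ k (n ∸ k))))
    (solve 4 (λ a b x y → (a :+ b) :* (x :* y) := a :* x :* y :+ x :* (b :* y)) refl (ℕ→ℚ k) (ℕ→ℚ (n ∸ k)) (f k) (g (n ∸ k)))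

D-· : ∀ f g → D (f · g) ≈ D f · g ⊕ f · D g
D-· f g = pointwise λ n → trans (cong (ℕ→ℚ n *_) (·-at f g n)) (trans (D-⊛ f g n)
  (sym (trans (⊕-at (D f · g) (f · D g) n) (cong₂ _+_ (·-at (D f) g n) (·-at f (D g) n)))))

D-constS-· : ∀ c f → D (constS c · f) ≈ constS c · D f
D-constS-· c f = ≈-trans (D-· (constS c) f)
  (≈-trans (⊕-cong (≈-trans (·-cong (D-constS c) ≈-refl) (·-zeroˡ f)) ≈-refl) (⊕-identityˡ (constS c · D f)))

-- Geometric series and X k = q^k / (1 - q^k)

qPow : ℕ → Series
qPow zero n = constS 1ℚ n
qPow (suc k) zero = 0ℚ
qPow (suc k) (suc n) = qPow k n

qPow-diag : ∀ k → qPow k k ≡ 1ℚ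
qPow-diag zero = refl
qPow-diag (suc k) = qPow-diag k

qPow-off : ∀ {k n} → k ≢ n → qPow k n ≡ 0ℚ
qPow-off {zero} {zero} 0≢0 = contradiction refl 0≢0
qPow-off {zero} {suc n} _ = refl
qPow-off {suc k} {zero} _ = refl
qPow-off {suc k} {suc n} k≢n = qPow-off (k≢n ∘ cong suc)

qPow-·-suc : ∀ k f n → (qPow (suc k) · f) (suc n) ≡ (qPow k · f) n
qPow-·-suc k f n = begin
  (qPow (suc k) · f) (suc n)              ≡⟨ ·-at (qPow (suc k)) f (suc n) ⟩
  (qPow (suc k) ⊛ f) (suc n)              ≡⟨ ⊛-suc (qPow (suc k)) f n ⟩
  0ℚ * f (suc n) + (qPow k ⊛ f) n         ≡⟨ cong (_+ (qPow k ⊛ f) n) (ℚₚ.*-zeroˡ (f (suc n))) ⟩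
  0ℚ + (qPow k ⊛ f) n                     ≡⟨ ℚₚ.+-identityˡ _ ⟩
  (qPow k ⊛ f) n                          ≡⟨ ·-at (qPow k) f n ⟨
  (qPow k · f) n                          ∎
  where open ≡-Reasoning

qPow-·-zero : ∀ k f → (qPow (suc k) · f) 0 ≡ 0ℚ
qPow-·-zero k f = trans (·-at (qPow (suc k)) f 0) (ℚₚ.*-zeroˡ (f 0))

qPow-·-shift : ∀ k f n → (qPow k · f) (k ℕ.+ n) ≡ f n
qPow-·-shift zero f n = at (·-identityˡ f) n
qPow-·-shift (suc k) f n = trans (qPow-·-suc k f (k ℕ.+ n)) (qPow-·-shift k f n)

qPow-·-< : ∀ {k n} f → n ℕ.< k → (qPow k · f) n ≡ 0ℚ
qPow-·-< {suc k} {zero} f _ = qPow-·-zero k f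
qPow-·-< {suc k} {suc n} f (s≤s n<k) = trans (qPow-·-suc k f n) (qPow-·-< f n<k)

qPow-+ : ∀ k l → qPow k · qPow l ≈ qPow (k ℕ.+ l)
qPow-+ zero l = ·-identityˡ (qPow l)
qPow-+ (suc k) l = pointwise λ where
  zero → qPow-·-zero k (qPow l)
  (suc n) → trans (qPow-·-suc k (qPow l) n) (at (qPow-+ k l) n)

D-qPow : ∀ k → D (qPow k) ≈ constS (ℕ→ℚ k) · qPow k
D-qPow k = pointwise eq
  where
  eq : ∀ n → D (qPow k) n ≡ (constS (ℕ→ℚ k) · qPow k) n
  eq n with k ≟ n
  ... | yes refl = sym (constS-· (ℕ→ℚ k) (qPow k) k)
  ... | no k≢n = trans (zeros (ℕ→ℚ n)) (sym (trans (constS-· (ℕ→ℚ k) (qPow k) n) (zeros (ℕ→ℚ k))))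
    where
    zeros : ∀ c → c * qPow k n ≡ 0ℚ
    zeros c = trans (cong (c *_) (qPow-off k≢n)) (ℚₚ.*-zeroʳ c)

oneMinusQ≈ : ∀ k → oneMinusQ (suc k) ≈ 𝟙 ⊝ qPow (suc k)
oneMinusQ≈ k = pointwise λ n → trans (eq n) (sym (⊝-at 𝟙 (qPow (suc k)) n))
  where
  eq : ∀ n → oneMinusQ (suc k) n ≡ 𝟙 n - qPow (suc k) n
  eq zero = refl
  eq (suc n) with suc n ≟ suc k
  ... | yes refl = cong (λ x → 0ℚ - x) (sym (qPow-diag k))
  ... | no n≢k = cong (λ x → 0ℚ - x) (sym (qPow-off λ k≡n → n≢k (cong suc (sym k≡n))))

-- The summand of `geom` is local to a `where` block and cannot be named; unification against `refl`
-- recovers it as the implicit `f`.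
summand : ∀ {n f} (x : ℚ) → x ≡ sumTo n f → ℕ → ℚ
summand {f = f} _ _ = f

geomTerm : ℕ → ℕ → ℕ → ℚ
geomTerm k n = summand {n} (geom k n) refl

geomTerm-≡ : ∀ k n i → i ℕ.* k ≡ n → geomTerm k n i ≡ 1ℚ
geomTerm-≡ k n i eq with i ℕ.* k ≟ n
... | yes _ = refl
... | no neq = contradiction eq neq

geomTerm-≢ : ∀ k n i → i ℕ.* k ≢ n → geomTerm k n i ≡ 0ℚ
geomTerm-≢ k n i neq with i ℕ.* k ≟ n
... | yes eq = contradiction eq neq
... | no _ = refl

geom-∣ : ∀ {k n} → suc k ∣ n → geom (suc k) n ≡ 1ℚ
geom-∣ {k} {n} (divides j refl) = trans
  (sum-single {j = j} (ℕₚ.m≤m*n j (suc k)) λ {i} i≢j → geomTerm-≢ (suc k) n i (i≢j ∘ ℕₚ.*-cancelʳ-≡ i j (suc k)))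
  (geomTerm-≡ (suc k) n j refl)

geom-∤ : ∀ {k n} → ¬ k ∣ n → geom k n ≡ 0ℚ
geom-∤ {k} {n} k∤n = sum-zero n λ {i} _ → geomTerm-≢ k n i λ eq → k∤n (divides i (sym eq))

geom-periodic : ∀ k n → geom (suc k) (suc k ℕ.+ n) ≡ geom (suc k) n
geom-periodic k n with suc k ∣? n
... | yes k∣n = trans (geom-∣ (∣m∣n⇒∣m+n ∣-refl k∣n)) (sym (geom-∣ k∣n))
... | no k∤n = trans (geom-∤ λ k∣ → k∤n (∣m+n∣m⇒∣n k∣ ∣-refl)) (sym (geom-∤ k∤n))

geom-< : ∀ {k n} → n ℕ.< suc k → geom (suc k) n ≡ 𝟙 n
geom-< {k} {zero} _ = geom-∣ {k} (divides 0 refl)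
geom-< {k} {suc n} n<k = geom-∤ (>⇒∤ n<k)

X : ℕ → Series
X k = qPow k · geom k

-- This is g = 1 + q^k g, the equation that characterises 1/(1 - q^k). Below q^k both sides are 1;
-- from there on it is the periodicity of the coefficients.
geom≈ : ∀ k → geom (suc k) ≈ 𝟙 ⊕ X (suc k)
geom≈ k = pointwise λ n → trans (eq n) (sym (⊕-at 𝟙 (X (suc k)) n))
  where
  eq : ∀ n → geom (suc k) n ≡ 𝟙 n + X (suc k) n
  eq n with n ℕ.<? suc k
  ... | yes n<k = trans (geom-< n<k) (sym (trans (cong (𝟙 n ℚ.+_) (qPow-·-< (geom (suc k)) n<k)) (ℚₚ.+-identityʳ (𝟙 n))))
  ... | no n≮k with n ∸ suc k | ℕₚ.m+[n∸m]≡n (ℕₚ.≮⇒≥ n≮k)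
  ...   | m | refl = trans (geom-periodic k m) (sym (trans (ℚₚ.+-identityˡ _) (qPow-·-shift (suc k) (geom (suc k)) m)))

X-< : ∀ {k n} → n ℕ.< k → X k n ≡ 0ℚ
X-< {k} = qPow-·-< (geom k)

X-suc : ∀ k n → X (suc k) (suc n) ≡ geom (suc k) (suc n)
X-suc k n = sym (trans (at (geom≈ k) (suc n)) (trans (⊕-at 𝟙 (X (suc k)) (suc n)) (ℚₚ.+-identityˡ _)))

-- With u = q^k and v = q^l the bracket equals (1 - uv)/((1 - u)(1 - v)), and its numerator cancels
-- the denominator of X_{k+l}.
X-·-X : ∀ k l → X (suc k) · X (suc l) ≈ X (suc k ℕ.+ suc l) · (𝟙 ⊕ X (suc k) ⊕ X (suc l))
X-·-X k l = ≈-sym (begin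
  X (suc k ℕ.+ suc l) · (𝟙 ⊕ X (suc k) ⊕ X (suc l))
    ≈⟨ ·-cong X-kl ≈-refl ⟩
  u · v · w · (𝟙 ⊕ u · g ⊕ v · h)
    ≈⟨ solve 5 (λ u v g h w → u :* v :* w :* (con (+ 1) :+ u :* g :+ v :* h)
        := u :* g :* (v :* h)
           :+ u :* v :* g :* h :* (w :- (con (+ 1) :+ u :* v :* w))
           :+ :- (u :* v :* w :* h) :* (g :- (con (+ 1) :+ u :* g))
           :+ :- (u :* v :* w :* (con (+ 1) :+ u :* g)) :* (h :- (con (+ 1) :+ v :* h)))
        ≈-refl u v g h w ⟩
  u · g · (v · h) ⊕ u · v · g · h · (w ⊝ (𝟙 ⊕ u · v · w)) ⊕ (⊖ (u · v · w · h)) · (g ⊝ (𝟙 ⊕ u · g))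
    ⊕ (⊖ (u · v · w · (𝟙 ⊕ u · g))) · (h ⊝ (𝟙 ⊕ v · h))
    ≈⟨ drop-⊝ _ _ (geom≈ l) ⟩
  u · g · (v · h) ⊕ u · v · g · h · (w ⊝ (𝟙 ⊕ u · v · w)) ⊕ (⊖ (u · v · w · h)) · (g ⊝ (𝟙 ⊕ u · g))
    ≈⟨ drop-⊝ _ _ (geom≈ k) ⟩
  u · g · (v · h) ⊕ u · v · g · h · (w ⊝ (𝟙 ⊕ u · v · w))
    ≈⟨ drop-⊝ _ _ (≈-trans (geom≈ (k ℕ.+ suc l)) (⊕-cong ≈-refl X-kl)) ⟩
  u · g · (v · h) ∎)
  where
  open ≈-Reasoning
  open Series-Solver
  u = qPow (suc k)
  v = qPow (suc l)
  g = geom (suc k)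
  h = geom (suc l)
  w = geom (suc k ℕ.+ suc l)
  X-kl : X (suc k ℕ.+ suc l) ≈ u · v · w
  X-kl = ·-cong (≈-sym (qPow-+ (suc k) (suc l))) ≈-refl

D-X : ∀ k → D (X (suc k)) ≈ constS (ℕ→ℚ (suc k)) · (X (suc k) ⊕ X (suc k) · X (suc k))
D-X k = begin
  D (u · g)
    ≈⟨ D-· u g ⟩
  D u · g ⊕ u · D g
    ≈⟨ solve 4 (λ u g du dg → du :* g :+ u :* dg
        := du :* g :* (con (+ 1) :+ u :* g)
           :+ u :* g :* (dg :- (du :* g :+ u :* dg))
           :+ :- (u :* dg) :* (g :- (con (+ 1) :+ u :* g)))
        ≈-refl u g (D u) (D g) ⟩
  D u · g · (𝟙 ⊕ u · g) ⊕ u · g · (D g ⊝ (D u · g ⊕ u · D g)) ⊕ (⊖ (u · D g)) · (g ⊝ (𝟙 ⊕ u · g))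
    ≈⟨ drop-⊝ _ _ (geom≈ k) ⟩
  D u · g · (𝟙 ⊕ u · g) ⊕ u · g · (D g ⊝ (D u · g ⊕ u · D g))
    ≈⟨ drop-⊝ _ _ D-g ⟩
  D u · g · (𝟙 ⊕ u · g)
    ≈⟨ ·-cong (·-cong (D-qPow (suc k)) ≈-refl) ≈-refl ⟩
  c · u · g · (𝟙 ⊕ u · g)
    ≈⟨ solve 3 (λ c u g → c :* u :* g :* (con (+ 1) :+ u :* g) := c :* (u :* g :+ u :* g :* (u :* g))) ≈-refl c u g ⟩
  c · (u · g ⊕ u · g · (u · g)) ∎
  where
  open ≈-Reasoning
  open Series-Solver
  u = qPow (suc k)
  g = geom (suc k)
  c = constS (ℕ→ℚ (suc k))
  D-g : D g ≈ D u · g ⊕ u · D g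
  D-g = ≈-trans (D-cong (geom≈ k)) (≈-trans (D-⊕ 𝟙 (u · g))
    (≈-trans (⊕-cong (D-constS 1ℚ) (D-· u g)) (⊕-identityˡ (D u · g ⊕ u · D g))))

-- Double sums

sum-square : ∀ K (h : ℕ → ℕ → ℚ) → sumTo (suc K) (λ i → sumTo (suc K) (h i))
  ≡ sumTo (suc K) (λ i → h i i) + sumTo K (λ s → sumTo s (λ j → h (suc s) j + h j (suc s)))
sum-square K h = trans (top K) (shape K)
  where
  open ≡-Reasoning
  open ℚ-Solver
  rim : ℕ → ℚ
  rim s = sumTo s (λ j → h (suc s) j + h j (suc s))
  top : ∀ K → sumTo (suc K) (λ i → sumTo (suc K) (h i)) ≡ sumTo K (λ i → sumTo K (h i)) + rim K + h (suc K) (suc K)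
  top K = begin
    sumTo K (λ i → sumTo K (h i) + h i (suc K)) + (sumTo K (h (suc K)) + h (suc K) (suc K))
      ≡⟨ cong (_+ (sumTo K (h (suc K)) + h (suc K) (suc K))) (sum-+ K (λ i → sumTo K (h i)) (λ i → h i (suc K))) ⟩
    sumTo K (λ i → sumTo K (h i)) + sumTo K (λ i → h i (suc K)) + (sumTo K (h (suc K)) + h (suc K) (suc K))
      ≡⟨ solve 4 (λ a b c d → a :+ b :+ (c :+ d) := a :+ (c :+ b) :+ d) refl
          (sumTo K (λ i → sumTo K (h i))) (sumTo K (λ i → h i (suc K))) (sumTo K (h (suc K))) (h (suc K) (suc K)) ⟩
    sumTo K (λ i → sumTo K (h i)) + (sumTo K (h (suc K)) + sumTo K (λ i → h i (suc K))) + h (suc K) (suc K)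
      ≡⟨ cong (λ z → sumTo K (λ i → sumTo K (h i)) + z + h (suc K) (suc K)) (sum-+ K (h (suc K)) (λ i → h i (suc K))) ⟨
    sumTo K (λ i → sumTo K (h i)) + rim K + h (suc K) (suc K) ∎
  shape : ∀ K → sumTo K (λ i → sumTo K (h i)) + rim K + h (suc K) (suc K)
    ≡ sumTo (suc K) (λ i → h i i) + sumTo K rim
  shape zero = solve 3 (λ a b c → a :+ b :+ c := a :+ c :+ b) refl (h 0 0) (rim 0) (h 1 1)
  shape (suc K) = trans (cong (λ z → z + rim (suc K) + h (2 ℕ.+ K) (2 ℕ.+ K)) (trans (top K) (shape K)))
    (solve 4 (λ a b c d → a :+ b :+ c :+ d := a :+ d :+ (b :+ c)) refl
      (sumTo (suc K) (λ i → h i i)) (sumTo K rim) (rim (suc K)) (h (2 ℕ.+ K) (2 ℕ.+ K)))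

-- Passing from K to K + 1 lengthens every row by one entry, and the new entries form the next
-- antidiagonal.
sum-triangle : ∀ K (v : ℕ → ℕ → ℚ) → sumTo K (λ i → sumTo (K ∸ i) (v i)) ≡ sumTo K (λ s → sumTo s (λ i → v i (s ∸ i)))
sum-triangle zero v = refl
sum-triangle (suc K) v = begin
  sumTo K (λ i → sumTo (suc K ∸ i) (v i)) + sumTo (suc K ∸ suc K) (v (suc K))
    ≡⟨ cong₂ _+_ (sum-cong K λ {i} i≤K → trans (cong (λ t → sumTo t (v i)) (ℕₚ.+-∸-assoc 1 i≤K))
                    (cong (λ t → sumTo (K ∸ i) (v i) + v i t) (sym (ℕₚ.+-∸-assoc 1 i≤K))))
                 (trans (cong (λ t → sumTo t (v (suc K))) (ℕₚ.n∸n≡0 (suc K))) (cong (v (suc K)) (sym (ℕₚ.n∸n≡0 (suc K))))) ⟩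
  sumTo K (λ i → sumTo (K ∸ i) (v i) + v i (suc K ∸ i)) + v (suc K) (suc K ∸ suc K)
    ≡⟨ cong (_+ v (suc K) (suc K ∸ suc K)) (sum-+ K (λ i → sumTo (K ∸ i) (v i)) (λ i → v i (suc K ∸ i))) ⟩
  sumTo K (λ i → sumTo (K ∸ i) (v i)) + sumTo K (λ i → v i (suc K ∸ i)) + v (suc K) (suc K ∸ suc K)
    ≡⟨ ℚₚ.+-assoc (sumTo K (λ i → sumTo (K ∸ i) (v i))) _ _ ⟩
  sumTo K (λ i → sumTo (K ∸ i) (v i)) + sumTo (suc K) (λ i → v i (suc K ∸ i))
    ≡⟨ cong (_+ sumTo (suc K) (λ i → v i (suc K ∸ i))) (sum-triangle K v) ⟩
  sumTo (suc K) (λ s → sumTo s (λ i → v i (s ∸ i))) ∎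
  where open ≡-Reasoning

sum-square-triangle : ∀ K (v : ℕ → ℕ → ℚ) → (∀ i j → K ℕ.< i ℕ.+ j → v i j ≡ 0ℚ) →
  sumTo K (λ i → sumTo K (v i)) ≡ sumTo K (λ s → sumTo s (λ i → v i (s ∸ i)))
sum-square-triangle K v v≡0 = trans
  (sum-cong K λ {i} i≤K → sum-truncate (ℕₚ.m∸n≤m K i) λ {j} K∸i<j →
    v≡0 i j (subst (ℕ._< i ℕ.+ j) (ℕₚ.m+[n∸m]≡n i≤K) (ℕₚ.+-monoʳ-< i K∸i<j)))
  (sum-triangle K v)

sum-product : ∀ m n (f g : ℕ → ℚ) → sumTo m f * sumTo n g ≡ sumTo m (λ i → sumTo n (λ j → f i * g j))
sum-product m n f g = trans (sym (sum-*ʳ m (sumTo n g) f)) (sum-cong m λ {i} _ → sym (sum-*ˡ n (f i) g))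

-- Lambert series Σ g(k) X_k and their products

-- The infinite sum over k ≥ 1 is cut off at k = n + 1. This is harmless, and its last term is
-- already zero, because X_k starts at q^k.
Lam : (ℕ → ℚ) → Series
Lam g n = sumTo n (λ i → g (suc i) * X (suc i) n)

Lam-extend : ∀ {n K} g → n ℕ.≤ K → Lam g n ≡ sumTo K (λ i → g (suc i) * X (suc i) n)
Lam-extend {n} g n≤K = sym (sum-truncate n≤K λ {i} n<i →
  trans (cong (g (suc i) *_) (X-< (ℕₚ.m≤n⇒m≤1+n n<i))) (ℚₚ.*-zeroʳ (g (suc i))))

Lam-cong : ∀ {f g} → (∀ k → f (suc k) ≡ g (suc k)) → Lam f ≈ Lam g
Lam-cong p = pointwise λ n → sum-cong n λ {i} _ → cong (_* X (suc i) n) (p i)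

Lam-⊕ : ∀ f g → Lam (λ k → f k + g k) ≈ Lam f ⊕ Lam g
Lam-⊕ f g = pointwise λ n → trans (sum-cong n λ {i} _ → ℚₚ.*-distribʳ-+ (X (suc i) n) (f (suc i)) (g (suc i)))
  (trans (sum-+ n (λ i → f (suc i) * X (suc i) n) (λ i → g (suc i) * X (suc i) n)) (sym (⊕-at (Lam f) (Lam g) n)))

Lam-* : ∀ c f → Lam (λ k → c * f k) ≈ constS c · Lam f
Lam-* c f = pointwise λ n → trans (sum-cong n λ {i} _ → ℚₚ.*-assoc c (f (suc i)) (X (suc i) n))
  (trans (sum-*ˡ n c (λ i → f (suc i) * X (suc i) n)) (sym (constS-· c (Lam f) n)))

squareSum : (ℕ → ℚ) → Series
squareSum f n = sumTo n (λ i → f (suc i) * (X (suc i) · X (suc i)) n)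

squareSum-cong : ∀ {f g} → (∀ k → f (suc k) ≡ g (suc k)) → squareSum f ≈ squareSum g
squareSum-cong p = pointwise λ n → sum-cong n λ {i} _ → cong (_* (X (suc i) · X (suc i)) n) (p i)

-- From D X_k = k (X_k + X_k²). Read backwards, it turns the diagonal terms X_k² left over in a
-- double sum into a derivative.
D-Lam : ∀ f → D (Lam f) ≈ Lam (λ k → ℕ→ℚ k * f k) ⊕ squareSum (λ k → ℕ→ℚ k * f k)
D-Lam f = pointwise λ n → begin
  ℕ→ℚ n * Lam f n
    ≡⟨ sum-*ˡ n (ℕ→ℚ n) _ ⟨
  sumTo n (λ i → ℕ→ℚ n * (f (suc i) * X (suc i) n))
    ≡⟨ sum-cong n (λ {i} _ → term n i) ⟩
  sumTo n (λ i → ℕ→ℚ (suc i) * f (suc i) * X (suc i) n + ℕ→ℚ (suc i) * f (suc i) * (X (suc i) · X (suc i)) n)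
    ≡⟨ sum-+ n (λ i → ℕ→ℚ (suc i) * f (suc i) * X (suc i) n) (λ i → ℕ→ℚ (suc i) * f (suc i) * (X (suc i) · X (suc i)) n) ⟩
  Lam (λ k → ℕ→ℚ k * f k) n + squareSum (λ k → ℕ→ℚ k * f k) n
    ≡⟨ ⊕-at (Lam (λ k → ℕ→ℚ k * f k)) (squareSum (λ k → ℕ→ℚ k * f k)) n ⟨
  (Lam (λ k → ℕ→ℚ k * f k) ⊕ squareSum (λ k → ℕ→ℚ k * f k)) n ∎
  where
  open ≡-Reasoning
  open ℚ-Solver
  term : ∀ n i → ℕ→ℚ n * (f (suc i) * X (suc i) n)
    ≡ ℕ→ℚ (suc i) * f (suc i) * X (suc i) n + ℕ→ℚ (suc i) * f (suc i) * (X (suc i) · X (suc i)) n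
  term n i = begin
    ℕ→ℚ n * (f (suc i) * X (suc i) n)
      ≡⟨ solve 3 (λ a b c → a :* (b :* c) := b :* (a :* c)) refl (ℕ→ℚ n) (f (suc i)) (X (suc i) n) ⟩
    f (suc i) * D (X (suc i)) n
      ≡⟨ cong (f (suc i) *_) (trans (at (D-X i) n) (trans (constS-· (ℕ→ℚ (suc i)) _ n)
          (cong (ℕ→ℚ (suc i) *_) (⊕-at (X (suc i)) (X (suc i) · X (suc i)) n)))) ⟩
    f (suc i) * (ℕ→ℚ (suc i) * (X (suc i) n + (X (suc i) · X (suc i)) n))
      ≡⟨ solve 4 (λ a k x y → a :* (k :* (x :+ y)) := k :* a :* x :+ k :* a :* y) refl
          (f (suc i)) (ℕ→ℚ (suc i)) (X (suc i) n) ((X (suc i) · X (suc i)) n) ⟩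
    ℕ→ℚ (suc i) * f (suc i) * X (suc i) n + ℕ→ℚ (suc i) * f (suc i) * (X (suc i) · X (suc i)) n ∎

pairSum : (ℕ → ℕ → ℚ) → Series
pairSum G n = sumTo n (λ i → sumTo n (λ j → G (suc i) (suc j) * (X (suc i) · X (suc j)) n))

pairSum-⊕ : ∀ F G → pairSum (λ k l → F k l + G k l) ≈ pairSum F ⊕ pairSum G
pairSum-⊕ F G = pointwise λ n → begin
  sumTo n (λ i → sumTo n (λ j → (F (suc i) (suc j) + G (suc i) (suc j)) * (X (suc i) · X (suc j)) n))
    ≡⟨ sum-cong n (λ {i} _ → trans
        (sum-cong n λ {j} _ → ℚₚ.*-distribʳ-+ ((X (suc i) · X (suc j)) n) (F (suc i) (suc j)) (G (suc i) (suc j)))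
        (sum-+ n (λ j → F (suc i) (suc j) * (X (suc i) · X (suc j)) n) (λ j → G (suc i) (suc j) * (X (suc i) · X (suc j)) n))) ⟩
  sumTo n (λ i → sumTo n (λ j → F (suc i) (suc j) * (X (suc i) · X (suc j)) n) + sumTo n (λ j → G (suc i) (suc j) * (X (suc i) · X (suc j)) n))
    ≡⟨ sum-+ n (λ i → sumTo n (λ j → F (suc i) (suc j) * (X (suc i) · X (suc j)) n)) (λ i → sumTo n (λ j → G (suc i) (suc j) * (X (suc i) · X (suc j)) n)) ⟩
  pairSum F n + pairSum G n
    ≡⟨ ⊕-at (pairSum F) (pairSum G) n ⟨
  (pairSum F ⊕ pairSum G) n ∎
  where open ≡-Reasoning

pairSum-⊗ : ∀ g h → pairSum (λ k l → g k * h l) ≈ Lam g · Lam h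
pairSum-⊗ g h = pointwise λ n → sym (begin
  (Lam g · Lam h) n
    ≡⟨ ·-at (Lam g) (Lam h) n ⟩
  sumTo n (λ m → Lam g m * Lam h (n ∸ m))
    ≡⟨ sum-cong n (λ {m} m≤n → trans (cong₂ _*_ (Lam-extend g m≤n) (Lam-extend h (ℕₚ.m∸n≤m n m)))
        (sum-product n n (λ i → g (suc i) * X (suc i) m) (λ j → h (suc j) * X (suc j) (n ∸ m)))) ⟩
  sumTo n (λ m → sumTo n (λ i → sumTo n (λ j → g (suc i) * X (suc i) m * (h (suc j) * X (suc j) (n ∸ m)))))
    ≡⟨ sum-swap n n _ ⟩
  sumTo n (λ i → sumTo n (λ m → sumTo n (λ j → g (suc i) * X (suc i) m * (h (suc j) * X (suc j) (n ∸ m)))))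
    ≡⟨ sum-cong n (λ {i} _ → trans (sum-swap n n _) (sum-cong n λ {j} _ → term n i j)) ⟩
  pairSum (λ k l → g k * h l) n ∎)
  where
  open ≡-Reasoning
  open ℚ-Solver
  term : ∀ n i j → sumTo n (λ m → g (suc i) * X (suc i) m * (h (suc j) * X (suc j) (n ∸ m)))
    ≡ g (suc i) * h (suc j) * (X (suc i) · X (suc j)) n
  term n i j = trans
    (sum-cong n λ {m} _ → solve 4 (λ a x b y → a :* x :* (b :* y) := a :* b :* (x :* y)) refl
      (g (suc i)) (X (suc i) m) (h (suc j)) (X (suc j) (n ∸ m)))
    (trans (sum-*ˡ n (g (suc i) * h (suc j)) (λ m → X (suc i) m * X (suc j) (n ∸ m)))
      (cong (g (suc i) * h (suc j) *_) (sym (·-at (X (suc i)) (X (suc j)) n))))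

X-·-X-< : ∀ {k l n} → n ℕ.< k ℕ.+ l → (X k · X l) n ≡ 0ℚ
X-·-X-< {k} {l} {n} n<k+l = trans
  (at (≈-trans (solve 4 (λ u g v h → u :* g :* (v :* h) := u :* v :* (g :* h)) ≈-refl (qPow k) (geom k) (qPow l) (geom l))
    (·-cong (qPow-+ k l) ≈-refl)) n)
  (qPow-·-< (geom k · geom l) n<k+l)
  where open Series-Solver

-- Q(k, l) stands for c Σ_{0<j≤k} F(j, k+l-j).

module _ (c : ℚ) (F G Q : ℕ → ℕ → ℚ)
  (F-sym : ∀ k l → F k l ≡ F l k) (G-sym : ∀ k l → G k l ≡ G l k)
  (F-cocycle : ∀ k l → F k (k ℕ.+ l) ≡ F k l + G k (k ℕ.+ l))
  (Q-zero : ∀ l → Q 0 l ≡ 0ℚ)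
  (Q-suc : ∀ k l → Q (suc k) l ≡ Q k (suc l) + c * F (suc k) l)
  where

  private
    antidiagonal : ∀ s → sumTo s (λ j → c * F (suc j) (suc (s ∸ j))) ≡ Q (suc s) 1
    antidiagonal s = trans (sum-cong s λ {j} j≤s → cong (λ t → c * F (suc j) t) (shift j≤s)) (partial s 1)
      where
      shift : ∀ {j} → j ℕ.≤ s → suc (s ∸ j) ≡ (s ℕ.+ 1) ∸ j
      shift {j} j≤s = trans (sym (ℕₚ.+-∸-assoc 1 j≤s)) (cong (_∸ j) (ℕₚ.+-comm 1 s))
      partial : ∀ s l → sumTo s (λ j → c * F (suc j) ((s ℕ.+ l) ∸ j)) ≡ Q (suc s) l
      partial zero l = sym (trans (Q-suc 0 l) (trans (cong (_+ c * F 1 l) (Q-zero (suc l))) (ℚₚ.+-identityˡ (c * F 1 l))))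
      partial (suc s) l = sym (trans (Q-suc (suc s) l) (cong₂ _+_
        (trans (sym (partial s (suc l))) (cong (λ t → sumTo s (λ j → c * F (suc j) (t ∸ j))) (ℕₚ.+-suc s l)))
        (cong (λ t → c * F (2 ℕ.+ s) t) (sym (ℕₚ.m+n∸m≡n (suc s) l)))))

    x : ℕ → ℕ → ℕ → ℚ
    x n i j = (X (suc i) · X (suc j)) n

    x-sym : ∀ n i j → x n i j ≡ x n j i
    x-sym n i j = at (·-comm (X (suc i)) (X (suc j))) n

    x-zero : ∀ {n i j} → n ℕ.≤ suc (i ℕ.+ j) → x n i j ≡ 0ℚ
    x-zero {n} {i} {j} le = X-·-X-< (s≤s (subst (n ℕ.≤_) (sym (ℕₚ.+-suc i j)) le))

    x-split : ∀ n i j → x n i j ≡ X (2 ℕ.+ (i ℕ.+ j)) n + x n (suc (i ℕ.+ j)) i + x n (suc (i ℕ.+ j)) j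
    x-split n i j = begin
      x n i j
        ≡⟨ at (X-·-X i j) n ⟩
      (X (suc i ℕ.+ suc j) · (𝟙 ⊕ X (suc i) ⊕ X (suc j))) n
        ≡⟨ cong (λ t → (X (suc t) · (𝟙 ⊕ X (suc i) ⊕ X (suc j))) n) (ℕₚ.+-suc i j) ⟩
      (Y · (𝟙 ⊕ X (suc i) ⊕ X (suc j))) n
        ≡⟨ at (solve 3 (λ y a b → y :* (con (+ 1) :+ a :+ b) := y :+ y :* a :+ y :* b) ≈-refl Y (X (suc i)) (X (suc j))) n ⟩
      (Y ⊕ Y · X (suc i) ⊕ Y · X (suc j)) n
        ≡⟨ trans (⊕-at (Y ⊕ Y · X (suc i)) (Y · X (suc j)) n) (cong (_+ x n (suc (i ℕ.+ j)) j) (⊕-at Y (Y · X (suc i)) n)) ⟩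
      Y n + x n (suc (i ℕ.+ j)) i + x n (suc (i ℕ.+ j)) j ∎
      where
      open ≡-Reasoning
      open Series-Solver
      Y = X (2 ℕ.+ (i ℕ.+ j))

    square-sym : ∀ m (E : ℕ → ℕ → ℚ) → (∀ k l → E k l ≡ E l k) → pairSum E (suc m)
      ≡ squareSum (λ k → E k k) (suc m) + sumTo m (λ s → sumTo s (λ j → ℤ→ℚ (+ 2) * (E (suc j) (2 ℕ.+ s) * x (suc m) (suc s) j)))
    square-sym m E E-sym = trans (sum-square m (λ i j → E (suc i) (suc j) * x (suc m) i j))
      (cong (squareSum (λ k → E k k) (suc m) ℚ.+_) (sum-cong m λ {s} _ → sum-cong s λ {j} _ → begin
        E (2 ℕ.+ s) (suc j) * x (suc m) (suc s) j + E (suc j) (2 ℕ.+ s) * x (suc m) j (suc s)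
          ≡⟨ cong₂ (λ u v → u * x (suc m) (suc s) j + E (suc j) (2 ℕ.+ s) * v) (E-sym (2 ℕ.+ s) (suc j)) (x-sym (suc m) j (suc s)) ⟩
        E (suc j) (2 ℕ.+ s) * x (suc m) (suc s) j + E (suc j) (2 ℕ.+ s) * x (suc m) (suc s) j
          ≡⟨ solve 1 (λ a → a :+ a := con (+ 2) :* a) refl (E (suc j) (2 ℕ.+ s) * x (suc m) (suc s) j) ⟩
        ℤ→ℚ (+ 2) * (E (suc j) (2 ℕ.+ s) * x (suc m) (suc s) j) ∎))
      where
      open ≡-Reasoning
      open ℚ-Solver

    -- The relation X_k X_l = X_{k+l} (1 + X_k + X_l), summed with the symmetric weight F.
    square-split : ∀ m → pairSum F (suc m)
      ≡ sumTo m (λ s → sumTo s (λ j → F (suc j) (suc (s ∸ j)) * X (2 ℕ.+ s) (suc m)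
          + ℤ→ℚ (+ 2) * (F (suc j) (suc (s ∸ j)) * x (suc m) (suc s) j)))
    square-split m = begin
      pairSum F n
        ≡⟨ sum-cong n (λ {i} _ → trans (sum-cong n λ {j} _ → expand i j) (sum-+ n (λ j → u i j) (λ j → f j i * w j i))) ⟩
      sumTo n (λ i → sumTo n (u i) + sumTo n (λ j → f j i * w j i))
        ≡⟨ sum-+ n (λ i → sumTo n (u i)) (λ i → sumTo n (λ j → f j i * w j i)) ⟩
      sumTo n (λ i → sumTo n (u i)) + sumTo n (λ i → sumTo n (λ j → f j i * w j i))
        ≡⟨ cong (sumTo n (λ i → sumTo n (u i)) ℚ.+_) (sum-swap n n (λ i j → f j i * w j i)) ⟩
      sumTo n (λ i → sumTo n (u i)) + sumTo n (λ i → sumTo n (λ j → f i j * w i j))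
        ≡⟨ sum-+ n (λ i → sumTo n (u i)) (λ i → sumTo n (λ j → f i j * w i j)) ⟨
      sumTo n (λ i → sumTo n (u i) + sumTo n (λ j → f i j * w i j))
        ≡⟨ sum-cong n (λ {i} _ → trans (sym (sum-+ n (u i) (λ j → f i j * w i j))) (sum-cong n λ {j} _ →
            solve 2 (λ a b → a :+ b :+ b := a :+ con (+ 2) :* b) refl (f i j * X (2 ℕ.+ (i ℕ.+ j)) n) (f i j * w i j))) ⟩
      sumTo n (λ i → sumTo n (v i))
        ≡⟨ sum-square-triangle n v (λ i j n<i+j → v-zero i j (ℕₚ.<⇒≤ n<i+j)) ⟩
      sumTo n (λ s → sumTo s (λ j → v j (s ∸ j)))
        ≡⟨ cong (sumTo m (λ s → sumTo s (λ j → v j (s ∸ j))) ℚ.+_)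
            (sum-zero n λ {j} j≤n → v-zero j (n ∸ j) (ℕₚ.≤-reflexive (sym (ℕₚ.m+[n∸m]≡n j≤n)))) ⟩
      sumTo m (λ s → sumTo s (λ j → v j (s ∸ j))) + 0ℚ
        ≡⟨ ℚₚ.+-identityʳ _ ⟩
      sumTo m (λ s → sumTo s (λ j → v j (s ∸ j)))
        ≡⟨ sum-cong m (λ {s} _ → sum-cong s λ {j} j≤s →
            cong (λ t → F (suc j) (suc (s ∸ j)) * X (2 ℕ.+ t) n + ℤ→ℚ (+ 2) * (F (suc j) (suc (s ∸ j)) * x n (suc t) j))
              (ℕₚ.m+[n∸m]≡n j≤s)) ⟩
      sumTo m (λ s → sumTo s (λ j → F (suc j) (suc (s ∸ j)) * X (2 ℕ.+ s) n + ℤ→ℚ (+ 2) * (F (suc j) (suc (s ∸ j)) * x n (suc s) j))) ∎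
      where
      open ≡-Reasoning
      open ℚ-Solver
      n = suc m
      f u v w : ℕ → ℕ → ℚ
      f i j = F (suc i) (suc j)
      w i j = x n (suc (i ℕ.+ j)) i
      u i j = f i j * X (2 ℕ.+ (i ℕ.+ j)) n + f i j * w i j
      v i j = f i j * X (2 ℕ.+ (i ℕ.+ j)) n + ℤ→ℚ (+ 2) * (f i j * w i j)
      expand : ∀ i j → f i j * x n i j ≡ u i j + f j i * w j i
      expand i j = begin
        f i j * x n i j
          ≡⟨ cong (f i j *_) (x-split n i j) ⟩
        f i j * (X (2 ℕ.+ (i ℕ.+ j)) n + w i j + x n (suc (i ℕ.+ j)) j)
          ≡⟨ solve 4 (λ f a b c → f :* (a :+ b :+ c) := f :* a :+ f :* b :+ f :* c) refl (f i j) (X (2 ℕ.+ (i ℕ.+ j)) n) (w i j) (x n (suc (i ℕ.+ j)) j) ⟩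
        u i j + f i j * x n (suc (i ℕ.+ j)) j
          ≡⟨ cong₂ (λ a t → u i j + a * x n (suc t) j) (F-sym (suc i) (suc j)) (ℕₚ.+-comm i j) ⟩
        u i j + f j i * w j i ∎
      v-zero : ∀ i j → n ℕ.≤ i ℕ.+ j → v i j ≡ 0ℚ
      v-zero i j n≤i+j = trans
        (cong₂ (λ a b → f i j * a + ℤ→ℚ (+ 2) * (f i j * b)) (X-< (s≤s (ℕₚ.m≤n⇒m≤1+n n≤i+j)))
          (x-zero (ℕₚ.m≤n⇒m≤1+n (ℕₚ.m≤n⇒m≤1+n (ℕₚ.≤-trans n≤i+j (ℕₚ.m≤m+n (i ℕ.+ j) i))))))
        (solve 1 (λ a → a :* con (+ 0) :+ con (+ 2) :* (a :* con (+ 0)) := con (+ 0)) refl (f i j))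

    -- The sum of F(k, l) X_k X_l is evaluated twice: by symmetry, as diagonal plus twice the part k
    -- < n of F(k, n) X_k X_n, and by the product formula, as a Lambert series plus twice the sum of
    -- F(k, n - k) X_k X_n. Since F(k, n) - F(k, n - k) = G(k, n), cancelling the common part `f₂`
    -- leaves only G off the diagonal.
    off-diagonal : ∀ m → sumTo m (λ s → sumTo s (λ j → ℤ→ℚ (+ 2) * (G (suc j) (2 ℕ.+ s) * x (suc m) (suc s) j)))
      + squareSum (λ k → F k k) (suc m)
      ≡ sumTo m (λ s → sumTo s (λ j → F (suc j) (suc (s ∸ j)) * X (2 ℕ.+ s) (suc m)))
    off-diagonal m = +-cancelʳ (sumTo m f₂) _ _ (begin
      sumTo m g₂ + σ + sumTo m f₂   ≡⟨ solve 3 (λ a b c → a :+ b :+ c := b :+ (c :+ a)) refl (sumTo m g₂) σ (sumTo m f₂) ⟩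
      σ + (sumTo m f₂ + sumTo m g₂) ≡⟨ cong (σ ℚ.+_) (sum-+ m f₂ g₂) ⟨
      σ + sumTo m (λ s → f₂ s + g₂ s)
        ≡⟨ cong (σ ℚ.+_) (sum-cong m λ {s} _ → trans (sym (sum-+ s _ _)) (sum-cong s λ {j} j≤s → step s j j≤s)) ⟩
      σ + sumTo m (λ s → sumTo s (λ j → ℤ→ℚ (+ 2) * (F (suc j) (2 ℕ.+ s) * x (suc m) (suc s) j)))
        ≡⟨ square-sym m F F-sym ⟨
      pairSum F (suc m)             ≡⟨ square-split m ⟩
      sumTo m (λ s → sumTo s (λ j → F (suc j) (suc (s ∸ j)) * X (2 ℕ.+ s) (suc m) + ℤ→ℚ (+ 2) * (F (suc j) (suc (s ∸ j)) * x (suc m) (suc s) j)))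
        ≡⟨ sum-cong m (λ {s} _ → sum-+ s _ _) ⟩
      sumTo m (λ s → y s + f₂ s)    ≡⟨ sum-+ m y f₂ ⟩
      sumTo m y + sumTo m f₂        ∎)
      where
      open ≡-Reasoning
      open ℚ-Solver
      σ = squareSum (λ k → F k k) (suc m)
      f₂ g₂ y : ℕ → ℚ
      f₂ s = sumTo s (λ j → ℤ→ℚ (+ 2) * (F (suc j) (suc (s ∸ j)) * x (suc m) (suc s) j))
      g₂ s = sumTo s (λ j → ℤ→ℚ (+ 2) * (G (suc j) (2 ℕ.+ s) * x (suc m) (suc s) j))
      y s = sumTo s (λ j → F (suc j) (suc (s ∸ j)) * X (2 ℕ.+ s) (suc m))
      step : ∀ s j → j ℕ.≤ s →
        ℤ→ℚ (+ 2) * (F (suc j) (suc (s ∸ j)) * x (suc m) (suc s) j) + ℤ→ℚ (+ 2) * (G (suc j) (2 ℕ.+ s) * x (suc m) (suc s) j)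
        ≡ ℤ→ℚ (+ 2) * (F (suc j) (2 ℕ.+ s) * x (suc m) (suc s) j)
      step s j j≤s = trans
        (solve 4 (λ t f g x → t :* (f :* x) :+ t :* (g :* x) := t :* ((f :+ g) :* x)) refl
          (ℤ→ℚ (+ 2)) (F (suc j) (suc (s ∸ j))) (G (suc j) (2 ℕ.+ s)) (x (suc m) (suc s) j))
        (cong (λ z → ℤ→ℚ (+ 2) * (z * x (suc m) (suc s) j)) (sym
          (subst (λ t → F (suc j) t ≡ F (suc j) (suc (s ∸ j)) + G (suc j) t)
            (cong suc (trans (ℕₚ.+-suc j (s ∸ j)) (cong suc (ℕₚ.m+[n∸m]≡n j≤s)))) (F-cocycle (suc j) (suc (s ∸ j))))))

    -- The cocycle condition at l = 0 reads F(k, k) = F(k, 0) + G(k, k). This is how the boundary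
    -- values F(0, k) enter, although the double sums only involve positive indices.
    diagonal : ∀ n → squareSum (λ k → F k k) n ≡ squareSum (F 0) n + squareSum (λ k → G k k) n
    diagonal n = trans
      (sum-cong n λ {i} _ → trans (cong (_* x n i i) (diag (suc i))) (ℚₚ.*-distribʳ-+ (x n i i) (F 0 (suc i)) (G (suc i) (suc i))))
      (sum-+ n (λ i → F 0 (suc i) * x n i i) (λ i → G (suc i) (suc i) * x n i i))
      where
      diag : ∀ k → F k k ≡ F 0 k + G k k
      diag k = trans (subst (λ t → F k t ≡ F k 0 + G k t) (ℕₚ.+-identityʳ k) (F-cocycle k 0)) (cong (_+ G k k) (F-sym k 0))

  -- Adding the diagonal of G to `off-diagonal` completes the double sum of G, at the price of the
  -- boundary squares. The coefficient of X_n that remains is c times the sum of F(j, n - j) over 0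
  -- < j < n, which is Q(n - 1, 1); the scalar c is there to clear denominators.
  pairSum-reduce : constS c · (pairSum G ⊕ squareSum (F 0)) ≈ Lam (λ k → Q (ℕ.pred k) 1)
  pairSum-reduce = pointwise λ n → trans (constS-· c _ n) (trans (cong (c *_) (⊕-at (pairSum G) (squareSum (F 0)) n)) (eq n))
    where
    open ≡-Reasoning
    open ℚ-Solver
    eq : ∀ n → c * (pairSum G n + squareSum (F 0) n) ≡ Lam (λ k → Q (ℕ.pred k) 1) n
    eq zero = begin
      c * (G 1 1 * x 0 0 0 + F 0 1 * x 0 0 0)   ≡⟨ cong (λ z → c * (G 1 1 * z + F 0 1 * z)) (x-zero {0} {0} {0} z≤n) ⟩
      c * (G 1 1 * 0ℚ + F 0 1 * 0ℚ)             ≡⟨ solve 3 (λ c a b → c :* (a :* con (+ 0) :+ b :* con (+ 0)) := con (+ 0)) refl c (G 1 1) (F 0 1) ⟩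
      0ℚ                                        ≡⟨ ℚₚ.*-zeroˡ (X 1 0) ⟨
      0ℚ * X 1 0                                ≡⟨ cong (_* X 1 0) (Q-zero 1) ⟨
      Q 0 1 * X 1 0                             ∎
    eq (suc m) = begin
      c * (pairSum G n + squareSum (F 0) n)
        ≡⟨ cong (λ z → c * (z + squareSum (F 0) n)) (square-sym m G G-sym) ⟩
      c * (squareSum (λ k → G k k) n + g₂ + squareSum (F 0) n)
        ≡⟨ cong (c *_) (trans (solve 3 (λ a b c → a :+ b :+ c := b :+ (c :+ a)) refl (squareSum (λ k → G k k) n) g₂ (squareSum (F 0) n))
            (cong (g₂ ℚ.+_) (sym (diagonal n)))) ⟩
      c * (g₂ + squareSum (λ k → F k k) n)
        ≡⟨ cong (c *_) (off-diagonal m) ⟩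
      c * sumTo m (λ s → sumTo s (λ j → F (suc j) (suc (s ∸ j)) * X (2 ℕ.+ s) n))
        ≡⟨ trans (sym (sum-*ˡ m c _)) (sum-cong m λ {s} _ → row s) ⟩
      sumTo m (λ s → Q (suc s) 1 * X (2 ℕ.+ s) n)
        ≡⟨ ℚₚ.+-identityˡ _ ⟨
      0ℚ + sumTo m (λ s → Q (suc s) 1 * X (2 ℕ.+ s) n)
        ≡⟨ cong (_+ sumTo m (λ s → Q (suc s) 1 * X (2 ℕ.+ s) n)) (trans (sym (ℚₚ.*-zeroˡ (X 1 n))) (cong (_* X 1 n) (sym (Q-zero 1)))) ⟩
      Q 0 1 * X 1 n + sumTo m (λ s → Q (suc s) 1 * X (2 ℕ.+ s) n)
        ≡⟨ sum-head m (λ i → Q i 1 * X (suc i) n) ⟨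
      Lam (λ k → Q (ℕ.pred k) 1) n ∎
      where
      n = suc m
      g₂ = sumTo m (λ s → sumTo s (λ j → ℤ→ℚ (+ 2) * (G (suc j) (2 ℕ.+ s) * x n (suc s) j)))
      row : ∀ s → c * sumTo s (λ j → F (suc j) (suc (s ∸ j)) * X (2 ℕ.+ s) n) ≡ Q (suc s) 1 * X (2 ℕ.+ s) n
      row s = begin
        c * sumTo s (λ j → F (suc j) (suc (s ∸ j)) * X (2 ℕ.+ s) n)   ≡⟨ cong (c *_) (sum-*ʳ s (X (2 ℕ.+ s) n) _) ⟩
        c * (sumTo s (λ j → F (suc j) (suc (s ∸ j))) * X (2 ℕ.+ s) n) ≡⟨ ℚₚ.*-assoc c _ _ ⟨
        c * sumTo s (λ j → F (suc j) (suc (s ∸ j))) * X (2 ℕ.+ s) n   ≡⟨ cong (_* X (2 ℕ.+ s) n) (trans (sym (sum-*ˡ s c _)) (antidiagonal s)) ⟩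
        Q (suc s) 1 * X (2 ℕ.+ s) n                                   ∎

-- Weights with coefficients periodic mod 3, and their verification by computation

data Residue : Set where
  r0 r1 r2 : Residue

next : Residue → Residue
next r0 = r1
next r1 = r2
next r2 = r0

-- Recursion by `next`, instead of division with remainder, lets `res (suc n)` reduce when n is a
-- variable, so that recurrences in k become statements about a residue and its successor.
res : ℕ → Residue
res zero = r0
res (suc n) = next (res n)

_⊞_ : Residue → Residue → Residue
r0 ⊞ s = s
r1 ⊞ s = next s
r2 ⊞ s = next (next s)

next-⊞ : ∀ r s → next r ⊞ s ≡ next (r ⊞ s)
next-⊞ r0 s = refl
next-⊞ r1 s = refl
next-⊞ r2 r0 = refl
next-⊞ r2 r1 = refl
next-⊞ r2 r2 = refl

res-+ : ∀ m n → res (m ℕ.+ n) ≡ res m ⊞ res n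
res-+ zero n = refl
res-+ (suc m) n = trans (cong next (res-+ m n)) (sym (next-⊞ (res m) (res n)))

-- Weights are written over an arbitrary signature, so that they can be read both as rational functions and
-- as polynomials for the ring solver; their dependence on residues sits in the integer coefficients only,
-- which keeps the two readings definitionally equal for a variable residue.

record Arithmetic : Set₁ where
  infixl 6 _+ᴬ_
  infixl 7 _*ᴬ_
  field
    Carrier : Set
    _+ᴬ_ _*ᴬ_ : Carrier → Carrier → Carrier
    ι : ℤ → Carrier

ℚ-arithmetic : Arithmetic
ℚ-arithmetic = record { Carrier = ℚ ; _+ᴬ_ = _+_ ; _*ᴬ_ = _*_ ; ι = ℤ→ℚ }

poly-arithmetic : Arithmetic
poly-arithmetic = record { Carrier = Polynomial 2 ; _+ᴬ_ = _:+_ ; _*ᴬ_ = _:*_ ; ι = con }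
  where open ℚ-Solver

module _ where
  open ℚ-Solver

  agree : Polynomial 2 → Polynomial 2 → Bool
  agree p q = is-just (normalise p ≟N normalise q)

  agree⇒≡ : ∀ p q → T (agree p q) → ∀ ρ → ⟦ p ⟧ ρ ≡ ⟦ q ⟧ ρ
  agree⇒≡ p q ok ρ with normalise p ≟N normalise q
  ... | just p≈q = trans (sym (correct p ρ)) (trans (⟦ p≈q ⟧N-cong ρ) (correct q ρ))

  allResidues : (Residue → Bool) → Bool
  allResidues P = P r0 ∧ P r1 ∧ P r2

  allResidues⇒ : ∀ P → T (allResidues P) → ∀ r → T (P r)
  allResidues⇒ P ok r0 = proj₁ (Equivalence.to T-∧ ok)
  allResidues⇒ P ok r1 = proj₁ (Equivalence.to T-∧ (proj₂ (Equivalence.to (T-∧ {P r0}) ok)))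
  allResidues⇒ P ok r2 = proj₂ (Equivalence.to (T-∧ {P r1}) (proj₂ (Equivalence.to (T-∧ {P r0}) ok)))

  -- Proof by reflection: both sides are normalised for each of the nine pairs of residues. The
  -- implicit argument is a closed Boolean condition that computes to the unit type, so it is filled
  -- in exactly when all nine comparisons succeed.
  check : (p q : Residue → Residue → Polynomial 2) →
    {T (allResidues λ r → allResidues λ s → agree (p r s) (q r s))} →
    ∀ r s k l → ⟦ p r s ⟧ (k ∷ l ∷ []) ≡ ⟦ q r s ⟧ (k ∷ l ∷ [])
  check p q {ok} r s k l = agree⇒≡ (p r s) (q r s)
    (allResidues⇒ (λ s → agree (p r s) (q r s)) (allResidues⇒ (λ r → allResidues λ s → agree (p r s) (q r s)) ok r) s)
    (k ∷ l ∷ [])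

  K L 1P : Polynomial 2
  K = var zero
  L = var (suc zero)
  1P = con (+ 1)

-- `χ` and `χ₀` are the nontrivial and the principal character mod 3. The function `w` is -(ω^k +
-- ω^(-k)) for a primitive cube root of unity ω, or 1 minus 3 times the indicator of 3 | k; it
-- produces combinations of E₂(q) and E₂(q³).
χ w χ₀ : Residue → ℤ
χ r0 = + 0
χ r1 = + 1
χ r2 = -[1+ 0 ]
w r0 = -[1+ 1 ]
w r1 = + 1
w r2 = + 1
χ₀ r0 = + 0
χ₀ r1 = + 1
χ₀ r2 = + 1

δ : Residue → Residue → ℤ
δ r0 r0 = + 1
δ r1 r1 = + 1
δ r2 r2 = + 1
δ _ _ = + 0

weight : (Residue → ℚ → ℚ) → ℕ → ℚ
weight f k = f (res k) (ℕ→ℚ k)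

weight₂ : (Residue → Residue → ℚ → ℚ → ℚ) → ℕ → ℕ → ℚ
weight₂ F k l = F (res k) (res l) (ℕ→ℚ k) (ℕ→ℚ l)

squareSum-* : ∀ c f → squareSum (λ k → c * f k) ≈ constS c · squareSum f
squareSum-* c f = pointwise λ n → trans
  (sum-cong n λ {i} _ → ℚₚ.*-assoc c (f (suc i)) ((X (suc i) · X (suc i)) n))
  (trans (sum-*ˡ n c (λ i → f (suc i) * (X (suc i) · X (suc i)) n)) (sym (constS-· c (squareSum f) n)))

module _ (c d : ℤ) (F G Q : Residue → Residue → ℚ → ℚ → ℚ) (f φ : Residue → ℚ → ℚ)
  (F-sym : ∀ r s k l → F r s k l ≡ F s r l k) (G-sym : ∀ r s k l → G r s k l ≡ G s r l k)
  (F-cocycle : ∀ r s k l → F r (r ⊞ s) k (k + l) ≡ F r s k l + G r (r ⊞ s) k (k + l))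
  (F-zero : ∀ s l → F r0 s 0ℚ l ≡ ℤ→ℚ d * (l * f s l))
  (Q-zero : ∀ s l → Q r0 s 0ℚ l ≡ 0ℚ)
  (Q-suc : ∀ r s k l → Q (next r) s (1ℚ + k) l ≡ Q r (next s) k (1ℚ + l) + ℤ→ℚ c * F (next r) s (1ℚ + k) l)
  (Q-one : ∀ r k → Q r r1 k 1ℚ ≡ φ (next r) (1ℚ + k))
  where

  -- The boundary value F(0, l) = d l f(l) has the shape required by `D-Lam`, so the squares become
  -- a derivative. The hypotheses are stated for all residues and all rational k, l, independently
  -- of one another: this makes them polynomial identities that `check` can decide.
  weighted-pairSum : ℤ→Series c · (pairSum (weight₂ G) ⊕ ℤ→Series d · (D (Lam (weight f)) ⊝ Lam (λ k → ℕ→ℚ k * weight f k)))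
    ≈ Lam (weight φ)
  weighted-pairSum = begin
    ℤ→Series c · (pairSum (weight₂ G) ⊕ ℤ→Series d · (D (Lam (weight f)) ⊝ Lam (λ k → ℕ→ℚ k * weight f k)))
      ≈⟨ ·-cong ≈-refl (⊕-cong ≈-refl (≈-sym squares)) ⟩
    ℤ→Series c · (pairSum (weight₂ G) ⊕ squareSum (weight₂ F 0))
      ≈⟨ pairSum-reduce (ℤ→ℚ c) (weight₂ F) (weight₂ G) (weight₂ Q)
          (λ k l → F-sym _ _ _ _) (λ k l → G-sym _ _ _ _)
          (λ k l → subst₂ (λ t x → F (res k) t (ℕ→ℚ k) x ≡ weight₂ F k l + G (res k) t (ℕ→ℚ k) x)
            (sym (res-+ k l)) (sym (ℕ→ℚ-+ k l)) (F-cocycle _ _ _ _))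
          (λ l → Q-zero _ _)
          (λ k l → subst₂ (λ x y → Q (next (res k)) (res l) x (ℕ→ℚ l)
              ≡ Q (res k) (next (res l)) (ℕ→ℚ k) y + ℤ→ℚ c * F (next (res k)) (res l) x (ℕ→ℚ l))
            (sym (ℕ→ℚ-suc k)) (sym (ℕ→ℚ-suc l)) (Q-suc _ _ _ _)) ⟩
    Lam (λ k → weight₂ Q (ℕ.pred k) 1)
      ≈⟨ Lam-cong {λ k → weight₂ Q (ℕ.pred k) 1} {weight φ} (λ i → trans (Q-one (res i) (ℕ→ℚ i)) (cong (φ (next (res i))) (sym (ℕ→ℚ-suc i)))) ⟩
    Lam (weight φ) ∎
    where
    open ≈-Reasoning
    kf : ℕ → ℚ
    kf k = ℕ→ℚ k * weight f k
    squares : squareSum (weight₂ F 0) ≈ ℤ→Series d · (D (Lam (weight f)) ⊝ Lam kf)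
    squares = begin
      squareSum (weight₂ F 0)                                ≈⟨ squareSum-cong {weight₂ F 0} {λ k → ℤ→ℚ d * kf k} (λ i → F-zero (res (suc i)) (ℕ→ℚ (suc i))) ⟩
      squareSum (λ k → ℤ→ℚ d * kf k)                         ≈⟨ squareSum-* (ℤ→ℚ d) kf ⟩
      ℤ→Series d · squareSum kf                              ≈⟨ ·-cong ≈-refl (solve 2 (λ s l → s := l :+ s :- l) ≈-refl (squareSum kf) (Lam kf)) ⟩
      ℤ→Series d · ((Lam kf ⊕ squareSum kf) ⊝ Lam kf)        ≈⟨ ·-cong ≈-refl (⊕-cong (≈-sym (D-Lam (weight f))) ≈-refl) ⟩
      ℤ→Series d · (D (Lam (weight f)) ⊝ Lam kf)             ∎
      where open Series-Solver

module Weights (S : Arithmetic) where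
  open Arithmetic S

  select : Residue → (x y z : Carrier) → Carrier
  select r x y z = ι (δ r r0) *ᴬ x +ᴬ ι (δ r r1) *ᴬ y +ᴬ ι (δ r r2) *ᴬ z

  -- The partial sum Σ_{0<j≤k} c F(j, k+l-j), given its value for k ≡ 0 (mod 3).
  partialSum : ℤ → (F : Residue → Residue → Carrier → Carrier → Carrier) → (Residue → Carrier → Carrier → Carrier) →
    Residue → Residue → Carrier → Carrier → Carrier
  partialSum c F Q₀ r s k l = select r (Q₀ s k l) (Q₁ s k l)
    (Q₁ (next s) (k +ᴬ ι -[1+ 0 ]) (l +ᴬ ι (+ 1)) +ᴬ ι c *ᴬ F r2 s k l)
    where
    Q₁ : Residue → Carrier → Carrier → Carrier
    Q₁ s k l = Q₀ (next s) (k +ᴬ ι -[1+ 0 ]) (l +ᴬ ι (+ 1)) +ᴬ ι c *ᴬ F r1 s k l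

  symmetrised : (f g : Residue → Carrier → Carrier) → Residue → Residue → Carrier → Carrier → Carrier
  symmetrised f g r s k l = f r k *ᴬ g s l +ᴬ g r k *ᴬ f s l

  e kχ₀ kw kχ k²χ k²w k³χ k⁴χ : Residue → Carrier → Carrier
  e r k = ι (χ r)
  kχ₀ r k = k *ᴬ ι (χ₀ r)
  kw r k = k *ᴬ ι (w r)
  kχ r k = k *ᴬ ι (χ r)
  k²χ r k = k *ᴬ kχ r k
  k²w r k = k *ᴬ kw r k
  k³χ r k = k *ᴬ k²χ r k
  k⁴χ r k = k *ᴬ k³χ r k

  combination : (a b c d : ℤ) (f g h i : Residue → Carrier → Carrier) → Residue → Carrier → Carrier
  combination a b c d f g h i r k = ι a *ᴬ f r k +ᴬ ι b *ᴬ g r k +ᴬ ι c *ᴬ h r k +ᴬ ι d *ᴬ i r k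

  -- Each F is the symmetric solution of F(k, l) = F(k - l, l) + G(k, l), up to a scalar, found by linear algebra
  -- on polynomials with coefficients periodic mod 3; φ(n) is then c Σ_{0<k<n} F(k, n-k).

  G₁ F₁ Q₁ G₂ F₂ Q₂ G₃ F₃ Q₃ G₄ F₄ Q₄ G₅ F₅ Q₅ : Residue → Residue → Carrier → Carrier → Carrier

  G₁ = symmetrised e e
  F₁ r s k l = ι (+ 2 ℤ.* δ r s ℤ.* χ₀ r)
  -- For k ≡ 0 (mod 3), one j in three satisfies j ≡ k + l - j, namely j ≡ -l, and each contributes
  -- 2 χ₀(l). The sum of F is thus 2 χ₀(l) k / 3, whence the factor 3.
  Q₁ = partialSum (+ 3) F₁ λ s k l → ι (+ 2 ℤ.* χ₀ s) *ᴬ k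

  G₂ = symmetrised kw e
  F₂ r s k l = ι (coefficient s r) *ᴬ k +ᴬ ι (coefficient r s) *ᴬ l
    where
    coefficient : Residue → Residue → ℤ
    coefficient r s = (δ r s ℤ.- + 1) ℤ.* (+ 2 ℤ.* χ s ℤ.+ χ r)
  Q₂ = partialSum (+ 3) F₂ λ s k l → select s
    (ι (+ 2) *ᴬ k)
    (ι (+ 2) *ᴬ k +ᴬ ι (ℤ.- + 3) *ᴬ k *ᴬ (k +ᴬ l))
    (ι (ℤ.- + 1) *ᴬ k +ᴬ ι (+ 3) *ᴬ k *ᴬ (k +ᴬ l))

  -- One ninth of the quadratic part of `Y · Y ⊝ a · N`.
  G₃ r s k l = kw r k *ᴬ kw s l +ᴬ ι (+ 3) *ᴬ symmetrised k²χ e r s k l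
  F₃ r s k l = ι (+ 3 ℤ.* δ r s ℤ.- + 1) *ᴬ (k *ᴬ k +ᴬ k *ᴬ l +ᴬ l *ᴬ l)
  Q₃ = partialSum (+ 3) F₃ λ s k l → select s
    (ι (+ 4) *ᴬ k +ᴬ ι (ℤ.- + 3) *ᴬ k *ᴬ l)
    (ι (ℤ.- + 2) *ᴬ k)
    (ι (ℤ.- + 2) *ᴬ k +ᴬ ι (+ 3) *ᴬ k *ᴬ l)

  G₄ r s k l = ι (+ 3) *ᴬ symmetrised kw k²χ r s k l
  F₄ r s k l = l *ᴬ half r s k l +ᴬ k *ᴬ half s r l k
    where
    coefficient : Residue → Residue → ℤ
    coefficient r s = χ r ℤ.* (+ 3 ℤ.* δ r s ℤ.- + 1) ℤ.- + 3 ℤ.* χ s ℤ.* δ r r0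
    half : Residue → Residue → Carrier → Carrier → Carrier
    half r s k l = ι (ℤ.- + 2 ℤ.* χ s ℤ.* δ r r0) *ᴬ l *ᴬ l +ᴬ ι (coefficient r s) *ᴬ k *ᴬ l
  Q₄ = partialSum (+ 3) F₄ λ s k l → select s
    (k *ᴬ (ι (ℤ.- + 4) +ᴬ l *ᴬ l +ᴬ ι (ℤ.- + 1) *ᴬ k *ᴬ l))
    (k *ᴬ (k +ᴬ l) *ᴬ (ι (ℤ.- + 2) +ᴬ ι (+ 4) *ᴬ (k +ᴬ l) +ᴬ ι (ℤ.- + 2) *ᴬ (k +ᴬ l) *ᴬ (k +ᴬ l)))
    (k *ᴬ (k +ᴬ l) *ᴬ (ι (+ 2) +ᴬ ι (ℤ.- + 2) *ᴬ k +ᴬ ι (ℤ.- + 5) *ᴬ l +ᴬ ι (+ 2) *ᴬ (k +ᴬ l) *ᴬ (k +ᴬ l)))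

  G₅ = symmetrised kχ₀ k²χ
  F₅ r s k l = ι (χ r ℤ.* δ r s) *ᴬ k *ᴬ l *ᴬ (k +ᴬ l)
  -- Summing j² over one residue class mod 3 up to a multiple k of 3 gives k (k - 3)(2k - 3)/18 plus
  -- terms with smaller denominators; hence 18 here.
  Q₅ = partialSum (+ 18) F₅ λ s k l → select s
    (ι (+ 0))
    (ι (ℤ.- + 1) *ᴬ k *ᴬ (k +ᴬ l) *ᴬ (ι (+ 3) +ᴬ ι (+ 3) *ᴬ l +ᴬ ι (+ 3) *ᴬ k *ᴬ l +ᴬ k *ᴬ k))
    (k *ᴬ (k +ᴬ l) *ᴬ (ι (+ 3) +ᴬ ι (ℤ.- + 3) *ᴬ l +ᴬ ι (+ 3) *ᴬ k *ᴬ l +ᴬ k *ᴬ k))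

  φ₁ φ₂ φ₃ φ₄ φ₅ : Residue → Carrier → Carrier
  φ₁ = combination (+ 2) (ℤ.- + 2) (+ 0) (+ 0) kχ₀ e e e
  φ₂ = combination (+ 6) (ℤ.- + 1) (ℤ.- + 2) (ℤ.- + 3) kχ kw e k²χ
  φ₃ = combination (+ 3) (ℤ.- + 2) (+ 2) (ℤ.- + 3) k²w kw e k²χ
  φ₄ = combination (+ 2) (ℤ.- + 6) (+ 6) (ℤ.- + 2) kw k²χ k³χ k⁴χ
  φ₅ = combination (+ 4) (ℤ.- + 3) (ℤ.- + 1) (+ 0) kχ₀ k²χ k⁴χ e

open Weights ℚ-arithmetic public
private module Poly = Weights poly-arithmetic

module _ where
  open ℚ-Solver

  -- The names give modular weights. In this instance and in `weight-five′`, F(0, l) = 0, so d = 0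
  -- and `e` is a mere placeholder; the other three produce the derivatives of `a`, `Y` and `N`.
  weight-two : ℤ→Series (+ 3) · (pairSum (weight₂ G₁) ⊕ ℤ→Series (+ 0) · (D (Lam (weight e)) ⊝ Lam (λ k → ℕ→ℚ k * weight e k)))
    ≈ Lam (weight φ₁)
  weight-two = weighted-pairSum (+ 3) (+ 0) F₁ G₁ Q₁ e φ₁
    (check (λ r s → Poly.F₁ r s K L) (λ r s → Poly.F₁ s r L K))
    (check (λ r s → Poly.G₁ r s K L) (λ r s → Poly.G₁ s r L K))
    (check (λ r s → Poly.F₁ r (r ⊞ s) K (K :+ L)) (λ r s → Poly.F₁ r s K L :+ Poly.G₁ r (r ⊞ s) K (K :+ L)))
    (λ s l → check (λ r s → Poly.F₁ r0 s (con (+ 0)) L) (λ r s → con (+ 0) :* (L :* Poly.e s L)) r0 s 0ℚ l)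
    (λ s l → check (λ r s → Poly.Q₁ r0 s (con (+ 0)) L) (λ r s → con (+ 0)) r0 s 0ℚ l)
    (check (λ r s → Poly.Q₁ (next r) s (1P :+ K) L) (λ r s → Poly.Q₁ r (next s) K (1P :+ L) :+ con (+ 3) :* Poly.F₁ (next r) s (1P :+ K) L))
    (λ r k → check (λ r s → Poly.Q₁ r r1 K 1P) (λ r s → Poly.φ₁ (next r) (1P :+ K)) r r0 k 0ℚ)

  weight-three : ℤ→Series (+ 3) · (pairSum (weight₂ G₂) ⊕ ℤ→Series (ℤ.- + 2) · (D (Lam (weight e)) ⊝ Lam (λ k → ℕ→ℚ k * weight e k)))
    ≈ Lam (weight φ₂)
  weight-three = weighted-pairSum (+ 3) (ℤ.- + 2) F₂ G₂ Q₂ e φ₂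
    (check (λ r s → Poly.F₂ r s K L) (λ r s → Poly.F₂ s r L K))
    (check (λ r s → Poly.G₂ r s K L) (λ r s → Poly.G₂ s r L K))
    (check (λ r s → Poly.F₂ r (r ⊞ s) K (K :+ L)) (λ r s → Poly.F₂ r s K L :+ Poly.G₂ r (r ⊞ s) K (K :+ L)))
    (λ s l → check (λ r s → Poly.F₂ r0 s (con (+ 0)) L) (λ r s → con (ℤ.- + 2) :* (L :* Poly.e s L)) r0 s 0ℚ l)
    (λ s l → check (λ r s → Poly.Q₂ r0 s (con (+ 0)) L) (λ r s → con (+ 0)) r0 s 0ℚ l)
    (check (λ r s → Poly.Q₂ (next r) s (1P :+ K) L) (λ r s → Poly.Q₂ r (next s) K (1P :+ L) :+ con (+ 3) :* Poly.F₂ (next r) s (1P :+ K) L))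
    (λ r k → check (λ r s → Poly.Q₂ r r1 K 1P) (λ r s → Poly.φ₂ (next r) (1P :+ K)) r r0 k 0ℚ)

  weight-four : ℤ→Series (+ 3) · (pairSum (weight₂ G₃) ⊕ ℤ→Series (ℤ.- + 1) · (D (Lam (weight kw)) ⊝ Lam (λ k → ℕ→ℚ k * weight kw k)))
    ≈ Lam (weight φ₃)
  weight-four = weighted-pairSum (+ 3) (ℤ.- + 1) F₃ G₃ Q₃ kw φ₃
    (check (λ r s → Poly.F₃ r s K L) (λ r s → Poly.F₃ s r L K))
    (check (λ r s → Poly.G₃ r s K L) (λ r s → Poly.G₃ s r L K))
    (check (λ r s → Poly.F₃ r (r ⊞ s) K (K :+ L)) (λ r s → Poly.F₃ r s K L :+ Poly.G₃ r (r ⊞ s) K (K :+ L)))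
    (λ s l → check (λ r s → Poly.F₃ r0 s (con (+ 0)) L) (λ r s → con (ℤ.- + 1) :* (L :* Poly.kw s L)) r0 s 0ℚ l)
    (λ s l → check (λ r s → Poly.Q₃ r0 s (con (+ 0)) L) (λ r s → con (+ 0)) r0 s 0ℚ l)
    (check (λ r s → Poly.Q₃ (next r) s (1P :+ K) L) (λ r s → Poly.Q₃ r (next s) K (1P :+ L) :+ con (+ 3) :* Poly.F₃ (next r) s (1P :+ K) L))
    (λ r k → check (λ r s → Poly.Q₃ r r1 K 1P) (λ r s → Poly.φ₃ (next r) (1P :+ K)) r r0 k 0ℚ)

  weight-five : ℤ→Series (+ 3) · (pairSum (weight₂ G₄) ⊕ ℤ→Series (ℤ.- + 2) · (D (Lam (weight k²χ)) ⊝ Lam (λ k → ℕ→ℚ k * weight k²χ k)))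
    ≈ Lam (weight φ₄)
  weight-five = weighted-pairSum (+ 3) (ℤ.- + 2) F₄ G₄ Q₄ k²χ φ₄
    (check (λ r s → Poly.F₄ r s K L) (λ r s → Poly.F₄ s r L K))
    (check (λ r s → Poly.G₄ r s K L) (λ r s → Poly.G₄ s r L K))
    (check (λ r s → Poly.F₄ r (r ⊞ s) K (K :+ L)) (λ r s → Poly.F₄ r s K L :+ Poly.G₄ r (r ⊞ s) K (K :+ L)))
    (λ s l → check (λ r s → Poly.F₄ r0 s (con (+ 0)) L) (λ r s → con (ℤ.- + 2) :* (L :* Poly.k²χ s L)) r0 s 0ℚ l)
    (λ s l → check (λ r s → Poly.Q₄ r0 s (con (+ 0)) L) (λ r s → con (+ 0)) r0 s 0ℚ l)
    (check (λ r s → Poly.Q₄ (next r) s (1P :+ K) L) (λ r s → Poly.Q₄ r (next s) K (1P :+ L) :+ con (+ 3) :* Poly.F₄ (next r) s (1P :+ K) L))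
    (λ r k → check (λ r s → Poly.Q₄ r r1 K 1P) (λ r s → Poly.φ₄ (next r) (1P :+ K)) r r0 k 0ℚ)

  weight-five′ : ℤ→Series (+ 18) · (pairSum (weight₂ G₅) ⊕ ℤ→Series (+ 0) · (D (Lam (weight e)) ⊝ Lam (λ k → ℕ→ℚ k * weight e k)))
    ≈ Lam (weight φ₅)
  weight-five′ = weighted-pairSum (+ 18) (+ 0) F₅ G₅ Q₅ e φ₅
    (check (λ r s → Poly.F₅ r s K L) (λ r s → Poly.F₅ s r L K))
    (check (λ r s → Poly.G₅ r s K L) (λ r s → Poly.G₅ s r L K))
    (check (λ r s → Poly.F₅ r (r ⊞ s) K (K :+ L)) (λ r s → Poly.F₅ r s K L :+ Poly.G₅ r (r ⊞ s) K (K :+ L)))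
    (λ s l → check (λ r s → Poly.F₅ r0 s (con (+ 0)) L) (λ r s → con (+ 0) :* (L :* Poly.e s L)) r0 s 0ℚ l)
    (λ s l → check (λ r s → Poly.Q₅ r0 s (con (+ 0)) L) (λ r s → con (+ 0)) r0 s 0ℚ l)
    (check (λ r s → Poly.Q₅ (next r) s (1P :+ K) L) (λ r s → Poly.Q₅ r (next s) K (1P :+ L) :+ con (+ 18) :* Poly.F₅ (next r) s (1P :+ K) L))
    (λ r k → check (λ r s → Poly.Q₅ r r1 K 1P) (λ r s → Poly.φ₅ (next r) (1P :+ K)) r r0 k 0ℚ)

-- The five quadratic relations

pairSum-* : ∀ c G → pairSum (λ k l → c * G k l) ≈ constS c · pairSum G
pairSum-* c G = pointwise λ n → trans
  (sum-cong n λ {i} _ → trans (sum-cong n λ {j} _ → ℚₚ.*-assoc c (G (suc i) (suc j)) ((X (suc i) · X (suc j)) n))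
    (sum-*ˡ n c (λ j → G (suc i) (suc j) * (X (suc i) · X (suc j)) n)))
  (trans (sum-*ˡ n c (λ i → sumTo n (λ j → G (suc i) (suc j) * (X (suc i) · X (suc j)) n))) (sym (constS-· c (pairSum G) n)))

lam : (Residue → ℚ → ℚ) → Series
lam f = Lam (weight f)

pairSum-symmetrised : ∀ f g → pairSum (weight₂ (symmetrised f g)) ≈ lam f · lam g ⊕ lam g · lam f
pairSum-symmetrised f g = ≈-trans
  (pairSum-⊕ (λ k l → weight f k * weight g l) (λ k l → weight g k * weight f l))
  (⊕-cong (pairSum-⊗ (weight f) (weight g)) (pairSum-⊗ (weight g) (weight f)))

lam-combination : ∀ a b c d f g h i → lam (combination a b c d f g h i)
  ≈ ℤ→Series a · lam f ⊕ ℤ→Series b · lam g ⊕ ℤ→Series c · lam h ⊕ ℤ→Series d · lam i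
lam-combination a b c d f g h i =
  ≈-trans (Lam-⊕ (λ k → af k + bg k + ch k) di) (⊕-cong
  (≈-trans (Lam-⊕ (λ k → af k + bg k) ch) (⊕-cong
  (≈-trans (Lam-⊕ af bg) (⊕-cong (Lam-* (ℤ→ℚ a) (weight f)) (Lam-* (ℤ→ℚ b) (weight g))))
  (Lam-* (ℤ→ℚ c) (weight h)))) (Lam-* (ℤ→ℚ d) (weight i)))
  where
  af bg ch di : ℕ → ℚ
  af k = ℤ→ℚ a * weight f k
  bg k = ℤ→ℚ b * weight g k
  ch k = ℤ→ℚ c * weight h k
  di k = ℤ→ℚ d * weight i k

affine : ℤ → (Residue → ℚ → ℚ) → Series
affine c f = 𝟙 ⊕ ℤ→Series c · lam f

D-affine : ∀ c f → D (affine c f) ≈ ℤ→Series c · D (lam f)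
D-affine c f = ≈-trans (D-⊕ 𝟙 (ℤ→Series c · lam f))
  (≈-trans (⊕-cong (D-constS 1ℚ) (D-constS-· (ℤ→ℚ c) (lam f))) (⊕-identityˡ (ℤ→Series c · D (lam f))))

-- In the notation of the Borweins, a is the cubic theta function a(q) and N = b(q)³. With Ramanujan's E₂,
-- P = (3 E₂(q³) - E₂(q)) / 2 and Y = (9 E₂(q³) - E₂(q)) / 8.

a P Y N E₅ : Series
a = affine (+ 6) e
P = affine (+ 12) kχ₀
Y = affine (+ 3) kw
N = affine (ℤ.- + 9) k²χ
E₅ = affine (+ 3) k⁴χ

constS-cancel : ∀ n {f g} → constS (ℕ→ℚ (suc n)) · f ≈ constS (ℕ→ℚ (suc n)) · g → f ≈ g
constS-cancel n {f} {g} p = pointwise λ i → *-cancelˡ-suc n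
  (trans (sym (constS-· (ℕ→ℚ (suc n)) f i)) (trans (at p i) (constS-· (ℕ→ℚ (suc n)) g i)))

module _ where
  open ≈-Reasoning
  open Series-Solver

  -- Each identity is a multiple of the corresponding reduction formula, up to linear terms.

  a²≈P : a · a ≈ P
  a²≈P = begin
    a · a
      ≈⟨ solve 4 (λ x z y u → (con (+ 1) :+ con (+ 6) :* x) :* (con (+ 1) :+ con (+ 6) :* x)
          := con (+ 1) :+ con (+ 12) :* z :+ con (+ 6) :* (
            con (+ 3) :* ((x :* x :+ x :* x) :+ con (+ 0) :* (y :- u))
            :- (con (+ 2) :* z :+ con (ℤ.- + 2) :* x :+ con (+ 0) :* x :+ con (+ 0) :* x)))
          ≈-refl (lam e) (lam kχ₀) (D (lam e)) (lam kχ) ⟩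
    P ⊕ _ · (_ ⊝ _)
      ≈⟨ drop-⊝ P (ℤ→Series (+ 6)) (≈-trans (·-cong ≈-refl (⊕-cong (≈-sym (pairSum-symmetrised e e)) ≈-refl))
          (≈-trans weight-two (lam-combination (+ 2) (ℤ.- + 2) (+ 0) (+ 0) kχ₀ e e e))) ⟩
    P ∎

  3Da≈aY-N : ℤ→Series (+ 3) · D a ≈ a · Y ⊝ N
  3Da≈aY-N = ≈-sym (begin
    a · Y ⊝ N
      ≈⟨ solve 5 (λ x y n d u → (con (+ 1) :+ con (+ 6) :* x) :* (con (+ 1) :+ con (+ 3) :* y) :- (con (+ 1) :+ con (ℤ.- + 9) :* n)
          := con (+ 3) :* (con (+ 6) :* d) :+ con (+ 3) :* (
            con (+ 3) :* ((y :* x :+ x :* y) :+ con (ℤ.- + 2) :* (d :- u))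
            :- (con (+ 6) :* u :+ con (ℤ.- + 1) :* y :+ con (ℤ.- + 2) :* x :+ con (ℤ.- + 3) :* n)))
          ≈-refl (lam e) (lam kw) (lam k²χ) (D (lam e)) (lam kχ) ⟩
    ℤ→Series (+ 3) · (ℤ→Series (+ 6) · D (lam e)) ⊕ _ · (_ ⊝ _)
      ≈⟨ drop-⊝ _ (ℤ→Series (+ 3)) (≈-trans (·-cong ≈-refl (⊕-cong (≈-sym (pairSum-symmetrised kw e)) ≈-refl))
          (≈-trans weight-three (lam-combination (+ 6) (ℤ.- + 1) (ℤ.- + 2) (ℤ.- + 3) kχ kw e k²χ))) ⟩
    ℤ→Series (+ 3) · (ℤ→Series (+ 6) · D (lam e))
      ≈⟨ ·-cong ≈-refl (D-affine (+ 6) e) ⟨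
    ℤ→Series (+ 3) · D a ∎)

  3DY≈Y²-aN : ℤ→Series (+ 3) · D Y ≈ Y · Y ⊝ a · N
  3DY≈Y²-aN = ≈-sym (begin
    Y · Y ⊝ a · N
      ≈⟨ solve 5 (λ x y n d u → (con (+ 1) :+ con (+ 3) :* y) :* (con (+ 1) :+ con (+ 3) :* y)
            :- (con (+ 1) :+ con (+ 6) :* x) :* (con (+ 1) :+ con (ℤ.- + 9) :* n)
          := con (+ 3) :* (con (+ 3) :* d) :+ con (+ 3) :* (
            con (+ 3) :* ((y :* y :+ con (+ 3) :* (n :* x :+ x :* n)) :+ con (ℤ.- + 1) :* (d :- u))
            :- (con (+ 3) :* u :+ con (ℤ.- + 2) :* y :+ con (+ 2) :* x :+ con (ℤ.- + 3) :* n)))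
          ≈-refl (lam e) (lam kw) (lam k²χ) (D (lam kw)) (lam k²w) ⟩
    ℤ→Series (+ 3) · (ℤ→Series (+ 3) · D (lam kw)) ⊕ _ · (_ ⊝ _)
      ≈⟨ drop-⊝ _ (ℤ→Series (+ 3)) (≈-trans (·-cong ≈-refl (⊕-cong (≈-sym pairs) ≈-refl))
          (≈-trans weight-four (lam-combination (+ 3) (ℤ.- + 2) (+ 2) (ℤ.- + 3) k²w kw e k²χ))) ⟩
    ℤ→Series (+ 3) · (ℤ→Series (+ 3) · D (lam kw))
      ≈⟨ ·-cong ≈-refl (D-affine (+ 3) kw) ⟨
    ℤ→Series (+ 3) · D Y ∎)
    where
    pairs : pairSum (weight₂ G₃) ≈ lam kw · lam kw ⊕ ℤ→Series (+ 3) · (lam k²χ · lam e ⊕ lam e · lam k²χ)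
    pairs = ≈-trans (pairSum-⊕ (λ k l → weight kw k * weight kw l) (λ k l → ℤ→ℚ (+ 3) * weight₂ (symmetrised k²χ e) k l))
      (⊕-cong (pairSum-⊗ (weight kw) (weight kw)) (≈-trans (pairSum-* (ℤ→ℚ (+ 3)) (weight₂ (symmetrised k²χ e)))
        (·-cong ≈-refl (pairSum-symmetrised k²χ e))))

  DN≈YN-E₅ : D N ≈ Y · N ⊝ E₅
  -- Proved after doubling: the multiplier of the reduction formula would otherwise be -3/2, and
  -- solver constants are integers.
  DN≈YN-E₅ = constS-cancel 1 (≈-sym (begin
    ℤ→Series (+ 2) · (Y · N ⊝ E₅)
      ≈⟨ solve 5 (λ y n v d u → con (+ 2) :* ((con (+ 1) :+ con (+ 3) :* y) :* (con (+ 1) :+ con (ℤ.- + 9) :* n) :- (con (+ 1) :+ con (+ 3) :* v))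
          := con (+ 2) :* (con (ℤ.- + 9) :* d) :+ con (ℤ.- + 3) :* (
            con (+ 3) :* (con (+ 3) :* (y :* n :+ n :* y) :+ con (ℤ.- + 2) :* (d :- u))
            :- (con (+ 2) :* y :+ con (ℤ.- + 6) :* n :+ con (+ 6) :* u :+ con (ℤ.- + 2) :* v)))
          ≈-refl (lam kw) (lam k²χ) (lam k⁴χ) (D (lam k²χ)) (lam k³χ) ⟩
    ℤ→Series (+ 2) · (ℤ→Series (ℤ.- + 9) · D (lam k²χ)) ⊕ _ · (_ ⊝ _)
      ≈⟨ drop-⊝ _ (ℤ→Series (ℤ.- + 3)) (≈-trans (·-cong ≈-refl (⊕-cong (≈-sym pairs) ≈-refl))
          (≈-trans weight-five (lam-combination (+ 2) (ℤ.- + 6) (+ 6) (ℤ.- + 2) kw k²χ k³χ k⁴χ))) ⟩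
    ℤ→Series (+ 2) · (ℤ→Series (ℤ.- + 9) · D (lam k²χ))
      ≈⟨ ·-cong ≈-refl (D-affine (ℤ.- + 9) k²χ) ⟨
    ℤ→Series (+ 2) · D N ∎))
    where
    pairs : pairSum (weight₂ G₄) ≈ ℤ→Series (+ 3) · (lam kw · lam k²χ ⊕ lam k²χ · lam kw)
    pairs = ≈-trans (pairSum-* (ℤ→ℚ (+ 3)) (weight₂ (symmetrised kw k²χ))) (·-cong ≈-refl (pairSum-symmetrised kw k²χ))

  E₅≈PN : E₅ ≈ P · N
  E₅≈PN = ≈-sym (begin
    P · N
      ≈⟨ solve 6 (λ x z n v d u → (con (+ 1) :+ con (+ 12) :* z) :* (con (+ 1) :+ con (ℤ.- + 9) :* n)
          := con (+ 1) :+ con (+ 3) :* v :+ con (ℤ.- + 3) :* (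
            con (+ 18) :* ((z :* n :+ n :* z) :+ con (+ 0) :* (d :- u))
            :- (con (+ 4) :* z :+ con (ℤ.- + 3) :* n :+ con (ℤ.- + 1) :* v :+ con (+ 0) :* x)))
          ≈-refl (lam e) (lam kχ₀) (lam k²χ) (lam k⁴χ) (D (lam e)) (lam kχ) ⟩
    E₅ ⊕ _ · (_ ⊝ _)
      ≈⟨ drop-⊝ E₅ (ℤ→Series (ℤ.- + 3)) (≈-trans (·-cong ≈-refl (⊕-cong (≈-sym (pairSum-symmetrised kχ₀ k²χ)) ≈-refl))
          (≈-trans weight-five′ (lam-combination (+ 4) (ℤ.- + 3) (ℤ.- + 1) (+ 0) kχ₀ k²χ k⁴χ e))) ⟩
    E₅ ∎)

-- First-order linear differential equations

·-vanish : ∀ f g n → (∀ {k} → k ℕ.≤ n → g k ≡ 0ℚ) → (f · g) (suc n) ≡ f 0 * g (suc n)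
·-vanish f g n g≡0 = trans (·-at f g (suc n)) (trans (⊛-suc f g n)
  (trans (cong (f 0 * g (suc n) ℚ.+_) (sum-zero n λ {k} _ →
      trans (cong (f (suc k) *_) (g≡0 (ℕₚ.m∸n≤m n k))) (ℚₚ.*-zeroʳ (f (suc k)))))
    (ℚₚ.+-identityʳ _)))

vanish-below : (u : Series) → u 0 ≡ 0ℚ → (∀ n → (∀ {k} → k ℕ.≤ n → u k ≡ 0ℚ) → u (suc n) ≡ 0ℚ) → u ≈ 𝟘
vanish-below u u₀≡0 step = pointwise λ n → trans (below n ℕₚ.≤-refl) (sym (𝟘-at n))
  where
  below : ∀ n {k} → k ℕ.≤ n → u k ≡ 0ℚ
  below n k≤n with ℕₚ.m≤n⇒m<n∨m≡n k≤n
  below (suc n) _ | inj₁ (s≤s k≤n) = below n k≤n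
  below zero _ | inj₂ refl = u₀≡0
  below (suc n) _ | inj₂ refl = step n (below n)

-- If u vanishes up to q^n, the coefficient of q^(n+1) in the equation reads (n + 1) u_{n+1} = f_0
-- u_{n+1} = 0.
linear-ODE-unique₀ : ∀ f u → f 0 ≡ 0ℚ → D u ≈ f · u → u 0 ≡ 0ℚ → u ≈ 𝟘
linear-ODE-unique₀ f u f₀≡0 Du≈fu u₀≡0 = vanish-below u u₀≡0 λ n below → *-cancelˡ-suc n (begin
  ℕ→ℚ (suc n) * u (suc n)   ≡⟨ at Du≈fu (suc n) ⟩
  (f · u) (suc n)           ≡⟨ ·-vanish f u n below ⟩
  f 0 * u (suc n)           ≡⟨ cong (_* u (suc n)) f₀≡0 ⟩
  0ℚ * u (suc n)            ≡⟨ ℚₚ.*-zeroˡ (u (suc n)) ⟩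
  0ℚ                        ≡⟨ ℚₚ.*-zeroʳ (ℕ→ℚ (suc n)) ⟨
  ℕ→ℚ (suc n) * 0ℚ          ∎)
  where open ≡-Reasoning

-- With f_0 = 1 the equation leaves u_1 free, so u_1 must be prescribed as well; for n ≥ 2 the
-- factor n - 1 can be cancelled. The resonance occurs in `27tN`, where f is `Y`.
linear-ODE-unique₁ : ∀ f u → f 0 ≡ 1ℚ → D u ≈ f · u → u 0 ≡ 0ℚ → u 1 ≡ 0ℚ → u ≈ 𝟘
linear-ODE-unique₁ f u f₀≡1 Du≈fu u₀≡0 u₁≡0 = vanish-below u u₀≡0 step
  where
  open ≡-Reasoning
  open ℚ-Solver
  step : ∀ n → (∀ {k} → k ℕ.≤ n → u k ≡ 0ℚ) → u (suc n) ≡ 0ℚ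
  step zero _ = u₁≡0
  step (suc n) below = *-cancelˡ-suc n (begin
    ℕ→ℚ (suc n) * v                 ≡⟨ solve 2 (λ k v → k :* v := (con (+ 1) :+ k) :* v :- con (+ 1) :* v) refl (ℕ→ℚ (suc n)) v ⟩
    (1ℚ + ℕ→ℚ (suc n)) * v - 1ℚ * v ≡⟨ cong (λ z → z * v - 1ℚ * v) (ℕ→ℚ-suc (suc n)) ⟨
    ℕ→ℚ (2 ℕ.+ n) * v - 1ℚ * v      ≡⟨ cong (_- 1ℚ * v) (trans (at Du≈fu (2 ℕ.+ n)) (trans (·-vanish f u (suc n) below) (cong (_* v) f₀≡1))) ⟩
    1ℚ * v - 1ℚ * v                 ≡⟨ solve 2 (λ k v → con (+ 1) :* v :- con (+ 1) :* v := k :* con (+ 0)) refl (ℕ→ℚ (suc n)) v ⟩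
    ℕ→ℚ (suc n) * 0ℚ                ∎)
    where v = u (2 ℕ.+ n)

-- Powers

infixr 8 _^_
_^_ : Series → ℕ → Series
f ^ zero = 𝟙
f ^ suc n = f · f ^ n

^-cong : ∀ {f g} n → f ≈ g → f ^ n ≈ g ^ n
^-cong zero _ = ≈-refl
^-cong (suc n) f≈g = ·-cong f≈g (^-cong n f≈g)

^-·-distrib : ∀ f g n → (f · g) ^ n ≈ f ^ n · g ^ n
^-·-distrib f g zero = ≈-sym (·-identityˡ 𝟙)
^-·-distrib f g (suc n) = ≈-trans (·-cong ≈-refl (^-·-distrib f g n))
  (solve 4 (λ f g a b → f :* g :* (a :* b) := f :* a :* (g :* b)) ≈-refl f g (f ^ n) (g ^ n))
  where open Series-Solver

^-+ : ∀ f m n → f ^ (m ℕ.+ n) ≈ f ^ m · f ^ n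
^-+ f zero n = ≈-sym (·-identityˡ (f ^ n))
^-+ f (suc m) n = ≈-trans (·-cong ≈-refl (^-+ f m n)) (≈-sym (·-assoc f (f ^ m) (f ^ n)))

𝟙-^ : ∀ n → 𝟙 ^ n ≈ 𝟙
𝟙-^ zero = ≈-refl
𝟙-^ (suc n) = ≈-trans (·-identityˡ (𝟙 ^ n)) (𝟙-^ n)

qPow-^ : ∀ n → qPow 1 ^ n ≈ qPow n
qPow-^ zero = pointwise λ _ → refl
qPow-^ (suc n) = ≈-trans (·-cong ≈-refl (qPow-^ n)) (qPow-+ 1 n)

-- Here ℓ is the logarithmic derivative of f. The product form D f = f ℓ needs no division, and so
-- also covers a series `t` without constant term.
D-^ : ∀ f ℓ n → D f ≈ f · ℓ → D (f ^ n) ≈ constS (ℕ→ℚ n) · (f ^ n · ℓ)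
D-^ f ℓ zero _ = ≈-trans (D-constS 1ℚ) (solve 1 (λ l → con (+ 0) := con (+ 0) :* (con (+ 1) :* l)) ≈-refl ℓ)
  where open Series-Solver
D-^ f ℓ (suc n) Df≈fℓ = begin
  D (f · f ^ n)                                         ≈⟨ D-· f (f ^ n) ⟩
  D f · f ^ n ⊕ f · D (f ^ n)                           ≈⟨ ⊕-cong (·-cong Df≈fℓ ≈-refl) (·-cong ≈-refl (D-^ f ℓ n Df≈fℓ)) ⟩
  f · ℓ · f ^ n ⊕ f · (constS (ℕ→ℚ n) · (f ^ n · ℓ))    ≈⟨ solve 4 (λ f l g k → f :* l :* g :+ f :* (k :* (g :* l)) := (con (+ 1) :+ k) :* (f :* g :* l)) ≈-refl f ℓ (f ^ n) (constS (ℕ→ℚ n)) ⟩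
  (𝟙 ⊕ constS (ℕ→ℚ n)) · (f · f ^ n · ℓ)                ≈⟨ ·-cong 1+n ≈-refl ⟩
  constS (ℕ→ℚ (suc n)) · (f · f ^ n · ℓ)                ∎
  where
  open ≈-Reasoning
  open Series-Solver
  1+n : 𝟙 ⊕ constS (ℕ→ℚ n) ≈ constS (ℕ→ℚ (suc n))
  1+n = pointwise λ where
    zero → trans (⊕-at 𝟙 (constS (ℕ→ℚ n)) 0) (sym (ℕ→ℚ-suc n))
    (suc i) → ⊕-at 𝟙 (constS (ℕ→ℚ n)) (suc i)

factor-q : ∀ f → f 0 ≡ 0ℚ → f ≈ qPow 1 · tailS f
factor-q f f₀≡0 = pointwise λ where
  zero → trans f₀≡0 (sym (qPow-·-zero 0 (tailS f)))
  (suc n) → sym (trans (qPow-·-suc 0 (tailS f) n) (at (·-identityˡ (tailS f)) n))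

-- Composition Σ β(j) t^j with a series t without constant term

module Composition (t : Series) (t₀≡0 : t 0 ≡ 0ℚ) where

  ^-< : ∀ {n j} → n ℕ.< j → (t ^ j) n ≡ 0ℚ
  ^-< {n} {j} n<j = trans
    (at (≈-trans (^-cong j (factor-q t t₀≡0)) (≈-trans (^-·-distrib (qPow 1) (tailS t) j) (·-cong (qPow-^ j) ≈-refl))) n)
    (qPow-·-< (tailS t ^ j) n<j)

  -- By `^-<` the power t^j starts at q^j or later, so the sum may stop at j = n.
  comp : (ℕ → ℚ) → Series
  comp β n = sumTo n (λ j → β j * (t ^ j) n)

  comp-extend : ∀ {n K} β → n ℕ.≤ K → comp β n ≡ sumTo K (λ j → β j * (t ^ j) n)
  comp-extend β n≤K = sym (sum-truncate n≤K λ {j} n<j → trans (cong (β j *_) (^-< n<j)) (ℚₚ.*-zeroʳ (β j)))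

  comp-cong : ∀ {β γ} → (∀ j → β j ≡ γ j) → comp β ≈ comp γ
  comp-cong p = pointwise λ n → sum-cong n λ {j} _ → cong (_* (t ^ j) n) (p j)

  comp-⊕ : ∀ β γ → comp (λ j → β j + γ j) ≈ comp β ⊕ comp γ
  comp-⊕ β γ = pointwise λ n → trans (sum-cong n λ {j} _ → ℚₚ.*-distribʳ-+ ((t ^ j) n) (β j) (γ j))
    (trans (sum-+ n (λ j → β j * (t ^ j) n) (λ j → γ j * (t ^ j) n)) (sym (⊕-at (comp β) (comp γ) n)))

  comp-* : ∀ c β → comp (λ j → c * β j) ≈ constS c · comp β
  comp-* c β = pointwise λ n → trans (sum-cong n λ {j} _ → ℚₚ.*-assoc c (β j) ((t ^ j) n))
    (trans (sum-*ˡ n c (λ j → β j * (t ^ j) n)) (sym (constS-· c (comp β) n)))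

  comp-constS : ∀ c → comp (constS c) ≈ constS c
  comp-constS c = pointwise λ n → trans
    (sum-single {n} {0} {λ j → constS c j * (t ^ j) n} z≤n
      λ { {zero} 0≢0 → contradiction refl 0≢0 ; {suc j} _ → ℚₚ.*-zeroˡ ((t ^ suc j) n) })
    (trans (sym (constS-· c 𝟙 n)) (at (·-identityʳ (constS c)) n))

  comp-·-at : ∀ β g n → (comp β · g) n ≡ sumTo n (λ j → β j * (t ^ j · g) n)
  comp-·-at β g n = begin
    (comp β · g) n
      ≡⟨ ·-at (comp β) g n ⟩
    sumTo n (λ k → comp β k * g (n ∸ k))
      ≡⟨ sum-cong n (λ {k} k≤n → trans (cong (_* g (n ∸ k)) (comp-extend β k≤n)) (sym (sum-*ʳ n (g (n ∸ k)) (λ j → β j * (t ^ j) k)))) ⟩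
    sumTo n (λ k → sumTo n (λ j → β j * (t ^ j) k * g (n ∸ k)))
      ≡⟨ sum-swap n n (λ k j → β j * (t ^ j) k * g (n ∸ k)) ⟩
    sumTo n (λ j → sumTo n (λ k → β j * (t ^ j) k * g (n ∸ k)))
      ≡⟨ sum-cong n (λ {j} _ → trans (sum-cong n λ {k} _ → ℚₚ.*-assoc (β j) ((t ^ j) k) (g (n ∸ k)))
          (trans (sum-*ˡ n (β j) (λ k → (t ^ j) k * g (n ∸ k))) (cong (β j *_) (sym (·-at (t ^ j) g n))))) ⟩
    sumTo n (λ j → β j * (t ^ j · g) n) ∎
    where open ≡-Reasoning

  shift : (ℕ → ℚ) → ℕ → ℚ
  shift β zero = 0ℚ
  shift β (suc j) = β j

  comp-shift : ∀ β → comp (shift β) ≈ comp β · t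
  comp-shift β = pointwise λ n → trans (eq n) (sym (comp-·-at β t n))
    where
    open ≡-Reasoning
    eq : ∀ n → comp (shift β) n ≡ sumTo n (λ j → β j * (t ^ j · t) n)
    eq n = begin
      comp (shift β) n
        ≡⟨ comp-extend (shift β) (ℕₚ.n≤1+n n) ⟩
      sumTo (suc n) (λ j → shift β j * (t ^ j) n)
        ≡⟨ sum-head n (λ j → shift β j * (t ^ j) n) ⟩
      0ℚ * 𝟙 n + sumTo n (λ j → β j * (t · t ^ j) n)
        ≡⟨ cong (_+ sumTo n (λ j → β j * (t · t ^ j) n)) (ℚₚ.*-zeroˡ (𝟙 n)) ⟩
      0ℚ + sumTo n (λ j → β j * (t · t ^ j) n)
        ≡⟨ ℚₚ.+-identityˡ _ ⟩
      sumTo n (λ j → β j * (t · t ^ j) n)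
        ≡⟨ sum-cong n (λ {j} _ → cong (β j *_) (at (·-comm t (t ^ j)) n)) ⟩
      sumTo n (λ j → β j * (t ^ j · t) n) ∎

  comp-uncons : ∀ β → comp β ≈ constS (β 0) ⊕ comp (tailS β) · t
  comp-uncons β = ≈-trans (comp-cong {β} {λ j → constS (β 0) j + shift (tailS β) j} λ where
      zero → sym (ℚₚ.+-identityʳ (β 0))
      (suc j) → sym (ℚₚ.+-identityˡ (β (suc j))))
    (≈-trans (comp-⊕ (constS (β 0)) (shift (tailS β))) (⊕-cong (comp-constS (β 0)) (comp-shift (tailS β))))

  ·-t-cong-< : ∀ {f g} n → (∀ {k} → k ℕ.< n → f k ≡ g k) → (f · t) n ≡ (g · t) n
  ·-t-cong-< {f} {g} n p = trans (to-tail f n) (trans (tail-eq n p) (sym (to-tail g n)))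
    where
    to-tail : ∀ f n → (f · t) n ≡ (qPow 1 · (f · tailS t)) n
    to-tail f = at (≈-trans (·-cong ≈-refl (factor-q t t₀≡0))
      (solve 3 (λ f q s → f :* (q :* s) := q :* (f :* s)) ≈-refl f (qPow 1) (tailS t)))
      where open Series-Solver
    tail-eq : ∀ n → (∀ {k} → k ℕ.< n → f k ≡ g k) → (qPow 1 · (f · tailS t)) n ≡ (qPow 1 · (g · tailS t)) n
    tail-eq zero _ = trans (qPow-·-zero 0 (f · tailS t)) (sym (qPow-·-zero 0 (g · tailS t)))
    tail-eq (suc n) p = trans (qPow-·-shift 1 (f · tailS t) n)
      (trans (·-cong-≤ n (λ k≤n → p (s≤s k≤n)) (λ _ → refl)) (sym (qPow-·-shift 1 (g · tailS t) n)))

  -- By strong induction on the coefficient: `comp-uncons` splits off the constant term and leaves a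
  -- multiple of t, whose n-th coefficient involves only earlier coefficients of the other factor,
  -- as in `·-t-cong-<`.
  comp-· : ∀ β γ → comp (β · γ) ≈ comp β · comp γ
  comp-· β γ = pointwise λ n → below (suc n) ℕₚ.≤-refl β γ
    where
    open ≡-Reasoning
    below : ∀ m {n} → n ℕ.< m → ∀ β γ → comp (β · γ) n ≡ (comp β · comp γ) n
    below (suc m) {n} (s≤s n≤m) β γ = begin
      comp (β · γ) n
        ≡⟨ at (comp-uncons (β · γ)) n ⟩
      (constS ((β · γ) 0) ⊕ comp (tailS (β · γ)) · t) n
        ≡⟨ ⊕-at (constS ((β · γ) 0)) (comp (tailS (β · γ)) · t) n ⟩
      constS ((β · γ) 0) n + (comp (tailS (β · γ)) · t) n
        ≡⟨ cong₂ _+_ (cong (λ z → constS z n) (·-at β γ 0)) (·-t-cong-< n λ {k} k<n → tail-step (ℕₚ.<-≤-trans k<n n≤m)) ⟩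
      constS (β 0 * γ 0) n + (V · t) n
        ≡⟨ cong (_+ (V · t) n) (sym (at const-mul n)) ⟩
      (constS (β 0) · constS (γ 0)) n + (V · t) n
        ≡⟨ ⊕-at (constS (β 0) · constS (γ 0)) (V · t) n ⟨
      (constS (β 0) · constS (γ 0) ⊕ V · t) n
        ≡⟨ at recombine n ⟩
      (comp β · comp γ) n ∎
      where
      V = constS (β 0) · comp (tailS γ) ⊕ comp (tailS β) · comp γ
      const-mul : constS (β 0) · constS (γ 0) ≈ constS (β 0 * γ 0)
      const-mul = pointwise λ where
        zero → constS-· (β 0) (constS (γ 0)) 0
        (suc i) → trans (constS-· (β 0) (constS (γ 0)) (suc i)) (ℚₚ.*-zeroʳ (β 0))
      tail-step : ∀ {k} → k ℕ.< m → comp (tailS (β · γ)) k ≡ V k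
      tail-step {k} k<m = begin
        comp (tailS (β · γ)) k
          ≡⟨ at (comp-cong {tailS (β · γ)} {λ j → β 0 * tailS γ j + (tailS β · γ) j} λ j →
              trans (·-at β γ (suc j)) (trans (⊛-suc β γ j) (cong (β 0 * γ (suc j) ℚ.+_) (sym (·-at (tailS β) γ j))))) k ⟩
        comp (λ j → β 0 * tailS γ j + (tailS β · γ) j) k
          ≡⟨ at (comp-⊕ (λ j → β 0 * tailS γ j) (tailS β · γ)) k ⟩
        (comp (λ j → β 0 * tailS γ j) ⊕ comp (tailS β · γ)) k
          ≡⟨ ⊕-at (comp (λ j → β 0 * tailS γ j)) (comp (tailS β · γ)) k ⟩
        comp (λ j → β 0 * tailS γ j) k + comp (tailS β · γ) k
          ≡⟨ cong₂ _+_ (at (comp-* (β 0) (tailS γ)) k) (below m k<m (tailS β) γ) ⟩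
        (constS (β 0) · comp (tailS γ)) k + (comp (tailS β) · comp γ) k
          ≡⟨ ⊕-at (constS (β 0) · comp (tailS γ)) (comp (tailS β) · comp γ) k ⟨
        V k ∎
      recombine : constS (β 0) · constS (γ 0) ⊕ V · t ≈ comp β · comp γ
      recombine = ≈-trans
        (solve 6 (λ b g b′ g′ c t → b :* g :+ (b :* g′ :+ b′ :* c) :* t := b :* (g :+ g′ :* t) :+ b′ :* t :* c) ≈-refl
          (constS (β 0)) (constS (γ 0)) (comp (tailS β)) (comp (tailS γ)) (comp γ) t)
        (≈-trans (⊕-cong (·-cong ≈-refl (≈-sym (comp-uncons γ))) ≈-refl)
        (≈-trans (solve 4 (λ b b′ c t → b :* c :+ b′ :* t :* c := (b :+ b′ :* t) :* c) ≈-refl (constS (β 0)) (comp (tailS β)) (comp γ) t)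
          (·-cong (≈-sym (comp-uncons β)) ≈-refl)))
        where open Series-Solver

  comp-^ : ∀ β m → comp β ^ m ≈ comp (β ^ m)
  comp-^ β zero = ≈-sym (comp-constS 1ℚ)
  comp-^ β (suc m) = ≈-trans (·-cong ≈-refl (comp-^ β m)) (≈-sym (comp-· β (β ^ m)))

  -- The chain rule q d/dq = ((q dt/dq)/t) (t d/dt), where t d/dt multiplies the j-th coefficient by
  -- j.
  D-comp : ∀ β ℓ → D t ≈ t · ℓ → D (comp β) ≈ comp (λ j → ℕ→ℚ j * β j) · ℓ
  D-comp β ℓ Dt≈tℓ = pointwise λ n → begin
    ℕ→ℚ n * comp β n
      ≡⟨ sum-*ˡ n (ℕ→ℚ n) (λ j → β j * (t ^ j) n) ⟨
    sumTo n (λ j → ℕ→ℚ n * (β j * (t ^ j) n))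
      ≡⟨ sum-cong n (λ {j} _ → term n j) ⟩
    sumTo n (λ j → ℕ→ℚ j * β j * (t ^ j · ℓ) n)
      ≡⟨ comp-·-at (λ j → ℕ→ℚ j * β j) ℓ n ⟨
    (comp (λ j → ℕ→ℚ j * β j) · ℓ) n ∎
    where
    open ≡-Reasoning
    open ℚ-Solver
    term : ∀ n j → ℕ→ℚ n * (β j * (t ^ j) n) ≡ ℕ→ℚ j * β j * (t ^ j · ℓ) n
    term n j = begin
      ℕ→ℚ n * (β j * (t ^ j) n)             ≡⟨ solve 3 (λ a b c → a :* (b :* c) := b :* (a :* c)) refl (ℕ→ℚ n) (β j) ((t ^ j) n) ⟩
      β j * D (t ^ j) n                     ≡⟨ cong (β j *_) (trans (at (D-^ t ℓ j Dt≈tℓ) n) (constS-· (ℕ→ℚ j) (t ^ j · ℓ) n)) ⟩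
      β j * (ℕ→ℚ j * (t ^ j · ℓ) n)         ≡⟨ solve 3 (λ a b c → a :* (b :* c) := b :* a :* c) refl (β j) (ℕ→ℚ j) ((t ^ j · ℓ) n) ⟩
      ℕ→ℚ j * β j * (t ^ j · ℓ) n           ∎

-- Inverses

module Inverse (h : Series) (h₀≡1 : h 0 ≡ 1ℚ) where

  private
    u : Series
    u = 𝟙 ⊝ h

    u₀≡0 : u 0 ≡ 0ℚ
    u₀≡0 = trans (⊝-at 𝟙 h 0) (cong (λ z → 1ℚ - z) h₀≡1)

  open Composition u u₀≡0

  -- The geometric series in 1 - h, which has no constant term; `comp-uncons` gives its equation i =
  -- 1 + i (1 - h).
  inverse : Series
  inverse = comp (λ _ → 1ℚ)

  ·-inverse : h · inverse ≈ 𝟙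
  ·-inverse = begin
    h · inverse                                  ≈⟨ solve 2 (λ h i → h :* i := con (+ 1) :+ con (+ 1) :* (i :- (con (+ 1) :+ i :* (con (+ 1) :- h)))) ≈-refl h inverse ⟩
    𝟙 ⊕ 𝟙 · (inverse ⊝ (𝟙 ⊕ inverse · u))        ≈⟨ drop-⊝ 𝟙 𝟙 (comp-uncons (λ _ → 1ℚ)) ⟩
    𝟙                                            ∎
    where
    open ≈-Reasoning
    open Series-Solver

-- First coefficients, and derivatives deduced from the five relations

affine-0 : ∀ c f → affine c f 0 ≡ 1ℚ
affine-0 c f = begin
  affine c f 0                                ≡⟨ ⊕-at 𝟙 (ℤ→Series c · lam f) 0 ⟩
  1ℚ + (ℤ→Series c · lam f) 0                 ≡⟨ cong (λ z → 1ℚ + z) (constS-· (ℤ→ℚ c) (lam f) 0) ⟩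
  1ℚ + ℤ→ℚ c * (weight f 1 * X 1 0)           ≡⟨ cong (λ z → 1ℚ + ℤ→ℚ c * (weight f 1 * z)) (X-< {1} {0} (s≤s z≤n)) ⟩
  1ℚ + ℤ→ℚ c * (weight f 1 * 0ℚ)              ≡⟨ solve 2 (λ c x → con (+ 1) :+ c :* (x :* con (+ 0)) := con (+ 1)) refl (ℤ→ℚ c) (weight f 1) ⟩
  1ℚ                                          ∎
  where
  open ≡-Reasoning
  open ℚ-Solver

affine-1 : ∀ c f → affine c f 1 ≡ ℤ→ℚ c * weight f 1
affine-1 c f = begin
  affine c f 1                                                    ≡⟨ ⊕-at 𝟙 (ℤ→Series c · lam f) 1 ⟩
  0ℚ + (ℤ→Series c · lam f) 1                                     ≡⟨ cong (λ z → 0ℚ + z) (constS-· (ℤ→ℚ c) (lam f) 1) ⟩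
  0ℚ + ℤ→ℚ c * (weight f 1 * X 1 1 + weight f 2 * X 2 1)          ≡⟨ cong₂ (λ y z → 0ℚ + ℤ→ℚ c * (weight f 1 * y + weight f 2 * z))
                                                                      (trans (X-suc 0 0) (geom-∣ {0} ∣-refl)) (X-< {2} {1} (s≤s (s≤s z≤n))) ⟩
  0ℚ + ℤ→ℚ c * (weight f 1 * 1ℚ + weight f 2 * 0ℚ)                ≡⟨ solve 3 (λ c x y → con (+ 0) :+ c :* (x :* con (+ 1) :+ y :* con (+ 0)) := c :* x) refl (ℤ→ℚ c) (weight f 1) (weight f 2) ⟩
  ℤ→ℚ c * weight f 1                                              ∎
  where
  open ≡-Reasoning
  open ℚ-Solver

-- The logarithmic derivative of b(q) = η(q)³ / η(q³).
Λ : Series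
Λ = lam kw ⊝ ℤ→Series (+ 4) · lam kχ₀

Λ-0 : Λ 0 ≡ 0ℚ
Λ-0 = trans (⊝-at (lam kw) (ℤ→Series (+ 4) · lam kχ₀) 0) (trans
  (cong₂ (λ x y → weight kw 1 * x - y) (X-< {1} {0} (s≤s z≤n)) (trans (constS-· (ℤ→ℚ (+ 4)) (lam kχ₀) 0)
    (cong (λ x → ℤ→ℚ (+ 4) * (weight kχ₀ 1 * x)) (X-< {1} {0} (s≤s z≤n)))))
  refl)

module _ where
  open ≈-Reasoning
  open Series-Solver

  Y≈P+3Λ : Y ≈ P ⊕ ℤ→Series (+ 3) · Λ
  Y≈P+3Λ = solve 2 (λ x z → con (+ 1) :+ con (+ 3) :* x
    := con (+ 1) :+ con (+ 12) :* z :+ con (+ 3) :* (x :- con (+ 4) :* z)) ≈-refl (lam kw) (lam kχ₀)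

  3DP : ℤ→Series (+ 3) · D P ≈ ℤ→Series (+ 2) · (P · Y ⊝ a · N)
  3DP = begin
    ℤ→Series (+ 3) · D P
      ≈⟨ ·-cong ≈-refl (≈-trans (D-cong (≈-sym a²≈P)) (D-· a a)) ⟩
    ℤ→Series (+ 3) · (D a · a ⊕ a · D a)
      ≈⟨ solve 5 (λ a d y n p → con (+ 3) :* (d :* a :+ a :* d)
          := con (+ 2) :* (p :* y :- a :* n)
             :+ (con (+ 2) :* a) :* (con (+ 3) :* d :- (a :* y :- n))
             :+ (con (+ 2) :* y) :* (a :* a :- p)) ≈-refl a (D a) Y N P ⟩
    ℤ→Series (+ 2) · (P · Y ⊝ a · N) ⊕ (ℤ→Series (+ 2) · a) · (ℤ→Series (+ 3) · D a ⊝ (a · Y ⊝ N)) ⊕ (ℤ→Series (+ 2) · Y) · (a · a ⊝ P)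
      ≈⟨ drop-⊝ _ (ℤ→Series (+ 2) · Y) a²≈P ⟩
    ℤ→Series (+ 2) · (P · Y ⊝ a · N) ⊕ (ℤ→Series (+ 2) · a) · (ℤ→Series (+ 3) · D a ⊝ (a · Y ⊝ N))
      ≈⟨ drop-⊝ _ (ℤ→Series (+ 2) · a) 3Da≈aY-N ⟩
    ℤ→Series (+ 2) · (P · Y ⊝ a · N) ∎

  -- Since 3 Λ = Y - P, this is the difference of the formulas for 3 D Y and 3 D P.
  9DΛ : ℤ→Series (+ 9) · D Λ ≈ Y · Y ⊕ a · N ⊝ ℤ→Series (+ 2) · (P · Y)
  9DΛ = begin
    ℤ→Series (+ 9) · D Λ
      ≈⟨ solve 6 (λ l a y n p d → con (+ 9) :* l := y :* y :+ a :* n :- con (+ 2) :* (p :* y)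
          :+ con (+ 1) :* (con (+ 3) :* (d :+ con (+ 3) :* l) :- (y :* y :- a :* n))
          :+ con (ℤ.- + 1) :* (con (+ 3) :* d :- con (+ 2) :* (p :* y :- a :* n))) ≈-refl (D Λ) a Y N P (D P) ⟩
    Y · Y ⊕ a · N ⊝ ℤ→Series (+ 2) · (P · Y)
      ⊕ 𝟙 · (ℤ→Series (+ 3) · (D P ⊕ ℤ→Series (+ 3) · D Λ) ⊝ (Y · Y ⊝ a · N))
      ⊕ ℤ→Series (ℤ.- + 1) · (ℤ→Series (+ 3) · D P ⊝ ℤ→Series (+ 2) · (P · Y ⊝ a · N))
      ≈⟨ drop-⊝ _ (ℤ→Series (ℤ.- + 1)) 3DP ⟩
    Y · Y ⊕ a · N ⊝ ℤ→Series (+ 2) · (P · Y)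
      ⊕ 𝟙 · (ℤ→Series (+ 3) · (D P ⊕ ℤ→Series (+ 3) · D Λ) ⊝ (Y · Y ⊝ a · N))
      ≈⟨ drop-⊝ _ 𝟙 (≈-trans (·-cong ≈-refl (≈-sym DY)) 3DY≈Y²-aN) ⟩
    Y · Y ⊕ a · N ⊝ ℤ→Series (+ 2) · (P · Y) ∎
    where
    DY : D Y ≈ D P ⊕ ℤ→Series (+ 3) · D Λ
    DY = ≈-trans (D-cong Y≈P+3Λ) (≈-trans (D-⊕ P (ℤ→Series (+ 3) · Λ)) (⊕-cong ≈-refl (D-constS-· (ℤ→ℚ (+ 3)) Λ)))

  -- The two weight five relations combine to D N = (Y - P) N. Hence `N` has the logarithmic
  -- derivative of b³.
  DN≈3ΛN : D N ≈ (ℤ→Series (+ 3) · Λ) · N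
  DN≈3ΛN = begin
    D N                                           ≈⟨ DN≈YN-E₅ ⟩
    Y · N ⊝ E₅                                    ≈⟨ ⊕-cong (·-cong Y≈P+3Λ ≈-refl) (⊖-cong E₅≈PN) ⟩
    (P ⊕ ℤ→Series (+ 3) · Λ) · N ⊝ P · N          ≈⟨ solve 3 (λ p l n → (p :+ con (+ 3) :* l) :* n :- p :* n := con (+ 3) :* l :* n) ≈-refl P Λ N ⟩
    (ℤ→Series (+ 3) · Λ) · N                      ∎

  -- As a P = a³, this is 3 a² D a with the relation for 3 D a inserted.
  D-aP : D (a · P) ≈ P · (a · Y ⊝ N)
  D-aP = constS-cancel 2 (begin
    ℤ→Series (+ 3) · D (a · P)
      ≈⟨ ·-cong ≈-refl (D-· a P) ⟩
    ℤ→Series (+ 3) · (D a · P ⊕ a · D P)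
      ≈⟨ solve 6 (λ a y n p da dp → con (+ 3) :* (da :* p :+ a :* dp) := con (+ 3) :* (p :* (a :* y :- n))
          :+ p :* (con (+ 3) :* da :- (a :* y :- n))
          :+ a :* (con (+ 3) :* dp :- con (+ 2) :* (p :* y :- a :* n))
          :+ (con (ℤ.- + 2) :* n) :* (a :* a :- p)) ≈-refl a Y N P (D a) (D P) ⟩
    ℤ→Series (+ 3) · (P · (a · Y ⊝ N)) ⊕ P · (ℤ→Series (+ 3) · D a ⊝ (a · Y ⊝ N))
      ⊕ a · (ℤ→Series (+ 3) · D P ⊝ ℤ→Series (+ 2) · (P · Y ⊝ a · N)) ⊕ (ℤ→Series (ℤ.- + 2) · N) · (a · a ⊝ P)
      ≈⟨ drop-⊝ _ (ℤ→Series (ℤ.- + 2) · N) a²≈P ⟩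
    ℤ→Series (+ 3) · (P · (a · Y ⊝ N)) ⊕ P · (ℤ→Series (+ 3) · D a ⊝ (a · Y ⊝ N))
      ⊕ a · (ℤ→Series (+ 3) · D P ⊝ ℤ→Series (+ 2) · (P · Y ⊝ a · N))
      ≈⟨ drop-⊝ _ a 3DP ⟩
    ℤ→Series (+ 3) · (P · (a · Y ⊝ N)) ⊕ P · (ℤ→Series (+ 3) · D a ⊝ (a · Y ⊝ N))
      ≈⟨ drop-⊝ _ P 3Da≈aY-N ⟩
    ℤ→Series (+ 3) · (P · (a · Y ⊝ N)) ∎)

-- The eta quotient enters only through its constant term and its logarithmic derivative, so it is
-- kept abstract; t = q/H then satisfies D t = t P.
module Hauptmodul (H : Series) (H₀≡1 : H 0 ≡ 1ℚ) (DH : D H ≈ H · (𝟙 ⊝ P)) where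

  open Inverse H H₀≡1 renaming (inverse to R; ·-inverse to H·R)

  t : Series
  t = qPow 1 · R

  t₀≡0 : t 0 ≡ 0ℚ
  t₀≡0 = qPow-·-zero 0 R

  open Composition t t₀≡0 public

  module _ where
    open ≈-Reasoning
    open Series-Solver

    DR : D R ≈ R · (P ⊝ 𝟙)
    DR = begin
      D R
        ≈⟨ solve 5 (λ r dr h dh p → dr := r :* (p :- con (+ 1))
            :+ r :* (dh :* r :+ h :* dr :- con (+ 0))
            :+ :- (r :* r) :* (dh :- h :* (con (+ 1) :- p))
            :+ :- (dr :+ r :* (con (+ 1) :- p)) :* (h :* r :- con (+ 1))) ≈-refl R (D R) H (D H) P ⟩
      R · (P ⊝ 𝟙) ⊕ R · (D H · R ⊕ H · D R ⊝ 𝟘) ⊕ (⊖ (R · R)) · (D H ⊝ H · (𝟙 ⊝ P)) ⊕ (⊖ (D R ⊕ R · (𝟙 ⊝ P))) · (H · R ⊝ 𝟙)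
        ≈⟨ drop-⊝ _ (⊖ (D R ⊕ R · (𝟙 ⊝ P))) H·R ⟩
      R · (P ⊝ 𝟙) ⊕ R · (D H · R ⊕ H · D R ⊝ 𝟘) ⊕ (⊖ (R · R)) · (D H ⊝ H · (𝟙 ⊝ P))
        ≈⟨ drop-⊝ _ (⊖ (R · R)) DH ⟩
      R · (P ⊝ 𝟙) ⊕ R · (D H · R ⊕ H · D R ⊝ 𝟘)
        ≈⟨ drop-⊝ _ R (≈-trans (≈-sym (D-· H R)) (≈-trans (D-cong H·R) (D-constS 1ℚ))) ⟩
      R · (P ⊝ 𝟙) ∎

    Dt : D t ≈ t · P
    Dt = begin
      D (qPow 1 · R)                                ≈⟨ D-· (qPow 1) R ⟩
      D (qPow 1) · R ⊕ qPow 1 · D R                 ≈⟨ ⊕-cong (·-cong (D-qPow 1) ≈-refl) (·-cong ≈-refl DR) ⟩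
      𝟙 · qPow 1 · R ⊕ qPow 1 · (R · (P ⊝ 𝟙))       ≈⟨ solve 3 (λ q r p → con (+ 1) :* q :* r :+ q :* (r :* (p :- con (+ 1))) := q :* r :* p) ≈-refl (qPow 1) R P ⟩
      qPow 1 · R · P                                ∎

    -- c³ = a³ - b³ in the form 27 t = c³ / b³.
    27tN : ℤ→Series (+ 27) · (t · N) ≈ a · P ⊝ N
    27tN = begin
      ℤ→Series (+ 27) · (t · N)       ≈⟨ solve 2 (λ x y → x := y :+ con (+ 1) :* (x :- y :- con (+ 0))) ≈-refl (ℤ→Series (+ 27) · (t · N)) (a · P ⊝ N) ⟩
      a · P ⊝ N ⊕ 𝟙 · (ρ ⊝ 𝟘)         ≈⟨ drop-⊝ (a · P ⊝ N) 𝟙 (linear-ODE-unique₁ Y ρ (affine-0 (+ 3) kw) Dρ ρ₀ ρ₁) ⟩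
      a · P ⊝ N                       ∎
      where
      ρ : Series
      ρ = ℤ→Series (+ 27) · (t · N) ⊝ (a · P ⊝ N)
      Dρ : D ρ ≈ Y · ρ
      Dρ = begin
        D ρ
          ≈⟨ D-⊝ (ℤ→Series (+ 27) · (t · N)) (a · P ⊝ N) ⟩
        D (ℤ→Series (+ 27) · (t · N)) ⊝ D (a · P ⊝ N)
          ≈⟨ ⊕-cong (≈-trans (D-constS-· (ℤ→ℚ (+ 27)) (t · N)) (·-cong ≈-refl (D-· t N))) (⊖-cong (D-⊝ (a · P) N)) ⟩
        ℤ→Series (+ 27) · (D t · N ⊕ t · D N) ⊝ (D (a · P) ⊝ D N)
          ≈⟨ ⊕-cong (·-cong ≈-refl (⊕-cong (·-cong Dt ≈-refl) (·-cong ≈-refl DN))) (⊖-cong (⊕-cong D-aP (⊖-cong DN))) ⟩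
        ℤ→Series (+ 27) · (t · P · N ⊕ t · (Y · N ⊝ P · N)) ⊝ (P · (a · Y ⊝ N) ⊝ (Y · N ⊝ P · N))
          ≈⟨ solve 5 (λ t p n y a → con (+ 27) :* (t :* p :* n :+ t :* (y :* n :- p :* n)) :- (p :* (a :* y :- n) :- (y :* n :- p :* n))
              := y :* (con (+ 27) :* (t :* n) :- (a :* p :- n))) ≈-refl t P N Y a ⟩
        Y · ρ ∎
        where
        DN : D N ≈ Y · N ⊝ P · N
        DN = ≈-trans DN≈YN-E₅ (⊕-cong ≈-refl (⊖-cong E₅≈PN))
      ρ-at : ∀ n → ρ n ≡ ℤ→ℚ (+ 27) * (t ⊛ N) n - ((a ⊛ P) n - N n)
      ρ-at n = trans (⊝-at (ℤ→Series (+ 27) · (t · N)) (a · P ⊝ N) n) (cong₂ _-_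
        (trans (constS-· (ℤ→ℚ (+ 27)) (t · N) n) (cong (ℤ→ℚ (+ 27) *_) (·-at t N n)))
        (trans (⊝-at (a · P) N n) (cong (_- N n) (·-at a P n))))
      ρ₀ : ρ 0 ≡ 0ℚ
      ρ₀ = trans (ρ-at 0) (trans
        (cong₂ (λ x y → ℤ→ℚ (+ 27) * (x * N 0) - (a 0 * P 0 - y)) t₀≡0 (affine-0 (ℤ.- + 9) k²χ))
        (trans (cong₂ (λ x y → ℤ→ℚ (+ 27) * (0ℚ * N 0) - (x * y - 1ℚ)) (affine-0 (+ 6) e) (affine-0 (+ 12) kχ₀))
          (trans (cong (λ x → ℤ→ℚ (+ 27) * (0ℚ * x) - (1ℚ * 1ℚ - 1ℚ)) (affine-0 (ℤ.- + 9) k²χ)) refl)))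
      R₀ : R 0 ≡ 1ℚ
      R₀ = refl
      t₁ : t 1 ≡ 1ℚ
      t₁ = trans (qPow-·-shift 1 R 0) R₀
      first-coefficient : ∀ {t₀ t₁ n₀ n₁ a₀ a₁ p₀ p₁ : ℚ} → t₀ ≡ 0ℚ → t₁ ≡ 1ℚ → n₀ ≡ 1ℚ → n₁ ≡ ℤ→ℚ (ℤ.- + 9) →
        a₀ ≡ 1ℚ → a₁ ≡ ℤ→ℚ (+ 6) → p₀ ≡ 1ℚ → p₁ ≡ ℤ→ℚ (+ 12) →
        ℤ→ℚ (+ 27) * (t₀ * n₁ + t₁ * n₀) - ((a₀ * p₁ + a₁ * p₀) - n₁) ≡ 0ℚ
      first-coefficient refl refl refl refl refl refl refl refl = refl
      ρ₁ : ρ 1 ≡ 0ℚ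
      ρ₁ = trans (ρ-at 1) (first-coefficient t₀≡0 t₁ (affine-0 (ℤ.- + 9) k²χ) (affine-1 (ℤ.- + 9) k²χ)
        (affine-0 (+ 6) e) (affine-1 (+ 6) e) (affine-0 (+ 12) kχ₀) (affine-1 (+ 12) kχ₀))

  -- The hypergeometric equation, with θ = t d/dt: θ² ψ + t (27 θ² + 18 θ + 3) ψ = 0.
  module _ (β : ℕ → ℚ) (β₀≡1 : β 0 ≡ 1ℚ)
    (β-suc : ∀ j → ℕ→ℚ (suc j) * (ℕ→ℚ (suc j) * β (suc j))
      ≡ - (ℤ→ℚ (+ 27) * (ℕ→ℚ j * (ℕ→ℚ j * β j)) + ℤ→ℚ (+ 18) * (ℕ→ℚ j * β j) + ℤ→ℚ (+ 3) * β j))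
    where

    private
      θβ θ²β rhs : ℕ → ℚ
      θβ j = ℕ→ℚ j * β j
      θ²β j = ℕ→ℚ j * θβ j
      rhs j = ℤ→ℚ (+ 27) * θ²β j + ℤ→ℚ (+ 18) * θβ j + ℤ→ℚ (+ 3) * β j

      ψ ψ₁ ψ₂ W : Series
      ψ = comp β
      ψ₁ = comp θβ
      ψ₂ = comp θ²β
      W = ψ₁ · P ⊝ Λ · ψ

      open ≈-Reasoning
      open Series-Solver

      ψ-ODE : ψ₂ ≈ ⊖ ((ℤ→Series (+ 27) · ψ₂ ⊕ ℤ→Series (+ 18) · ψ₁ ⊕ ℤ→Series (+ 3) · ψ) · t)
      ψ-ODE = begin
        comp θ²β
          ≈⟨ comp-cong {θ²β} {λ j → ℤ→ℚ (ℤ.- + 1) * shift rhs j} coefficients ⟩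
        comp (λ j → ℤ→ℚ (ℤ.- + 1) * shift rhs j)
          ≈⟨ ≈-trans (comp-* (ℤ→ℚ (ℤ.- + 1)) (shift rhs)) (·-cong ≈-refl (comp-shift rhs)) ⟩
        ℤ→Series (ℤ.- + 1) · (comp rhs · t)
          ≈⟨ solve 2 (λ r t → con (ℤ.- + 1) :* (r :* t) := :- (r :* t)) ≈-refl (comp rhs) t ⟩
        ⊖ (comp rhs · t)
          ≈⟨ ⊖-cong (·-cong (≈-trans (comp-⊕ (λ j → ℤ→ℚ (+ 27) * θ²β j + ℤ→ℚ (+ 18) * θβ j) (λ j → ℤ→ℚ (+ 3) * β j))
              (⊕-cong (≈-trans (comp-⊕ (λ j → ℤ→ℚ (+ 27) * θ²β j) (λ j → ℤ→ℚ (+ 18) * θβ j))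
                (⊕-cong (comp-* (ℤ→ℚ (+ 27)) θ²β) (comp-* (ℤ→ℚ (+ 18)) θβ))) (comp-* (ℤ→ℚ (+ 3)) β))) ≈-refl) ⟩
        ⊖ ((ℤ→Series (+ 27) · ψ₂ ⊕ ℤ→Series (+ 18) · ψ₁ ⊕ ℤ→Series (+ 3) · ψ) · t) ∎
        where
        neg-one : ∀ x → - x ≡ ℤ→ℚ (ℤ.- + 1) * x
        neg-one x = QS.solve 1 (λ x → QS.:- x QS.:= QS.con (ℤ.- + 1) QS.:* x) refl x
          where module QS = ℚ-Solver
        coefficients : ∀ j → θ²β j ≡ ℤ→ℚ (ℤ.- + 1) * shift rhs j
        coefficients zero = ℚₚ.*-zeroˡ (θβ 0)
        coefficients (suc j) = trans (β-suc j) (neg-one (rhs j))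

      Dψ : D ψ ≈ ψ₁ · P
      Dψ = D-comp β P Dt

      Dψ₁ : D ψ₁ ≈ ψ₂ · P
      Dψ₁ = D-comp θβ P Dt

      -- Eliminates t: multiplied by N, the leading factor 1 + 27 t of the hypergeometric equation
      -- becomes a P and 27 t becomes a P - N. A further factor a turns a P into P², the coefficient
      -- that ψ₂ has in the second derivative of ψ.
      9ψ₂P² : ℤ→Series (+ 9) · (ψ₂ · (P · P)) ≈ ⊖ (a · (a · P ⊝ N) · (ℤ→Series (+ 6) · ψ₁ ⊕ ψ))
      9ψ₂P² = constS-cancel 2 (begin
        ℤ→Series (+ 3) · (ℤ→Series (+ 9) · (ψ₂ · (P · P)))
          ≈⟨ solve 7 (λ a p n t f f₁ f₂ → con (+ 3) :* (con (+ 9) :* (f₂ :* (p :* p)))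
              := con (+ 3) :* (:- (a :* (a :* p :- n) :* (con (+ 6) :* f₁ :+ f)))
                 :+ (con (+ 27) :* n :* a) :* (f₂ :- :- ((con (+ 27) :* f₂ :+ con (+ 18) :* f₁ :+ con (+ 3) :* f) :* t))
                 :+ :- (a :* (con (+ 27) :* f₂ :+ con (+ 18) :* f₁ :+ con (+ 3) :* f)) :* (con (+ 27) :* (t :* n) :- (a :* p :- n))
                 :+ :- (con (+ 27) :* f₂ :* p) :* (a :* a :- p)) ≈-refl a P N t ψ ψ₁ ψ₂ ⟩
        ℤ→Series (+ 3) · (⊖ (a · (a · P ⊝ N) · (ℤ→Series (+ 6) · ψ₁ ⊕ ψ)))
          ⊕ (ℤ→Series (+ 27) · N · a) · (ψ₂ ⊝ ⊖ (θψ · t)) ⊕ (⊖ (a · θψ)) · (ℤ→Series (+ 27) · (t · N) ⊝ (a · P ⊝ N))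
          ⊕ (⊖ (ℤ→Series (+ 27) · ψ₂ · P)) · (a · a ⊝ P)
          ≈⟨ drop-⊝ _ (⊖ (ℤ→Series (+ 27) · ψ₂ · P)) a²≈P ⟩
        ℤ→Series (+ 3) · (⊖ (a · (a · P ⊝ N) · (ℤ→Series (+ 6) · ψ₁ ⊕ ψ)))
          ⊕ (ℤ→Series (+ 27) · N · a) · (ψ₂ ⊝ ⊖ (θψ · t)) ⊕ (⊖ (a · θψ)) · (ℤ→Series (+ 27) · (t · N) ⊝ (a · P ⊝ N))
          ≈⟨ drop-⊝ _ (⊖ (a · θψ)) 27tN ⟩
        ℤ→Series (+ 3) · (⊖ (a · (a · P ⊝ N) · (ℤ→Series (+ 6) · ψ₁ ⊕ ψ)))
          ⊕ (ℤ→Series (+ 27) · N · a) · (ψ₂ ⊝ ⊖ (θψ · t))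
          ≈⟨ drop-⊝ _ (ℤ→Series (+ 27) · N · a) ψ-ODE ⟩
        ℤ→Series (+ 3) · (⊖ (a · (a · P ⊝ N) · (ℤ→Series (+ 6) · ψ₁ ⊕ ψ))) ∎)
        where
        θψ : Series
        θψ = ℤ→Series (+ 27) · ψ₂ ⊕ ℤ→Series (+ 18) · ψ₁ ⊕ ℤ→Series (+ 3) · ψ

      -- The second-order operator factors through D - Λ.
      DW : D W ≈ Λ · W
      DW = constS-cancel 8 (begin
        ℤ→Series (+ 9) · D W
          ≈⟨ ·-cong ≈-refl (≈-trans (D-⊝ (ψ₁ · P) (Λ · ψ)) (⊕-cong
              (≈-trans (D-· ψ₁ P) (⊕-cong (·-cong Dψ₁ ≈-refl) ≈-refl))
              (⊖-cong (≈-trans (D-· Λ ψ) (⊕-cong ≈-refl (·-cong ≈-refl Dψ)))))) ⟩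
        ℤ→Series (+ 9) · (ψ₂ · P · P ⊕ ψ₁ · D P ⊝ (D Λ · ψ ⊕ Λ · (ψ₁ · P)))
          ≈⟨ solve 10 (λ a p n y l f f₁ f₂ dp dl → con (+ 9) :* (f₂ :* p :* p :+ f₁ :* dp :- (dl :* f :+ l :* (f₁ :* p)))
              := con (+ 9) :* (l :* (f₁ :* p :- l :* f))
                 :+ con (+ 1) :* (con (+ 9) :* (f₂ :* (p :* p)) :- :- (a :* (a :* p :- n) :* (con (+ 6) :* f₁ :+ f)))
                 :+ (con (+ 3) :* f₁) :* (con (+ 3) :* dp :- con (+ 2) :* (p :* y :- a :* n))
                 :+ :- f :* (con (+ 9) :* dl :- (y :* y :+ a :* n :- con (+ 2) :* (p :* y)))
                 :+ :- (p :* (con (+ 6) :* f₁ :+ f)) :* (a :* a :- p)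
                 :+ (con (+ 6) :* p :* f₁ :- f :* (y :- p :+ con (+ 3) :* l)) :* (y :- (p :+ con (+ 3) :* l)))
              ≈-refl a P N Y Λ ψ ψ₁ ψ₂ (D P) (D Λ) ⟩
        ℤ→Series (+ 9) · (Λ · W) ⊕ 𝟙 · _ ⊕ (ℤ→Series (+ 3) · ψ₁) · _ ⊕ (⊖ ψ) · _ ⊕ (⊖ (P · (ℤ→Series (+ 6) · ψ₁ ⊕ ψ))) · _
          ⊕ (ℤ→Series (+ 6) · P · ψ₁ ⊝ ψ · (Y ⊝ P ⊕ ℤ→Series (+ 3) · Λ)) · (Y ⊝ (P ⊕ ℤ→Series (+ 3) · Λ))
          ≈⟨ drop-⊝ _ _ Y≈P+3Λ ⟩
        ℤ→Series (+ 9) · (Λ · W) ⊕ 𝟙 · _ ⊕ (ℤ→Series (+ 3) · ψ₁) · _ ⊕ (⊖ ψ) · _ ⊕ (⊖ (P · (ℤ→Series (+ 6) · ψ₁ ⊕ ψ))) · (a · a ⊝ P)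
          ≈⟨ drop-⊝ _ _ a²≈P ⟩
        ℤ→Series (+ 9) · (Λ · W) ⊕ 𝟙 · _ ⊕ (ℤ→Series (+ 3) · ψ₁) · _ ⊕ (⊖ ψ) · _
          ≈⟨ drop-⊝ _ (⊖ ψ) 9DΛ ⟩
        ℤ→Series (+ 9) · (Λ · W) ⊕ 𝟙 · _ ⊕ (ℤ→Series (+ 3) · ψ₁) · _
          ≈⟨ drop-⊝ _ (ℤ→Series (+ 3) · ψ₁) 3DP ⟩
        ℤ→Series (+ 9) · (Λ · W) ⊕ 𝟙 · _
          ≈⟨ drop-⊝ _ 𝟙 9ψ₂P² ⟩
        ℤ→Series (+ 9) · (Λ · W) ∎)

      W₀ : W 0 ≡ 0ℚ
      W₀ = trans (⊝-at (ψ₁ · P) (Λ · ψ) 0) (trans (cong₂ _-_ (·-at ψ₁ P 0) (·-at Λ ψ 0))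
        (trans (cong₂ (λ x y → x * P 0 - y * ψ 0) (trans (cong (_* 1ℚ) (ℚₚ.*-zeroˡ (β 0))) refl) Λ-0)
          (trans (cong₂ _-_ (ℚₚ.*-zeroˡ (P 0)) (ℚₚ.*-zeroˡ (ψ 0))) refl)))

      -- `W` is D ψ - Λ ψ. It solves D W = Λ W without constant term, so it vanishes, and the
      -- second-order equation has been lowered to first order.
      Dψ≈ψΛ : D ψ ≈ ψ · Λ
      Dψ≈ψΛ = begin
        D ψ                         ≈⟨ Dψ ⟩
        ψ₁ · P                      ≈⟨ solve 3 (λ x l f → x := f :* l :+ con (+ 1) :* (x :- l :* f :- con (+ 0))) ≈-refl (ψ₁ · P) Λ ψ ⟩
        ψ · Λ ⊕ 𝟙 · (W ⊝ 𝟘)         ≈⟨ drop-⊝ (ψ · Λ) 𝟙 (linear-ODE-unique₀ Λ W Λ-0 DW W₀) ⟩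
        ψ · Λ                       ∎

    -- Both sides have constant term 1 and logarithmic derivative 3 Λ, so their difference solves a
    -- homogeneous first-order equation and starts at 0.
    ψ³≈N : comp β ^ 3 ≈ N
    ψ³≈N = begin
      ψ ^ 3                     ≈⟨ solve 2 (λ x n → x := n :+ con (+ 1) :* (x :- n :- con (+ 0))) ≈-refl (ψ ^ 3) N ⟩
      N ⊕ 𝟙 · (ψ ^ 3 ⊝ N ⊝ 𝟘)   ≈⟨ drop-⊝ N 𝟙 (linear-ODE-unique₀ (ℤ→Series (+ 3) · Λ) (ψ ^ 3 ⊝ N) 3Λ₀ Du u₀) ⟩
      N                         ∎
      where
      Du : D (ψ ^ 3 ⊝ N) ≈ (ℤ→Series (+ 3) · Λ) · (ψ ^ 3 ⊝ N)
      Du = begin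
        D (ψ ^ 3 ⊝ N)
          ≈⟨ ≈-trans (D-⊝ (ψ ^ 3) N) (⊕-cong (D-^ ψ Λ 3 Dψ≈ψΛ) (⊖-cong DN≈3ΛN)) ⟩
        ℤ→Series (+ 3) · (ψ ^ 3 · Λ) ⊝ (ℤ→Series (+ 3) · Λ) · N
          ≈⟨ solve 3 (λ x l n → con (+ 3) :* (x :* l) :- con (+ 3) :* l :* n := con (+ 3) :* l :* (x :- n)) ≈-refl (ψ ^ 3) Λ N ⟩
        (ℤ→Series (+ 3) · Λ) · (ψ ^ 3 ⊝ N) ∎
      3Λ₀ : (ℤ→Series (+ 3) · Λ) 0 ≡ 0ℚ
      3Λ₀ = trans (constS-· (ℤ→ℚ (+ 3)) Λ 0) (cong (ℤ→ℚ (+ 3) *_) Λ-0)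
      ψ₀ : ψ 0 ≡ 1ℚ
      ψ₀ = cong (_* 1ℚ) β₀≡1
      u₀ : (ψ ^ 3 ⊝ N) 0 ≡ 0ℚ
      u₀ = trans (⊝-at (ψ ^ 3) N 0) (cong₂ _-_
        (trans (·-at ψ (ψ ^ 2) 0) (cong₂ _*_ ψ₀ (trans (·-at ψ (ψ ^ 1) 0) (cong₂ _*_ ψ₀ (trans (·-at ψ 𝟙 0) (cong (_* 1ℚ) ψ₀))))))
        (affine-0 (ℤ.- + 9) k²χ))

    E₅≈ : E₅ ≈ comp (β ^ 3) · P
    E₅≈ = begin
      E₅                ≈⟨ E₅≈PN ⟩
      P · N             ≈⟨ ·-cong ≈-refl (≈-sym ψ³≈N) ⟩
      P · comp β ^ 3    ≈⟨ ·-comm P (comp β ^ 3) ⟩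
      comp β ^ 3 · P    ≈⟨ ·-cong (comp-^ β 3) ≈-refl ⟩
      comp (β ^ 3) · P  ∎

  -- Lagrange inversion: P = D t / t, and D (H^i) = i H^i (1 - P) kills the coefficient of q^i in P H^i.

  PH^i-at-i : ∀ i → (P · H ^ suc i) (suc i) ≡ 0ℚ
  PH^i-at-i i = *-cancelˡ-suc i (begin
    k * (P · H ^ suc i) (suc i)           ≡⟨ constS-· k (P · H ^ suc i) (suc i) ⟨
    (constS k · (P · H ^ suc i)) (suc i)  ≡⟨ at expand (suc i) ⟩
    (constS k · H ^ suc i ⊝ D (H ^ suc i)) (suc i)
                                          ≡⟨ ⊝-at (constS k · H ^ suc i) (D (H ^ suc i)) (suc i) ⟩
    (constS k · H ^ suc i) (suc i) - k * (H ^ suc i) (suc i)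
                                          ≡⟨ cong (_- k * (H ^ suc i) (suc i)) (constS-· k (H ^ suc i) (suc i)) ⟩
    k * (H ^ suc i) (suc i) - k * (H ^ suc i) (suc i)
                                          ≡⟨ QS.solve 2 (λ x k → x QS.:- x QS.:= k QS.:* QS.con (+ 0)) refl (k * (H ^ suc i) (suc i)) k ⟩
    k * 0ℚ                                ∎)
    where
    open ≡-Reasoning
    module QS = ℚ-Solver
    open Series-Solver
    k = ℕ→ℚ (suc i)
    expand : constS k · (P · H ^ suc i) ≈ constS k · H ^ suc i ⊝ D (H ^ suc i)
    expand = ≈-trans
      (solve 3 (λ k p h → k :* (p :* h) := k :* h :- k :* (h :* (con (+ 1) :- p))) ≈-refl (constS k) P (H ^ suc i))
      (⊕-cong ≈-refl (⊖-cong (≈-sym (D-^ H (𝟙 ⊝ P) (suc i) DH))))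

  -- Since t H = q, the j-th term contributes γ_j [q^(m-j)] P H^(m-j). This is γ_m for j = m and
  -- zero for j < m by `PH^i-at-i`; for j > m the power t^j starts too late.
  lagrange : ∀ γ m → (comp γ · P · H ^ m) m ≡ γ m
  lagrange γ m = begin
    (comp γ · P · H ^ m) m                          ≡⟨ at (·-assoc (comp γ) P (H ^ m)) m ⟩
    (comp γ · (P · H ^ m)) m                        ≡⟨ comp-·-at γ (P · H ^ m) m ⟩
    sumTo m (λ j → γ j * (t ^ j · (P · H ^ m)) m)   ≡⟨ sum-single ℕₚ.≤-refl (λ {j} j≢m → trans (cong (γ j *_) (off j j≢m)) (ℚₚ.*-zeroʳ (γ j))) ⟩
    γ m * (t ^ m · (P · H ^ m)) m                   ≡⟨ cong (γ m *_) (trans (residue m ℕₚ.≤-refl) (diag (ℕₚ.n∸n≡0 m))) ⟩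
    γ m * 1ℚ                                        ≡⟨ ℚₚ.*-identityʳ (γ m) ⟩
    γ m                                             ∎
    where
    open ≡-Reasoning
    open Series-Solver
    t^ : ∀ j → t ^ j ≈ qPow j · R ^ j
    t^ j = ≈-trans (^-·-distrib (qPow 1) R j) (·-cong (qPow-^ j) ≈-refl)
    RH : ∀ j → R ^ j · H ^ j ≈ 𝟙
    RH j = ≈-trans (≈-sym (^-·-distrib R H j)) (≈-trans (^-cong j (≈-trans (·-comm R H) H·R)) (𝟙-^ j))
    residue : ∀ j → j ℕ.≤ m → (t ^ j · (P · H ^ m)) m ≡ (P · H ^ (m ∸ j)) (m ∸ j)
    residue j j≤m = begin
      (t ^ j · (P · H ^ m)) m
        ≡⟨ at (·-cong (t^ j) (·-cong ≈-refl (≈-trans (at-exponent (sym (ℕₚ.m+[n∸m]≡n j≤m))) (^-+ H j (m ∸ j))))) m ⟩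
      (qPow j · R ^ j · (P · (H ^ j · H ^ (m ∸ j)))) m
        ≡⟨ at (solve 5 (λ q r p h g → q :* r :* (p :* (h :* g)) := r :* h :* (q :* (p :* g))) ≈-refl (qPow j) (R ^ j) P (H ^ j) (H ^ (m ∸ j))) m ⟩
      (R ^ j · H ^ j · (qPow j · (P · H ^ (m ∸ j)))) m
        ≡⟨ at (≈-trans (·-cong (RH j) ≈-refl) (·-identityˡ _)) m ⟩
      (qPow j · (P · H ^ (m ∸ j))) m
        ≡⟨ cong (qPow j · (P · H ^ (m ∸ j))) (ℕₚ.m+[n∸m]≡n j≤m) ⟨
      (qPow j · (P · H ^ (m ∸ j))) (j ℕ.+ (m ∸ j))
        ≡⟨ qPow-·-shift j (P · H ^ (m ∸ j)) (m ∸ j) ⟩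
      (P · H ^ (m ∸ j)) (m ∸ j) ∎
      where
      at-exponent : ∀ {x y} → x ≡ y → H ^ x ≈ H ^ y
      at-exponent refl = ≈-refl
    diag : ∀ {i} → i ≡ 0 → (P · H ^ i) i ≡ 1ℚ
    diag refl = trans (at (·-identityʳ P) 0) (affine-0 (+ 12) kχ₀)
    off : ∀ j → j ≢ m → (t ^ j · (P · H ^ m)) m ≡ 0ℚ
    off j j≢m with ℕₚ.<-cmp j m
    ... | tri≈ _ j≡m _ = contradiction j≡m j≢m
    ... | tri> _ _ m<j = trans (at (≈-trans (·-cong (t^ j) ≈-refl) (·-assoc (qPow j) (R ^ j) (P · H ^ m))) m) (qPow-·-< (R ^ j · (P · H ^ m)) m<j)
    ... | tri< j<m _ _ = trans (residue j (ℕₚ.<⇒≤ j<m)) (positive (ℕₚ.m<n⇒0<n∸m j<m))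
      where
      positive : ∀ {i} → 0 ℕ.< i → (P · H ^ i) i ≡ 0ℚ
      positive {suc i} _ = PH^i-at-i i

-- The eta quotient H

⊛≈· : ∀ {f f′ g g′} → f ≈ f′ → g ≈ g′ → f ⊛ g ≈ f′ · g′
⊛≈· {f′ = f′} {g′ = g′} p q = pointwise λ n → trans (⊛-cong (at p) (at q) n) (sym (·-at f′ g′ n))

^S≈^ : ∀ f n → f ^S n ≈ f ^ n
^S≈^ f zero = pointwise oneS≗𝟙
^S≈^ f (suc n) = ⊛≈· ≈-refl (^S≈^ f n)

infix 4 _≈[_]_
_≈[_]_ : Series → ℕ → Series → Set
f ≈[ n ] g = ∀ {k} → k ℕ.≤ n → f k ≡ g k

·-cong-[] : ∀ n {f f′ g g′} → f ≈[ n ] f′ → g ≈[ n ] g′ → f · g ≈[ n ] f′ · g′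
·-cong-[] n p q {k} k≤n = ·-cong-≤ k (λ i≤k → p (ℕₚ.≤-trans i≤k k≤n)) (λ i≤k → q (ℕₚ.≤-trans i≤k k≤n))

^-cong-[] : ∀ n {f g} m → f ≈[ n ] g → f ^ m ≈[ n ] g ^ m
^-cong-[] n zero p _ = refl
^-cong-[] n (suc m) p = ·-cong-[] n p (^-cong-[] n m p)

module _ where
  open ≈-Reasoning
  open Series-Solver

  -- The logarithmic derivative of 1/(1 - q^k) is k X_k, and that of 1 - q^k is its negative; this
  -- is how an eta product leads to a Lambert series.
  D-geom : ∀ k → D (geom (suc k)) ≈ geom (suc k) · (constS (ℕ→ℚ (suc k)) · X (suc k))
  D-geom k = begin
    D (geom (suc k))                        ≈⟨ D-cong (geom≈ k) ⟩
    D (𝟙 ⊕ x)                               ≈⟨ ≈-trans (D-⊕ 𝟙 x) (⊕-cong (D-constS 1ℚ) (D-X k)) ⟩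
    𝟘 ⊕ c · (x ⊕ x · x)                     ≈⟨ solve 2 (λ c x → con (+ 0) :+ c :* (x :+ x :* x) := (con (+ 1) :+ x) :* (c :* x)) ≈-refl c x ⟩
    (𝟙 ⊕ x) · (c · x)                       ≈⟨ ·-cong (geom≈ k) ≈-refl ⟨
    geom (suc k) · (c · x)                  ∎
    where
    x = X (suc k)
    c = constS (ℕ→ℚ (suc k))

  D-oneMinusQ : ∀ k → D (oneMinusQ (suc k)) ≈ oneMinusQ (suc k) · (⊖ (constS (ℕ→ℚ (suc k)) · X (suc k)))
  D-oneMinusQ k = begin
    D (oneMinusQ (suc k))                   ≈⟨ D-cong (oneMinusQ≈ k) ⟩
    D (𝟙 ⊝ u)                               ≈⟨ ≈-trans (D-⊝ 𝟙 u) (⊕-cong (D-constS 1ℚ) (⊖-cong (D-qPow (suc k)))) ⟩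
    𝟘 ⊝ c · u                               ≈⟨ solve 3 (λ c u g → con (+ 0) :- c :* u := (con (+ 1) :- u) :* (:- (c :* (u :* g)))
                                                  :+ c :* u :* (g :- (con (+ 1) :+ u :* g))) ≈-refl c u g ⟩
    (𝟙 ⊝ u) · (⊖ (c · (u · g))) ⊕ c · u · (g ⊝ (𝟙 ⊕ u · g))
                                            ≈⟨ drop-⊝ _ (c · u) (geom≈ k) ⟩
    (𝟙 ⊝ u) · (⊖ (c · (u · g)))             ≈⟨ ·-cong (oneMinusQ≈ k) ≈-refl ⟨
    oneMinusQ (suc k) · (⊖ (c · (u · g)))   ∎
    where
    u = qPow (suc k)
    g = geom (suc k)
    c = constS (ℕ→ℚ (suc k))

ηFactor : ℕ → Series
ηFactor n = (oneMinusQ n ^S 12) ⊛ (geom (3 ℕ.* n) ^S 12)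

ηFactor≈ : ∀ n → ηFactor n ≈ oneMinusQ n ^ 12 · geom (3 ℕ.* n) ^ 12
ηFactor≈ n = ⊛≈· (^S≈^ (oneMinusQ n) 12) (^S≈^ (geom (3 ℕ.* n)) 12)

ηFactor-≈[] : ∀ n → ηFactor (suc n) ≈[ n ] 𝟙
ηFactor-≈[] n {k} k≤n = trans (at (ηFactor≈ (suc n)) k)
  (trans (·-cong-[] n (^-cong-[] n 12 oneMinusQ≈1) (^-cong-[] n 12 geom≈1) k≤n)
    (trans (at (·-cong (𝟙-^ 12) (𝟙-^ 12)) k) (at (·-identityˡ 𝟙) k)))
  where
  oneMinusQ≈1 : oneMinusQ (suc n) ≈[ n ] 𝟙
  oneMinusQ≈1 {k} k≤n = trans (at (oneMinusQ≈ n) k) (trans (⊝-at 𝟙 (qPow (suc n)) k)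
    (trans (cong (λ z → 𝟙 k - z) (qPow-off (ℕₚ.<⇒≢ (s≤s k≤n) ∘ sym))) (ℚₚ.+-identityʳ (𝟙 k))))
  geom≈1 : geom (3 ℕ.* suc n) ≈[ n ] 𝟙
  geom≈1 k≤n = geom-< (s≤s (ℕₚ.≤-trans k≤n (ℕₚ.m≤m+n n (2 ℕ.* suc n))))

-- Each coefficient of `H` is read off a different partial product. Because the factor of index k is
-- 1 up to q^(k-1), a single partial product can stand for `H` up to any given degree.
prodS-stable : ∀ {n K} → n ℕ.≤ K → prodS K ηFactor n ≡ prodS n ηFactor n
prodS-stable {n} {K} n≤K with ℕₚ.m≤n⇒m<n∨m≡n n≤K
... | inj₂ refl = refl
prodS-stable {n} {suc K} n≤K | inj₁ (s≤s n≤K′) = begin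
  (prodS K ηFactor ⊛ ηFactor (suc K)) n   ≡⟨ ·-at (prodS K ηFactor) (ηFactor (suc K)) n ⟨
  (prodS K ηFactor · ηFactor (suc K)) n   ≡⟨ ·-cong-≤ n (λ _ → refl) (λ k≤n → ηFactor-≈[] K (ℕₚ.≤-trans k≤n n≤K′)) ⟩
  (prodS K ηFactor · 𝟙) n                 ≡⟨ at (·-identityʳ (prodS K ηFactor)) n ⟩
  prodS K ηFactor n                       ≡⟨ prodS-stable n≤K′ ⟩
  prodS n ηFactor n                       ∎
  where open ≡-Reasoning

partialLam : (ℕ → ℚ) → ℕ → Series
partialLam f zero = 𝟘
partialLam f (suc K) = partialLam f K ⊕ constS (f (suc K)) · X (suc K)

partialLam-at : ∀ f K {n} → n ℕ.≤ K → partialLam f K n ≡ Lam f n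
partialLam-at f zero z≤n = sym (trans (cong (f 1 *_) (X-< {1} {0} (s≤s z≤n))) (ℚₚ.*-zeroʳ (f 1)))
partialLam-at f (suc K) {n} n≤K = begin
  partialLam f (suc K) n                                                   ≡⟨ as-sum K n ⟩
  sumTo K (λ i → f (suc i) * X (suc i) n)                                  ≡⟨ ℚₚ.+-identityʳ _ ⟨
  sumTo K (λ i → f (suc i) * X (suc i) n) + 0ℚ                             ≡⟨ cong (λ z → sumTo K (λ i → f (suc i) * X (suc i) n) + z)
                                                                                (sym (trans (cong (f (2 ℕ.+ K) *_) (X-< (s≤s n≤K))) (ℚₚ.*-zeroʳ (f (2 ℕ.+ K))))) ⟩
  sumTo (suc K) (λ i → f (suc i) * X (suc i) n)                            ≡⟨ Lam-extend f n≤K ⟨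
  Lam f n                                                                  ∎
  where
  open ≡-Reasoning
  step : ∀ K n → partialLam f (suc K) n ≡ partialLam f K n + f (suc K) * X (suc K) n
  step K n = trans (⊕-at (partialLam f K) (constS (f (suc K)) · X (suc K)) n)
    (cong (λ z → partialLam f K n + z) (constS-· (f (suc K)) (X (suc K)) n))
  as-sum : ∀ K n → partialLam f (suc K) n ≡ sumTo K (λ i → f (suc i) * X (suc i) n)
  as-sum zero n = trans (step 0 n) (trans (cong (_+ f 1 * X 1 n) (𝟘-at n)) (ℚₚ.+-identityˡ (f 1 * X 1 n)))
  as-sum (suc K) n = trans (step (suc K) n) (cong (_+ f (2 ℕ.+ K) * X (2 ℕ.+ K) n) (as-sum K n))

-- Weight for the terms 3k X_{3k} coming from the denominators 1 - q^(3k). Indexing by 3k with an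
-- indicator, instead of by k, allows a termwise comparison with the sum of k X_k.
multipleOf3 : ℕ → ℚ
multipleOf3 k = ℕ→ℚ k * ℤ→ℚ (δ (res k) r0)

res-*3 : ∀ K → res (K ℕ.* 3) ≡ r0
res-*3 zero = refl
res-*3 (suc K) = cong (next ∘ next ∘ next) (res-*3 K)

partialLam-multipleOf3 : ∀ K → partialLam multipleOf3 (suc K ℕ.* 3)
  ≈ partialLam multipleOf3 (K ℕ.* 3) ⊕ constS (ℕ→ℚ (suc K ℕ.* 3)) · X (suc K ℕ.* 3)
partialLam-multipleOf3 K with K ℕ.* 3 | res-*3 K
... | J | r≡0 = begin
  partialLam multipleOf3 J ⊕ constS (multipleOf3 (1 ℕ.+ J)) · X (1 ℕ.+ J) ⊕ constS (multipleOf3 (2 ℕ.+ J)) · X (2 ℕ.+ J)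
      ⊕ constS (multipleOf3 (3 ℕ.+ J)) · X (3 ℕ.+ J)
    ≈⟨ ⊕-cong (⊕-cong (⊕-cong ≈-refl (·-cong (coefficient 1 r1 (cong next r≡0)) ≈-refl))
        (·-cong (coefficient 2 r2 (cong (next ∘ next) r≡0)) ≈-refl)) (·-cong (coefficient 3 r0 (cong (next ∘ next ∘ next) r≡0)) ≈-refl) ⟩
  partialLam multipleOf3 J ⊕ constS (ℕ→ℚ (1 ℕ.+ J)) · 𝟘 · X (1 ℕ.+ J) ⊕ constS (ℕ→ℚ (2 ℕ.+ J)) · 𝟘 · X (2 ℕ.+ J)
      ⊕ constS (ℕ→ℚ (3 ℕ.+ J)) · 𝟙 · X (3 ℕ.+ J)
    ≈⟨ solve 7 (λ p a x b y c z → p :+ a :* con (+ 0) :* x :+ b :* con (+ 0) :* y :+ c :* con (+ 1) :* z := p :+ c :* z) ≈-refl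
        (partialLam multipleOf3 J) (constS (ℕ→ℚ (1 ℕ.+ J))) (X (1 ℕ.+ J)) (constS (ℕ→ℚ (2 ℕ.+ J))) (X (2 ℕ.+ J)) (constS (ℕ→ℚ (3 ℕ.+ J))) (X (3 ℕ.+ J)) ⟩
  partialLam multipleOf3 J ⊕ constS (ℕ→ℚ (3 ℕ.+ J)) · X (3 ℕ.+ J) ∎
  where
  open ≈-Reasoning
  open Series-Solver
  coefficient : ∀ i r → res (i ℕ.+ J) ≡ r → constS (multipleOf3 (i ℕ.+ J)) ≈ constS (ℕ→ℚ (i ℕ.+ J)) · ℤ→Series (δ r r0)
  coefficient i r refl = pointwise λ where
    zero → sym (constS-· (ℕ→ℚ (i ℕ.+ J)) (ℤ→Series (δ r r0)) 0)
    (suc n) → sym (trans (constS-· (ℕ→ℚ (i ℕ.+ J)) (ℤ→Series (δ r r0)) (suc n)) (ℚₚ.*-zeroʳ (ℕ→ℚ (i ℕ.+ J))))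

logDerivative : ℕ → Series
logDerivative K = ℤ→Series (+ 12) · (partialLam multipleOf3 (K ℕ.* 3) ⊝ partialLam ℕ→ℚ K)

D-ηFactor : ∀ k → D (ηFactor (suc k)) ≈ ηFactor (suc k) · (ℤ→Series (+ 12) ·
  (constS (ℕ→ℚ (suc k ℕ.* 3)) · X (suc k ℕ.* 3) ⊝ constS (ℕ→ℚ (suc k)) · X (suc k)))
D-ηFactor k = begin
  D (ηFactor (suc k))
    ≈⟨ ≈-trans (D-cong (ηFactor≈ (suc k))) (D-· f g) ⟩
  D f · g ⊕ f · D g
    ≈⟨ ⊕-cong (·-cong (D-^ (oneMinusQ (suc k)) (⊖ x) 12 (D-oneMinusQ k)) ≈-refl)
        -- `3 * suc k` computes to `suc (k + 2 * suc k)`, which supplies the predecessor for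
        -- `D-geom`.
        (·-cong ≈-refl (D-^ (geom (3 ℕ.* suc k)) y 12 (D-geom (k ℕ.+ 2 ℕ.* suc k)))) ⟩
  ℤ→Series (+ 12) · (f · ⊖ x) · g ⊕ f · (ℤ→Series (+ 12) · (g · y))
    ≈⟨ solve 4 (λ f g x y → con (+ 12) :* (f :* :- x) :* g :+ f :* (con (+ 12) :* (g :* y)) := f :* g :* (con (+ 12) :* (y :- x))) ≈-refl f g x y ⟩
  f · g · (ℤ→Series (+ 12) · (y ⊝ x))
    ≈⟨ ·-cong (≈-sym (ηFactor≈ (suc k))) (·-cong ≈-refl (⊕-cong (index (ℕₚ.*-comm 3 (suc k))) ≈-refl)) ⟩
  ηFactor (suc k) · (ℤ→Series (+ 12) · (constS (ℕ→ℚ (suc k ℕ.* 3)) · X (suc k ℕ.* 3) ⊝ x)) ∎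
  where
  open ≈-Reasoning
  open Series-Solver
  f = oneMinusQ (suc k) ^ 12
  g = geom (3 ℕ.* suc k) ^ 12
  x = constS (ℕ→ℚ (suc k)) · X (suc k)
  y = constS (ℕ→ℚ (3 ℕ.* suc k)) · X (3 ℕ.* suc k)
  index : ∀ {i j} → i ≡ j → constS (ℕ→ℚ i) · X i ≈ constS (ℕ→ℚ j) · X j
  index refl = ≈-refl

D-prodS : ∀ K → D (prodS K ηFactor) ≈ prodS K ηFactor · logDerivative K
D-prodS zero = ≈-trans (D-cong (pointwise oneS≗𝟙)) (≈-trans (D-constS 1ℚ)
  (solve 1 (λ x → con (+ 0) := x :* (con (+ 12) :* (con (+ 0) :- con (+ 0)))) ≈-refl oneS))
  where open Series-Solver
D-prodS (suc K) = begin
  D (p ⊛ ηFactor (suc K))                 ≈⟨ ≈-trans (D-cong (⊛≈· ≈-refl ≈-refl)) (D-· p (ηFactor (suc K))) ⟩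
  D p · η ⊕ p · D η                       ≈⟨ ⊕-cong (·-cong (D-prodS K) ≈-refl) (·-cong ≈-refl (D-ηFactor K)) ⟩
  p · (ℤ→Series (+ 12) · (m ⊝ l)) · η ⊕ p · (η · (ℤ→Series (+ 12) · (y ⊝ x)))
    ≈⟨ solve 6 (λ p η m l y x → p :* (con (+ 12) :* (m :- l)) :* η :+ p :* (η :* (con (+ 12) :* (y :- x)))
        := p :* η :* (con (+ 12) :* (m :+ y :- (l :+ x)))) ≈-refl p η m l y x ⟩
  p · η · (ℤ→Series (+ 12) · (m ⊕ y ⊝ (l ⊕ x)))
    ≈⟨ ·-cong (≈-sym (⊛≈· ≈-refl ≈-refl)) (·-cong ≈-refl (⊕-cong (≈-sym (partialLam-multipleOf3 K)) ≈-refl)) ⟩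
  (p ⊛ η) · logDerivative (suc K) ∎
  where
  open ≈-Reasoning
  open Series-Solver
  p = prodS K ηFactor
  η = ηFactor (suc K)
  m = partialLam multipleOf3 (K ℕ.* 3)
  l = partialLam ℕ→ℚ K
  x = constS (ℕ→ℚ (suc K)) · X (suc K)
  y = constS (ℕ→ℚ (suc K ℕ.* 3)) · X (suc K ℕ.* 3)

-- Removing the multiples of 3 from the sum of k X_k leaves the weight k χ₀(k), so the limit is -12
-- times the Lambert series in `P`.
logDerivative-≈[] : ∀ K → logDerivative K ≈[ K ] 𝟙 ⊝ P
logDerivative-≈[] K {n} n≤K = trans (·-cong-≤ n (λ _ → refl) λ {k} k≤n → trans
    (⊝-at (partialLam multipleOf3 (K ℕ.* 3)) (partialLam ℕ→ℚ K) k)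
    (trans (cong₂ _-_ (partialLam-at multipleOf3 (K ℕ.* 3) (ℕₚ.≤-trans k≤n (ℕₚ.≤-trans n≤K (ℕₚ.m≤m*n K 3))))
                      (partialLam-at ℕ→ℚ K (ℕₚ.≤-trans k≤n n≤K)))
           (sym (⊝-at (Lam multipleOf3) (Lam ℕ→ℚ) k))))
  (at total n)
  where
  open ≈-Reasoning
  open Series-Solver
  split : ∀ k → ℕ→ℚ (suc k) ≡ weight kχ₀ (suc k) + multipleOf3 (suc k)
  split k = check (λ _ _ → K′) (λ r _ → K′ QS.:* QS.con (χ₀ r) QS.:+ K′ QS.:* QS.con (δ r r0)) (res (suc k)) r0 (ℕ→ℚ (suc k)) 0ℚ
    where
    module QS = ℚ-Solver
    K′ = QS.var {2} zero
  total : ℤ→Series (+ 12) · (Lam multipleOf3 ⊝ Lam ℕ→ℚ) ≈ 𝟙 ⊝ P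
  total = begin
    ℤ→Series (+ 12) · (Lam multipleOf3 ⊝ Lam ℕ→ℚ)
      ≈⟨ ·-cong ≈-refl (⊕-cong ≈-refl (⊖-cong (≈-trans (Lam-cong {ℕ→ℚ} {λ k → weight kχ₀ k + multipleOf3 k} split) (Lam-⊕ (weight kχ₀) multipleOf3)))) ⟩
    ℤ→Series (+ 12) · (Lam multipleOf3 ⊝ (lam kχ₀ ⊕ Lam multipleOf3))
      ≈⟨ solve 2 (λ m z → con (+ 12) :* (m :- (z :+ m)) := con (+ 1) :- (con (+ 1) :+ con (+ 12) :* z)) ≈-refl (Lam multipleOf3) (lam kχ₀) ⟩
    𝟙 ⊝ P ∎

D-H : D H ≈ H · (𝟙 ⊝ P)
D-H = pointwise λ n → begin
  ℕ→ℚ n * H n                              ≡⟨ at (D-prodS n) n ⟩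
  (prodS n ηFactor · logDerivative n) n    ≡⟨ ·-cong-≤ n prodS-stable (logDerivative-≈[] n) ⟩
  (H · (𝟙 ⊝ P)) n                          ∎
  where open ≡-Reasoning

-- The coefficients B

invFact-suc : ∀ n → ℕ→ℚ (suc n) * invFact (suc n) ≡ invFact n
invFact-suc n = ℚₚ.toℚᵘ-injective (begin
  toℚᵘ (ℕ→ℚ (suc n) * invFact (suc n))              ≈⟨ ℚₚ.toℚᵘ-homo-* (ℕ→ℚ (suc n)) (invFact (suc n)) ⟩
  toℚᵘ (ℕ→ℚ (suc n)) ℚᵘ.* toℚᵘ (invFact (suc n))    ≈⟨ ℚᵘₚ.*-cong (toℚᵘ-ℤ→ℚ (+ suc n)) (toℚᵘ-invFact (suc n)) ⟩
  (+ suc n ℚᵘ./ 1) ℚᵘ.* 1/ (suc n)                  ≈⟨ ℚᵘₚ.*-cong (ℚᵘₚ.≃-refl {+ suc n ℚᵘ./ 1}) (ℚᵘₚ.≃-refl {1/ (suc n)}) ⟩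
  (+ suc n ℚᵘ./ 1) ℚᵘ.* 1/ (suc n)                  ≈⟨ cancel ⟩
  1/ n                                              ≈⟨ toℚᵘ-invFact n ⟨
  toℚᵘ (invFact n)                                  ∎)
  where
  open ℚᵘₚ.≃-Reasoning
  1/ : ℕ → ℚᵘ.ℚᵘ
  1/ k = ((+ 1) ℚᵘ./ (k !)) {{k !≢0}}
  toℚᵘ-invFact : ∀ k → toℚᵘ (invFact k) ℚᵘ.≃ 1/ k
  toℚᵘ-invFact k with k ! | k !≢0
  ... | suc d | _ = ℚₚ.toℚᵘ-fromℚᵘ ((+ 1) ℚᵘ./ suc d)
  cancel : (+ suc n ℚᵘ./ 1) ℚᵘ.* 1/ (suc n) ℚᵘ.≃ 1/ n
  cancel with n ! | n !≢0 | suc n ! in eq | suc n !≢0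
  ... | suc d | _ | suc d′ | _ = ℚᵘ.*≡* (trans (cong (ℤ._* + suc d) (ℤₚ.*-identityʳ (+ suc n)))
    (trans (sym (ℤₚ.pos-* (suc n) (suc d))) (trans (cong +_ (trans eq (sym (ℕₚ.*-identityˡ (suc d′))))) (sym (ℤₚ.*-identityˡ _)))))

-- The substitution z ↦ c z. It is multiplicative, so the factors 27^n and (-1)^n can be moved
-- inside the cube.
scale : ℚ → Series → Series
scale c f n = (c ^ℚ n) * f n

^ℚ-+ : ∀ c m n → c ^ℚ (m ℕ.+ n) ≡ (c ^ℚ m) * (c ^ℚ n)
^ℚ-+ c zero n = sym (ℚₚ.*-identityˡ (c ^ℚ n))
^ℚ-+ c (suc m) n = trans (cong (c *_) (^ℚ-+ c m n)) (sym (ℚₚ.*-assoc c (c ^ℚ m) (c ^ℚ n)))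

scale-⊛ : ∀ c f g → scale c (f ⊛ g) ≗ scale c f ⊛ scale c g
scale-⊛ c f g n = trans (sym (sum-*ˡ n (c ^ℚ n) (λ k → f k * g (n ∸ k)))) (sum-cong n λ {k} k≤n → trans
  (cong (_* (f k * g (n ∸ k))) (trans (cong (c ^ℚ_) (sym (ℕₚ.m+[n∸m]≡n k≤n))) (^ℚ-+ c k (n ∸ k))))
  (solve 4 (λ a b x y → a :* b :* (x :* y) := a :* x :* (b :* y)) refl (c ^ℚ k) (c ^ℚ (n ∸ k)) (f k) (g (n ∸ k))))
  where open ℚ-Solver

scale-^S : ∀ c f m → scale c (f ^S m) ≗ scale c f ^S m
scale-^S c f zero zero = refl
scale-^S c f zero (suc n) = ℚₚ.*-zeroʳ (c ^ℚ suc n)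
scale-^S c f (suc m) n = trans (scale-⊛ c f (f ^S m) n) (⊛-cong {scale c f} (λ _ → refl) (scale-^S c f m) n)

scaledF21 : Series
scaledF21 = scale (- 1ℚ) (scale (ℕ→ℚ 27) (F21 (+ 1 / 3) (+ 1 / 3)))

B≡scaledF21³ : ∀ m → B m ≡ (scaledF21 ^ 3) m
B≡scaledF21³ m = trans (cong (((- 1ℚ) ^ℚ m) *_) (scale-^S (ℕ→ℚ 27) (F21 (+ 1 / 3) (+ 1 / 3)) 3 m))
  (trans (scale-^S (- 1ℚ) (scale (ℕ→ℚ 27) (F21 (+ 1 / 3) (+ 1 / 3))) 3 m) (at (^S≈^ scaledF21 3) m))

-- The recurrence is 27 (k + 1/3)² = 27 k² + 18 k + 3. The parameter 1/3 is abstracted to t, with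
-- its two numerical products as hypotheses, since the solver knows integer constants only.
hypergeometric-step : ∀ t → ℤ→ℚ (+ 54) * t ≡ ℤ→ℚ (+ 18) → ℤ→ℚ (+ 27) * t * t ≡ ℤ→ℚ (+ 3) → ∀ s i f → s * i ≡ f → ∀ k u v x →
  s * (s * (ℤ→ℚ (ℤ.- + 1) * u * (ℤ→ℚ (+ 27) * v * (x * (t + k) * (x * (t + k)) * i * i))))
  ≡ - (ℤ→ℚ (+ 27) * (k * (k * (u * (v * (x * x * f * f))))) + ℤ→ℚ (+ 18) * (k * (u * (v * (x * x * f * f)))) + ℤ→ℚ (+ 3) * (u * (v * (x * x * f * f))))
hypergeometric-step t 54t≡18 27t²≡3 s i f refl k u v x = trans
  (solve 7 (λ s u v x t k i → s :* (s :* (con (ℤ.- + 1) :* u :* (con (+ 27) :* v :* (x :* (t :+ k) :* (x :* (t :+ k)) :* i :* i))))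
    := let y = u :* (v :* (x :* x :* (s :* i) :* (s :* i))) in
       :- (con (+ 27) :* (k :* (k :* y)) :+ con (+ 54) :* t :* (k :* y) :+ con (+ 27) :* t :* t :* y))
    refl s u v x t k i)
  (cong₂ (λ a b → - (ℤ→ℚ (+ 27) * (k * (k * y)) + a * (k * y) + b * y)) 54t≡18 27t²≡3)
  where
  open ℚ-Solver
  y = u * (v * (x * x * (s * i) * (s * i)))

scaledF21-suc : ∀ j → ℕ→ℚ (suc j) * (ℕ→ℚ (suc j) * scaledF21 (suc j))
  ≡ - (ℤ→ℚ (+ 27) * (ℕ→ℚ j * (ℕ→ℚ j * scaledF21 j)) + ℤ→ℚ (+ 18) * (ℕ→ℚ j * scaledF21 j) + ℤ→ℚ (+ 3) * scaledF21 j)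
scaledF21-suc j = hypergeometric-step (+ 1 / 3) refl refl (ℕ→ℚ (suc j)) (invFact (suc j)) (invFact j) (invFact-suc j)
  (ℕ→ℚ j) ((- 1ℚ) ^ℚ j) (ℕ→ℚ 27 ^ℚ j) (poch (+ 1 / 3) j)

-- C is the Eisenstein series E₅

χ₃-cong : ∀ m n → m ℕ.% 3 ≡ n ℕ.% 3 → χ₃ m ≡ χ₃ n
χ₃-cong m n eq with m ℕ.% 3 | n ℕ.% 3 | eq
... | 0 | _ | refl = refl
... | 1 | _ | refl = refl
... | suc (suc _) | _ | refl = refl

χ₃≡χ : ∀ n → χ₃ n ≡ χ (res n)
χ₃≡χ 0 = refl
χ₃≡χ 1 = refl
χ₃≡χ 2 = refl
χ₃≡χ (suc (suc (suc n))) = trans (χ₃-cong (3 ℕ.+ n) n (trans (cong (ℕ._% 3) (ℕₚ.+-comm 3 n)) (DivMod.[m+n]%n≡m%n n 3)))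
  (trans (χ₃≡χ n) (cong χ (period (res n))))
  where
  period : ∀ r → r ≡ next (next (next r))
  period r0 = refl
  period r1 = refl
  period r2 = refl

-- Recovers the local summand of `cCoeff` by unification, as `summand` does for `geom`.
cSummand : ∀ {n f} (x : ℚ) → x ≡ ℕ→ℚ 3 * sumTo n f → ℕ → ℚ
cSummand {f = f} _ _ = f

cTerm : ℕ → ℕ → ℚ
cTerm n = cSummand {n} (cCoeff n) refl

cTerm-0 : ∀ n → cTerm n 0 ≡ 0ℚ
cTerm-0 n with 0 ∣? n
... | yes _ = refl
... | no _ = refl

cTerm-∣ : ∀ n d → suc d ∣ n → cTerm n (suc d) ≡ ℤ→ℚ (χ₃ (suc d)) * (ℕ→ℚ (suc d) ^ℚ 4)
cTerm-∣ n d d∣n with suc d ∣? n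
... | yes _ = refl
... | no d∤n = contradiction d∣n d∤n

cTerm-∤ : ∀ n d → ¬ suc d ∣ n → cTerm n (suc d) ≡ 0ℚ
cTerm-∤ n d d∤n with suc d ∣? n
... | yes d∣n = contradiction d∣n d∤n
... | no _ = refl

-- At q^n with n positive, X_k has coefficient 1 if k divides n and 0 otherwise, so a Lambert series
-- has divisor sums as coefficients.
C≈E₅ : C ≈ E₅
C≈E₅ = pointwise λ { zero → sym (affine-0 (+ 3) k⁴χ) ; (suc n) → sym (positive n) }
  where
  open ≡-Reasoning
  term : ∀ n i → weight k⁴χ (suc i) * X (suc i) (suc n) ≡ cTerm (suc n) (suc i)
  term n i with suc i ∣? suc n
  ... | yes i∣n = trans (cong₂ (λ c x → ℕ→ℚ (suc i) * (ℕ→ℚ (suc i) * (ℕ→ℚ (suc i) * (ℕ→ℚ (suc i) * ℤ→ℚ c))) * x)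
      (sym (χ₃≡χ (suc i))) (trans (X-suc i n) (geom-∣ i∣n)))
    (solve 2 (λ k c → k :* (k :* (k :* (k :* c))) :* con (+ 1) := c :* (k :* (k :* (k :* (k :* con (+ 1)))))) refl
      (ℕ→ℚ (suc i)) (ℤ→ℚ (χ₃ (suc i))))
    where open ℚ-Solver
  ... | no i∤n = trans (cong (weight k⁴χ (suc i) *_) (trans (X-suc i n) (geom-∤ i∤n))) (ℚₚ.*-zeroʳ (weight k⁴χ (suc i)))
  sums : ∀ n → lam k⁴χ (suc n) ≡ sumTo (suc n) (cTerm (suc n))
  sums n = begin
    -- The Lambert sum runs over 1, ..., n + 2 and the divisor sum over 0, ..., n + 1; the extra
    -- term at either end is zero.
    sumTo n (λ i → weight k⁴χ (suc i) * X (suc i) (suc n)) + weight k⁴χ (2 ℕ.+ n) * X (2 ℕ.+ n) (suc n)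
      ≡⟨ cong₂ _+_ (sum-cong n λ {i} _ → term n i) (trans (cong (weight k⁴χ (2 ℕ.+ n) *_) (X-< (ℕₚ.≤-refl {2 ℕ.+ n}))) (ℚₚ.*-zeroʳ (weight k⁴χ (2 ℕ.+ n)))) ⟩
    sumTo n (λ i → cTerm (suc n) (suc i)) + 0ℚ
      ≡⟨ ℚₚ.+-comm (sumTo n (λ i → cTerm (suc n) (suc i))) 0ℚ ⟩
    0ℚ + sumTo n (λ i → cTerm (suc n) (suc i))
      ≡⟨ cong (_+ sumTo n (λ i → cTerm (suc n) (suc i))) (cTerm-0 (suc n)) ⟨
    cTerm (suc n) 0 + sumTo n (λ i → cTerm (suc n) (suc i))
      ≡⟨ sum-head n (cTerm (suc n)) ⟨
    sumTo (suc n) (cTerm (suc n)) ∎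
  positive : ∀ n → E₅ (suc n) ≡ cCoeff (suc n)
  positive n = begin
    E₅ (suc n)                                ≡⟨ ⊕-at 𝟙 (ℤ→Series (+ 3) · lam k⁴χ) (suc n) ⟩
    0ℚ + (ℤ→Series (+ 3) · lam k⁴χ) (suc n)   ≡⟨ ℚₚ.+-identityˡ _ ⟩
    (ℤ→Series (+ 3) · lam k⁴χ) (suc n)        ≡⟨ constS-· (ℤ→ℚ (+ 3)) (lam k⁴χ) (suc n) ⟩
    ℤ→ℚ (+ 3) * lam k⁴χ (suc n)               ≡⟨ cong (ℤ→ℚ (+ 3) *_) (sums n) ⟩
    cCoeff (suc n)                            ∎

C·H^m-at-m : ∀ m → (C · H ^ m) m ≡ B m
C·H^m-at-m m = trans
  (at (·-cong (≈-trans C≈E₅ (E₅≈ scaledF21 refl scaledF21-suc)) ≈-refl) m)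
  (trans (lagrange (scaledF21 ^ 3) m) (sym (B≡scaledF21³ m)))
  where open Hauptmodul H refl D-H

-- Integrality and divisibility

-- Divisibility with an integer quotient: the congruence is obtained with denominator 1, since all
-- coefficients involved are integers.
record IsMultiple (d : ℕ) (x : ℚ) : Set where
  constructor multiple
  field
    quotient : ℤ
    equality : x ≡ ℤ→ℚ (+ d) * ℤ→ℚ quotient

record IsInteger (x : ℚ) : Set where
  constructor integer
  field
    value : ℤ
    equality : x ≡ ℤ→ℚ value

integer-+ : ∀ {x y} → IsInteger x → IsInteger y → IsInteger (x + y)
integer-+ (integer a refl) (integer b refl) = integer (a ℤ.+ b) (sym (ℤ→ℚ-+ a b))

integer-* : ∀ {x y} → IsInteger x → IsInteger y → IsInteger (x * y)
integer-* (integer a refl) (integer b refl) = integer (a ℤ.* b) (sym (ℤ→ℚ-* a b))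

integer-sum : ∀ n {f} → (∀ k → IsInteger (f k)) → IsInteger (sumTo n f)
integer-sum zero int = int 0
integer-sum (suc n) int = integer-+ (integer-sum n int) (int (suc n))

integer-⊛ : ∀ {f g} → (∀ n → IsInteger (f n)) → (∀ n → IsInteger (g n)) → ∀ n → IsInteger ((f ⊛ g) n)
integer-⊛ int-f int-g n = integer-sum n λ k → integer-* (int-f k) (int-g (n ∸ k))

integer-oneS : ∀ n → IsInteger (oneS n)
integer-oneS zero = integer (+ 1) refl
integer-oneS (suc _) = integer (+ 0) refl

integer-^S : ∀ {f} m → (∀ n → IsInteger (f n)) → ∀ n → IsInteger ((f ^S m) n)
integer-^S zero int = integer-oneS
integer-^S (suc m) int = integer-⊛ int (integer-^S m int)

integer-prodS : ∀ K {F} → (∀ k n → IsInteger (F k n)) → ∀ n → IsInteger (prodS K F n)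
integer-prodS zero int = integer-oneS
integer-prodS (suc K) int = integer-⊛ (integer-prodS K int) (int (suc K))

integer-oneMinusQ : ∀ k n → IsInteger (oneMinusQ k n)
integer-oneMinusQ k zero = integer (+ 1) refl
integer-oneMinusQ k (suc n) with suc n ≟ k
... | yes _ = integer -[1+ 0 ] refl
... | no _ = integer (+ 0) refl

integer-geom : ∀ k n → IsInteger (geom k n)
integer-geom k n = integer-sum n term
  where
  term : ∀ i → IsInteger (geomTerm k n i)
  term i with i ℕ.* k ≟ n
  ... | yes _ = integer (+ 1) refl
  ... | no _ = integer (+ 0) refl

integer-H : ∀ n → IsInteger (H n)
integer-H n = integer-prodS n (λ k → integer-⊛ (integer-^S 12 (integer-oneMinusQ k)) (integer-^S 12 (integer-geom (3 ℕ.* k)))) n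

multiple-0 : ∀ d → IsMultiple d 0ℚ
multiple-0 d = multiple (+ 0) (sym (ℚₚ.*-zeroʳ (ℤ→ℚ (+ d))))

multiple-+ : ∀ {d x y} → IsMultiple d x → IsMultiple d y → IsMultiple d (x + y)
multiple-+ {d} (multiple a refl) (multiple b refl) = multiple (a ℤ.+ b)
  (trans (sym (ℚₚ.*-distribˡ-+ (ℤ→ℚ (+ d)) (ℤ→ℚ a) (ℤ→ℚ b))) (cong (ℤ→ℚ (+ d) *_) (sym (ℤ→ℚ-+ a b))))

multiple-*ˡ : ∀ {d x y} → IsInteger x → IsMultiple d y → IsMultiple d (x * y)
multiple-*ˡ {d} (integer a refl) (multiple b refl) = multiple (a ℤ.* b) (trans
  (solve 3 (λ x d y → x :* (d :* y) := d :* (x :* y)) refl (ℤ→ℚ a) (ℤ→ℚ (+ d)) (ℤ→ℚ b)) (cong (ℤ→ℚ (+ d) *_) (sym (ℤ→ℚ-* a b))))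
  where open ℚ-Solver

multiple-- : ∀ {d x y} → IsMultiple d x → IsMultiple d y → IsMultiple d (x - y)
multiple-- {d} {x} {y} mx my = subst (IsMultiple d) (cong (λ z → x + z) (solve 1 (λ y → con (ℤ.- + 1) :* y := :- y) refl y))
  (multiple-+ mx (multiple-*ˡ (integer (ℤ.- + 1) refl) my))
  where open ℚ-Solver

multiple-sum : ∀ {d} n {f} → (∀ {k} → k ≤ n → IsMultiple d (f k)) → IsMultiple d (sumTo n f)
multiple-sum zero mul = mul z≤n
multiple-sum (suc n) mul = multiple-+ (multiple-sum n λ k≤n → mul (ℕₚ.m≤n⇒m≤1+n k≤n)) (mul ℕₚ.≤-refl)

-- Divisors of k p prime to p divide k, and the others contribute multiples of p⁴.

module _ {p : ℕ} (p-prime : Prime p) where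

  private
    instance
      p≢0 : ℕ.NonZero p
      p≢0 = prime⇒nonZero p-prime

  cTerm-multiple : ∀ n d → p ∣ suc d → IsMultiple (p ℕ.^ 4) (cTerm n (suc d))
  cTerm-multiple n d (divides e d≡ep) with suc d ∣? n
  ... | no _ = multiple-0 (p ℕ.^ 4)
  ... | yes _ = subst (IsMultiple (p ℕ.^ 4)) (sym (trans
      (cong (λ z → ℤ→ℚ (χ₃ (suc d)) * (z ^ℚ 4)) (trans (cong ℕ→ℚ d≡ep) (ℕ→ℚ-* e p)))
      (trans (solve 3 (λ c e p → c :* (e :* p :* (e :* p :* (e :* p :* (e :* p :* con (+ 1)))))
          := c :* (e :* (e :* (e :* e))) :* (p :* (p :* (p :* (p :* con (+ 1)))) :* con (+ 1))) refl (ℤ→ℚ (χ₃ (suc d))) (ℕ→ℚ e) (ℕ→ℚ p))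
        (cong (λ z → ℤ→ℚ (χ₃ (suc d)) * (ℕ→ℚ e * (ℕ→ℚ e * (ℕ→ℚ e * ℕ→ℚ e))) * (z * 1ℚ)) (sym (ℕ→ℚ-^ 4))))))
      (multiple-*ˡ (integer-* (integer (χ₃ (suc d)) refl) (integer-* int-e (integer-* int-e (integer-* int-e int-e)))) (multiple (+ 1) refl))
    where
    open ℚ-Solver
    int-e : IsInteger (ℕ→ℚ e)
    int-e = integer (+ e) refl
    ℕ→ℚ-^ : ∀ m → ℕ→ℚ (p ℕ.^ m) ≡ ℕ→ℚ p ^ℚ m
    ℕ→ℚ-^ zero = refl
    ℕ→ℚ-^ (suc m) = trans (ℕ→ℚ-* p (p ℕ.^ m)) (cong (ℕ→ℚ p *_) (ℕ→ℚ-^ m))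

  ∤⇒coprime : ∀ {d} → ¬ p ∣ d → Coprime d p
  ∤⇒coprime p∤d (c∣d , c∣p) with prime⇒irreducible p-prime c∣p
  ... | inj₁ c≡1 = c≡1
  ... | inj₂ refl = contradiction c∣d p∤d

  cTerm-congruent : ∀ k d → IsMultiple (p ℕ.^ 4) (cTerm (k ℕ.* p) d - cTerm k d)
  cTerm-congruent k zero = subst (IsMultiple (p ℕ.^ 4)) (sym (cong₂ _-_ (cTerm-0 (k ℕ.* p)) (cTerm-0 k))) (multiple-0 (p ℕ.^ 4))
  cTerm-congruent k (suc d) with p ∣? suc d
  ... | yes p∣d = multiple-- (cTerm-multiple (k ℕ.* p) d p∣d) (cTerm-multiple k d p∣d)
  ... | no p∤d = subst (IsMultiple (p ℕ.^ 4)) (sym (trans (cong (_- cTerm k (suc d)) equal) (ℚₚ.+-inverseʳ (cTerm k (suc d))))) (multiple-0 (p ℕ.^ 4))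
    where
    equal : cTerm (k ℕ.* p) (suc d) ≡ cTerm k (suc d)
    equal with suc d ∣? k
    ... | yes d∣k = cTerm-∣ (k ℕ.* p) d (∣m⇒∣m*n p d∣k)
    ... | no d∤k = cTerm-∤ (k ℕ.* p) d λ d∣kp → d∤k (coprime-divisor (∤⇒coprime p∤d) (subst (suc d ∣_) (ℕₚ.*-comm k p) d∣kp))

  cCoeff-congruent : ∀ k → IsMultiple (p ℕ.^ 4) (cCoeff (suc k ℕ.* p) - cCoeff (suc k))
  cCoeff-congruent k = subst (IsMultiple (p ℕ.^ 4)) (begin
    ℕ→ℚ 3 * sumTo kp (λ d → cTerm kp d - cTerm (suc k) d)
      ≡⟨ cong (ℕ→ℚ 3 *_) (trans (sum-+ kp (cTerm kp) (λ d → - cTerm (suc k) d)) (cong (λ z → sumTo kp (cTerm kp) + z) (sum-neg kp (cTerm (suc k))))) ⟩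
    ℕ→ℚ 3 * (sumTo kp (cTerm kp) - sumTo kp (cTerm (suc k)))
      -- Both divisor sums are taken up to kp for the termwise comparison; divisors of k + 1 do not
      -- exceed it, so its sum may be cut back afterwards.
      ≡⟨ cong (λ z → ℕ→ℚ 3 * (sumTo kp (cTerm kp) - z)) (sum-truncate (ℕₚ.m≤m*n (suc k) p) beyond) ⟩
    ℕ→ℚ 3 * (sumTo kp (cTerm kp) - sumTo (suc k) (cTerm (suc k)))
      ≡⟨ solve 2 (λ x y → con (+ 3) :* (x :- y) := con (+ 3) :* x :- con (+ 3) :* y) refl (sumTo kp (cTerm kp)) (sumTo (suc k) (cTerm (suc k))) ⟩
    cCoeff kp - cCoeff (suc k) ∎)
    (multiple-*ˡ (integer (+ 3) refl) (multiple-sum kp λ {d} _ → cTerm-congruent (suc k) d))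
    where
    open ≡-Reasoning
    open ℚ-Solver
    kp = suc k ℕ.* p
    beyond : ∀ {d} → suc k ℕ.< d → cTerm (suc k) d ≡ 0ℚ
    beyond {suc d} k<d = cTerm-∤ (suc k) d (>⇒∤ k<d)

  C-congruent : ∀ k → IsMultiple (p ℕ.^ 4) (C (k ℕ.* p) - C k)
  C-congruent zero = multiple-0 (p ℕ.^ 4)
  C-congruent (suc k) = subst (λ z → IsMultiple (p ℕ.^ 4) (z - cCoeff (suc k))) (sym (C-positive (ℕₚ.m≤n*m p (suc k)))) (cCoeff-congruent k)
    where
    C-positive : ∀ {n} → p ≤ n → C n ≡ cCoeff n
    C-positive {suc n} _ = refl
    C-positive {zero} p≤0 = contradiction (ℕₚ.n≤0⇒n≡0 p≤0) (ℕ.≢-nonZero⁻¹ p)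

  qPow-p-0 : qPow p 0 ≡ 0ℚ
  qPow-p-0 = qPow-off (ℕ.≢-nonZero⁻¹ p)

  open Composition (qPow p) qPow-p-0

  qPow-p^ : ∀ j → qPow p ^ j ≈ qPow (j ℕ.* p)
  qPow-p^ zero = pointwise λ _ → refl
  qPow-p^ (suc j) = ≈-trans (·-cong ≈-refl (qPow-p^ j)) (qPow-+ p (j ℕ.* p))

  dilate≈comp : ∀ f → dilate p f ≈ comp f
  dilate≈comp f = pointwise λ n → sum-cong n λ {k} _ → trans (term n k) (cong (f k *_) (sym (at (qPow-p^ k) n)))
    where
    term : ∀ n k → summand {n} (dilate p f n) refl k ≡ f k * qPow (k ℕ.* p) n
    term n k with k ℕ.* p ≟ n
    ... | yes refl = sym (trans (cong (f k *_) (qPow-diag (k ℕ.* p))) (ℚₚ.*-identityʳ (f k)))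
    ... | no kp≢n = sym (trans (cong (f k *_) (qPow-off kp≢n)) (ℚₚ.*-zeroʳ (f k)))

  -- Dilation is composition with t = q^p, so by `comp-^` it commutes with the m-th power. The term
  -- q^(jp) then meets the coefficient of C at (m - j) p, and no j > m contributes.
  M≡ : ∀ m → M m p ≡ sumTo m (λ j → (H ^ m) j * C ((m ∸ j) ℕ.* p))
  M≡ m = begin
    (C ⊛ (dilate p H ^S m)) (m ℕ.* p)
      ≡⟨ at (⊛≈· ≈-refl (≈-trans (^S≈^ (dilate p H) m) (≈-trans (^-cong m (dilate≈comp H)) (comp-^ H m)))) (m ℕ.* p) ⟩
    (C · comp (H ^ m)) (m ℕ.* p)
      ≡⟨ at (·-comm C (comp (H ^ m))) (m ℕ.* p) ⟩
    (comp (H ^ m) · C) (m ℕ.* p)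
      ≡⟨ comp-·-at (H ^ m) C (m ℕ.* p) ⟩
    sumTo (m ℕ.* p) (λ j → (H ^ m) j * (qPow p ^ j · C) (m ℕ.* p))
      ≡⟨ sum-truncate (ℕₚ.m≤m*n m p) (λ {j} m<j → trans (cong ((H ^ m) j *_)
          (trans (at (·-cong (qPow-p^ j) ≈-refl) (m ℕ.* p)) (qPow-·-< C (ℕₚ.*-monoˡ-< p m<j)))) (ℚₚ.*-zeroʳ ((H ^ m) j))) ⟩
    sumTo m (λ j → (H ^ m) j * (qPow p ^ j · C) (m ℕ.* p))
      ≡⟨ sum-cong m (λ {j} j≤m → cong ((H ^ m) j *_) (trans (at (·-cong (qPow-p^ j) ≈-refl) (m ℕ.* p))
          (trans (cong (qPow (j ℕ.* p) · C) (trans (cong (ℕ._* p) (sym (ℕₚ.m+[n∸m]≡n j≤m))) (ℕₚ.*-distribʳ-+ p j (m ∸ j))))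
            (qPow-·-shift (j ℕ.* p) C ((m ∸ j) ℕ.* p))))) ⟩
    sumTo m (λ j → (H ^ m) j * C ((m ∸ j) ℕ.* p)) ∎
    where open ≡-Reasoning

  -- `M` and `B` are sums with the same integral weights, the coefficients of H^m, applied to C at
  -- (m - j) p and at m - j; each difference is divisible by p⁴.
  M-congruent : ∀ m → IsMultiple (p ℕ.^ 4) (M m p - B m)
  M-congruent m = subst (IsMultiple (p ℕ.^ 4)) difference
    (multiple-sum m λ {j} _ → multiple-*ˡ (subst IsInteger (at (^S≈^ H m) j) (integer-^S m integer-H j)) (C-congruent (m ∸ j)))
    where
    open ≡-Reasoning
    open ℚ-Solver
    f g : ℕ → ℚ
    f j = (H ^ m) j * C ((m ∸ j) ℕ.* p)
    g j = (H ^ m) j * C (m ∸ j)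
    g-sum : sumTo m g ≡ B m
    g-sum = trans (sym (·-at (H ^ m) C m)) (trans (at (·-comm (H ^ m) C) m) (C·H^m-at-m m))
    difference : sumTo m (λ j → (H ^ m) j * (C ((m ∸ j) ℕ.* p) - C (m ∸ j))) ≡ M m p - B m
    difference = begin
      sumTo m (λ j → (H ^ m) j * (C ((m ∸ j) ℕ.* p) - C (m ∸ j)))
        ≡⟨ sum-cong m (λ {j} _ → solve 3 (λ h x y → h :* (x :- y) := h :* x :+ :- (h :* y)) refl ((H ^ m) j) (C ((m ∸ j) ℕ.* p)) (C (m ∸ j))) ⟩
      sumTo m (λ j → f j + - g j)          ≡⟨ sum-+ m f (λ j → - g j) ⟩
      sumTo m f + sumTo m (λ j → - g j)    ≡⟨ cong (λ z → sumTo m f + z) (sum-neg m g) ⟩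
      sumTo m f - sumTo m g                ≡⟨ cong₂ _-_ (sym (M≡ m)) g-sum ⟩
      M m p - B m                          ∎

theorem4p5 : (p m : ℕ) → Prime p → 5 ≤ p → 1 ≤ m →
    CongModPow p 4 (M m p) (B m)
theorem4p5 p m p-prime 5≤p _ = congruence (M m p) (B m) (M-congruent p-prime m)
  where
  p∤1 : ¬ p ∣ 1
  p∤1 p∣1 = contradiction (ℕₚ.≤-trans 5≤p (∣⇒≤ p∣1)) λ { (s≤s ()) }
  congruence : ∀ x y → IsMultiple (p ℕ.^ 4) (x - y) → CongModPow p 4 x y
  congruence x y (multiple z eq) = z , + 1 , p∤1 , trans (ℚₚ.*-identityʳ (x - y)) eq
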